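{- Let $\mathcal{G}=(V,\sigma,E_2\cup\dots\cup E_{n-1})$ be a signed colored graph of type $(n,n)$ such that: (1) $\mathcal G$ obeys Axiom 1; (2) $V\subseteq S_n$; (3) $\sigma(v)$ is the signature (given by inverse descents) of the permutation $v$; (4) for all $1<i<n$ and all $v\in V$ admitting an $i$-edge, $E_i(v)$ is Knuth equivalent to $d_i(v)$. Then $P\colon V\to\mathrm{SYT}(n)$ induces a morphism $\phi\colon\mathcal{G}\to\bigcup_{\lambda\vdash n}\mathcal{G}_\lambda$. Furthermore, \[\sum_{v\in V}F_{\sigma(v)}(X)=\sum_{\lambda\vdash n}\bigl|V\cap\mathrm{SYam}(\lambda)\bigr|\, s_\lambda .\]
   Context: Tableaux are in French notation (rows numbered bottom to top). $P(w)$ is the Robinson–Schensted insertion tableau of $w\in S_n$; two permutations are Knuth equivalent if they have the same insertion tableau. $U_\lambda$ is the standard Young tableau of shape $\lambda$ filled with $1,\dots,n$ row by row from bottom to top, each row left to right, and $\mathrm{SYam}(\lambda)=\{w\in S_n: P(w)=U_\lambda\}$. For $w\in S_n$, $\sigma(w)\in\{\pm1\}^{n-1}$ with $\sigma(w)_i=+1$ if $i$ appears before $i+1$ in $w$, $-1$ otherwise; a tableau's signature is that of its row reading word (rows read left to right, from the top row down). For $1<i<n$, $d_i$ fixes $w$ if the value $i$ lies positionally between $i-1$ and $i+1$; otherwise it interchanges $i$ with whichever of $i-1,i+1$ is not in the middle of the three positions; $d_i$ acts on tableaux via row reading words. For $\lambda\vdash n$, $\mathcal{G}_\lambda$ has vertex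 set $\mathrm{SYT}(\lambda)$, tableau signatures, and $i$-edges $\{T,d_i(T)\}$ with $d_i(T)\ne T$, $1<i<n$. A signed colored graph of type $(n,n)$ consists of a finite vertex set $V$, sets $E_i$ ($1<i<n$) of unordered pairs of distinct vertices, and $\sigma\colon V\to\{\pm1\}^{n-1}$; a morphism sends $i$-edges to $i$-edges and preserves signatures. A vertex $v$ admits an $i$-neighbor (equivalently, under Axiom 1, an $i$-edge) if $\sigma(v)_{i-1}=-\sigma(v)_i$. Axiom 1: each $E_i$ is a complete matching on the set of vertices admitting an $i$-neighbor; then $E_i(v)$ denotes the vertex matched with $v$. For $\sigma\in\{\pm1\}^{n-1}$, the fundamental quasisymmetric function is $F_\sigma(X)=\sum x_{i_1}\cdots x_{i_n}$, summed over $i_1\le\dots\le i_n$ (positive integers) such that $i_j=i_{j+1}$ implies $\sigma_j=+1$. $s_\lambda$ is the Schur function. -}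

module Defs where

open import Data.Bool using (Bool; true; false; _∧_; _∨_; not; if_then_else_)
open import Data.Nat using (ℕ; zero; suc; _+_; _*_; _∸_; _<ᵇ_; _≡ᵇ_; _<_; _≤ᵇ_)
import Data.Nat as ℕ
open import Data.List using (List; []; _∷_; [_]; map; concat; concatMap; reverse;
  length; filterᵇ; foldl; upTo; zip)
open import Data.Nat.ListAction using (sum)
open import Data.List.Properties using (≡-dec)
open import Data.Product using (_×_; _,_; proj₁; proj₂)
open import Data.Sum using (_⊎_)
open import Data.Maybe using (Maybe; just; nothing)
open import Relation.Nullary using (¬_; does)
open import Relation.Binary.PropositionalEquality using (_≡_; _≢_; refl)
open import Data.List.Membership.Propositional using (_∈_)
open import Data.List.Relation.Unary.Unique.Propositional using (Unique)
open import Data.List.Relation.Binary.Permutation.Propositional using (_↭_)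

allB : {A : Set} → (A → Bool) → List A → Bool
allB p [] = true
allB p (x ∷ xs) = p x ∧ allB p xs

Word : Set
Word = List ℕ

range1 : ℕ → List ℕ
range1 n = map suc (upTo n)

IsPerm : ℕ → Word → Set
IsPerm n w = w ↭ range1 n

-- first position (0-based) of value a in w (length w if absent)
pos : ℕ → Word → ℕ
pos a [] = 0
pos a (x ∷ xs) = if a ≡ᵇ x then 0 else suc (pos a xs)

-- signature: true = +1, false = -1; entry j (1 ≤ j ≤ n-1) is +1 iff j is before j+1
sig : ℕ → Word → List Bool
sig n w = map (λ j → pos j w <ᵇ pos (suc j) w) (range1 (n ∸ 1))

-- 1-based lookup in a sign vector (default +1 out of range)
sgnAt : List Bool → ℕ → Bool
sgnAt [] _ = true
sgnAt (b ∷ bs) zero = true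
sgnAt (b ∷ bs) (suc zero) = b
sgnAt (b ∷ bs) (suc (suc j)) = sgnAt bs (suc j)

-- Tableaux (French notation): list of rows, first row = bottom row

Tableau : Set
Tableau = List (List ℕ)

_==T_ : Tableau → Tableau → Bool
S ==T T = does (≡-dec (≡-dec ℕ._≟_) S T)

reading : Tableau → Word
reading T = concat (reverse T)

insertRow : ℕ → List ℕ → List ℕ × Maybe ℕ
insertRow x [] = [ x ] , nothing
insertRow x (y ∷ ys) with x <ᵇ y
... | true = (x ∷ ys) , just y
... | false = (y ∷ proj₁ (insertRow x ys)) , proj₂ (insertRow x ys)

insertT : ℕ → Tableau → Tableau
insertT x [] = [ [ x ] ]
insertT x (r ∷ rs) with insertRow x r
... | r' , nothing = r' ∷ rs
... | r' , just y = r' ∷ insertT y rs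

P : Word → Tableau
P w = foldl (λ T x → insertT x T) [] w

KnuthEq : Word → Word → Set
KnuthEq u w = P u ≡ P w

incr : List ℕ → Bool
incr [] = true
incr (x ∷ []) = true
incr (x ∷ y ∷ ys) = (x <ᵇ y) ∧ incr (y ∷ ys)

wincr : List ℕ → Bool
wincr [] = true
wincr (x ∷ []) = true
wincr (x ∷ y ∷ ys) = (x ≤ᵇ y) ∧ wincr (y ∷ ys)

wdecr : List ℕ → Bool
wdecr [] = true
wdecr (x ∷ []) = true
wdecr (x ∷ y ∷ ys) = (y ≤ᵇ x) ∧ wdecr (y ∷ ys)

colAbove : List ℕ → List ℕ → Bool
colAbove lower upper = (length upper ≤ᵇ length lower)
  ∧ allB (λ p → proj₁ p <ᵇ proj₂ p) (zip lower upper)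

colsStrict : Tableau → Bool
colsStrict [] = true
colsStrict (r ∷ []) = true
colsStrict (r ∷ s ∷ rs) = colAbove r s ∧ colsStrict (s ∷ rs)

countV : ℕ → List ℕ → ℕ
countV c s = length (filterᵇ (λ x → c ≡ᵇ x) s)

isPermB : ℕ → List ℕ → Bool
isPermB n s = (length s ≡ᵇ n) ∧ allB (λ j → countV j s ≡ᵇ 1) (range1 n)

isSYT : ℕ → Tableau → Bool
isSYT n T = allB (λ r → 1 ≤ᵇ length r) T ∧ wdecr (map length T)
  ∧ isPermB n (concat T) ∧ allB incr T ∧ colsStrict T

swapV : ℕ → ℕ → ℕ → ℕ
swapV a b x = if x ≡ᵇ a then b else (if x ≡ᵇ b then a else x)

between : ℕ → ℕ → ℕ → Bool
between a b c = ((a <ᵇ b) ∧ (b <ᵇ c)) ∨ ((c <ᵇ b) ∧ (b <ᵇ a))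

dVal : ℕ → Word → ℕ → ℕ
dVal i w = if between p q r then (λ x → x)
           else (if between q p r then swapV i (suc i) else swapV (i ∸ 1) i)
  where
  p = pos (i ∸ 1) w
  q = pos i w
  r = pos (suc i) w

dW : ℕ → Word → Word
dW i w = map (dVal i w) w

dT : ℕ → Tableau → Tableau
dT i T = map (map (dVal i (reading T))) T

record SCGraph (n : ℕ) : Set₁ where
  field
    V : List Word
    V-unique : Unique V
    E : ℕ → Word → Word → Set
    E-sym : ∀ i v w → E i v w → E i w v
    E-distinct : ∀ i v w → E i v w → v ≢ w
    E-inV : ∀ i v w → E i v w → (v ∈ V) × (w ∈ V)
    σ : Word → List Bool
    σ-length : ∀ v → v ∈ V → length (σ v) ≡ n ∸ 1

open SCGraph public

Admits : ∀ {n} → SCGraph n → ℕ → Word → Set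
Admits G i v = sgnAt (σ G v) (i ∸ 1) ≢ sgnAt (σ G v) i

record Axiom1 {n : ℕ} (G : SCGraph n) : Set where
  field
    cover : ∀ i → 1 < i → i < n → ∀ v → v ∈ V G → Admits G i v →
            Data.Product.∃ (λ w → E G i v w)
    unique : ∀ i → 1 < i → i < n → ∀ v w w' → E G i v w → E G i v w' → w ≡ w'
    onlyAdmitting : ∀ i → 1 < i → i < n → ∀ v w → E G i v w → Admits G i v

TEdge : ℕ → Tableau → Tableau → Set
TEdge i S T = ((dT i S ≡ T) × (dT i S ≢ S)) ⊎ ((dT i T ≡ S) × (dT i T ≢ T))

IsPMorphism : ∀ {n} → SCGraph n → Set
IsPMorphism {n} G =
  (∀ v → v ∈ V G → (isSYT n (P v) ≡ true) × (sig n (reading (P v)) ≡ σ G v))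
  × (∀ i v w → 1 < i → i < n → E G i v w → TEdge i (P v) (P w))

-- Power series coefficients.  A monomial x_1^{α_1} ... x_k^{α_k} is a list α.

wordsOver : ℕ → ℕ → List (List ℕ)
wordsOver zero k = [ [] ]
wordsOver (suc m) k = concatMap (λ a → map (a ∷_) (wordsOver m k)) (range1 k)

hasContent : List ℕ → List ℕ → Bool
hasContent α s = (length s ≡ᵇ sum α) ∧ contentAux 1 α
  where
  contentAux : ℕ → List ℕ → Bool
  contentAux c [] = true
  contentAux c (a ∷ as) = (countV c s ≡ᵇ a) ∧ contentAux (suc c) as

descOK : List Bool → List ℕ → Bool
descOK σ s = aux 1 s
  where
  aux : ℕ → List ℕ → Bool
  aux j [] = true
  aux j (x ∷ []) = true
  aux j (x ∷ y ∷ ys) = (not (x ≡ᵇ y) ∨ sgnAt σ j) ∧ aux (suc j) (y ∷ ys)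

coeffF : ℕ → List Bool → List ℕ → ℕ
coeffF n σ α = length (filterᵇ (λ s → wincr s ∧ descOK σ s ∧ hasContent α s)
                                (wordsOver n (length α)))

fillings : List ℕ → ℕ → List Tableau
fillings [] k = [ [] ]
fillings (l ∷ ls) k = concatMap (λ r → map (r ∷_) (fillings ls k)) (wordsOver l k)

isSSYT : Tableau → Bool
isSSYT T = allB wincr T ∧ colsStrict T

coeffS : List ℕ → List ℕ → ℕ
coeffS λ' α = length (filterᵇ (λ T → isSSYT T ∧ hasContent α (concat T))
                               (fillings λ' (length α)))

-- partitions of m with all parts ≤ k (fuel f ≥ m)
partsB : ℕ → ℕ → ℕ → List (List ℕ)
partsB f zero k = [ [] ]
partsB zero (suc m) k = []
partsB (suc f) (suc m) k =
  concatMap (λ p → map (p ∷_) (partsB f (suc m ∸ p) p))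
            (filterᵇ (λ p → p ≤ᵇ k) (range1 (suc m)))

partitions : ℕ → List (List ℕ)
partitions n = partsB n n n

private
  test5 : length (partitions 5) ≡ 7
  test5 = refl
  test6 : partitions 4 ≡ ((1 ∷ 1 ∷ 1 ∷ 1 ∷ []) ∷ (2 ∷ 1 ∷ 1 ∷ []) ∷ (2 ∷ 2 ∷ []) ∷ (3 ∷ 1 ∷ []) ∷ (4 ∷ []) ∷ [])
  test6 = refl

Ufill : ℕ → List ℕ → Tableau
Ufill s [] = []
Ufill s (l ∷ ls) = map (s +_) (range1 l) ∷ Ufill (s + l) ls

U : List ℕ → Tableau
U λ' = Ufill 0 λ'

countSYam : List Word → List ℕ → ℕ
countSYam Vs λ' = length (filterᵇ (λ v → P v ==T U λ') Vs)

private
  testP : P (3 ∷ 1 ∷ 2 ∷ []) ≡ ((1 ∷ 2 ∷ []) ∷ (3 ∷ []) ∷ [])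
  testP = refl
  testF : coeffF 3 (true ∷ false ∷ []) (1 ∷ 2 ∷ []) ≡ 0
  testF = refl
  testS : coeffS (2 ∷ 1 ∷ []) (1 ∷ 1 ∷ 1 ∷ []) ≡ 2
  testS = refl
  testD : dW 2 (1 ∷ 3 ∷ 2 ∷ []) ≡ (2 ∷ 3 ∷ 1 ∷ [])
  testD = refl

{-# OPTIONS --safe #-}
module Submission where

-- Inserting x into a row, where it bumps y, moves y to the front of the row and x into its
-- place in the word formed by the tableau and the letters still to be inserted. Letters that
-- are adjacent in value keep their order, so the signature is preserved; the relative order
-- of i - 1, i, i + 1 changes only in the two configurations of a Knuth move on exactly these
-- letters. In all cases d_i commutes with the step, whence P (d_i v) = d_i (P v).
--
-- It follows that E_i injects the fibre of P over T into the fibre over d_i T, so the fibres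
-- over tableaux connected by the d_i are equinumerous. Listing the rows of n, n - 1, ..., 1
-- turns a tableau into a lattice word, and d_i can be used to bring the largest letter into
-- any prescribed corner; this connects every tableau of shape λ to U_λ. The coefficients of
-- x^α then agree because both count the pairs of a vertex v and a semistandard tableau of
-- content α whose standardisation is P v.

open import Defs
open import Data.Bool using (Bool; true; false; _∧_; _∨_; not; if_then_else_; T?) renaming (T to IsTrue)
open import Data.Bool.Properties using (T-≡; ∧-identityʳ)
open import Data.Nat
open import Data.Nat.ListAction using (sum)
open import Data.Nat.Properties
open import Algebra.Properties.CommutativeSemigroup +-commutativeSemigroup using (x∙yz≈y∙xz; interchange)
open import Data.List hiding (sum)
open import Data.List.Properties hiding (reverse-applyUpTo)
open import Data.List.Membership.Propositional using (_∈_; _∉_)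
open import Data.List.Membership.Propositional.Properties
  using (∈-++⁺ˡ; ∈-++⁺ʳ; ∈-++⁻; ∈-∃++; ∈-map⁺; ∈-map⁻; ∈-upTo⁺; ∈-upTo⁻; ∈-filter⁺; ∈-filter⁻; ∈-concat⁺′)
open import Data.List.Membership.DecPropositional _≟_ using (_∈?_)
open import Data.List.Relation.Unary.Any using (here; there)
open import Data.List.Relation.Unary.All as All using (All; []; _∷_)
import Data.List.Relation.Unary.All.Properties as Allₚ
open import Data.List.Relation.Unary.AllPairs as AllPairs using (AllPairs; []; _∷_)
import Data.List.Relation.Unary.AllPairs.Properties as AllPairsₚ
open import Data.List.Relation.Unary.Linked using (Linked; []; [-]; _∷_)
open import Data.List.Relation.Unary.Unique.Propositional using (Unique)
import Data.List.Relation.Unary.Unique.Propositional.Properties as Uniqueₚ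
open import Data.List.Relation.Binary.Permutation.Propositional
  using (_↭_; prep; ↭-refl; ↭-sym; ↭-trans; ↭-reflexive; ↭⇒↭ₛ)
import Data.List.Relation.Binary.Permutation.Propositional as Perm
open import Data.List.Relation.Binary.Permutation.Propositional.Properties
  using (shift; ++⁺ˡ; ∈-resp-↭; ↭-length; ++-comm; ↭-reverse)
import Data.List.Relation.Binary.Permutation.Propositional.Properties as PermP
import Data.List.Relation.Binary.Permutation.Setoid.Properties as PermS
open import Data.Maybe using (just; nothing)
open import Data.Product hiding (map; zip)
open import Data.Sum using (_⊎_; inj₁; inj₂; [_,_]′)
import Data.Sum as Sum
open import Data.Empty
open import Data.Unit using (⊤; tt)
open import Function using (_∘_; Equivalence)
open import Relation.Nullary
open import Relation.Nullary.Decidable using (dec-true)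
open import Relation.Binary.Definitions using (Tri; tri<; tri≈; tri>)
open import Relation.Binary.PropositionalEquality

-- Hypothesis (4) fixes E_i(v) only up to Knuth equivalence, and d_i(v) itself may lie outside V.
-- What can be used is the equation P (E_i v) = d_i (P v), available once P is known to commute with
-- d_i. The obstacle is that the relabelling d_i depends on the whole word and changes when the
-- insertion performs a Knuth move on i - 1, i, i + 1. A statement about the insertion of one letter
-- must therefore carry the entire current word (rows above, row at hand, pending letters) and say
-- on which letters the relabellings before and after the step agree. Fibres are compared through
-- inequalities obtained from the edges of G; the exchange of the rows of two cells is symmetric, so
-- two inequalities give equality. For connectivity it suffices to use those d_i that have i - 1 in
-- the middle and hence exchange the cells i and i + 1. Tableaux are handled as biwords, a word of
-- row indices above the sorted content. The standard tableau P v and a semistandard tableau of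
-- content α then correspond exactly when their words of row indices coincide.

-- Positions of letters and the three cases of d_i

≡ᵇ-refl : ∀ m → (m ≡ᵇ m) ≡ true
≡ᵇ-refl zero = refl
≡ᵇ-refl (suc m) = ≡ᵇ-refl m

≡ᵇ-true : ∀ m n → (m ≡ᵇ n) ≡ true → m ≡ n
≡ᵇ-true m n eq = ≡ᵇ⇒≡ m n (subst IsTrue (sym eq) tt)

≢⇒≡ᵇ-false : ∀ {m n} → m ≢ n → (m ≡ᵇ n) ≡ false
≢⇒≡ᵇ-false {m} {n} m≢n with m ≡ᵇ n in eq
... | false = refl
... | true = ⊥-elim (m≢n (≡ᵇ-true m n eq))

<⇒<ᵇ-true : ∀ {m n} → m < n → (m <ᵇ n) ≡ true
<⇒<ᵇ-true {zero} {suc n} _ = refl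
<⇒<ᵇ-true {suc m} {suc n} (s≤s lt) = <⇒<ᵇ-true lt

≤⇒<ᵇ-false : ∀ {m n} → n ≤ m → (m <ᵇ n) ≡ false
≤⇒<ᵇ-false {m} {zero} _ = refl
≤⇒<ᵇ-false {suc m} {suc n} (s≤s le) = ≤⇒<ᵇ-false le

<ᵇ-true : ∀ m n → (m <ᵇ n) ≡ true → m < n
<ᵇ-true m n eq = <ᵇ⇒< m n (subst IsTrue (sym eq) tt)

pos-here : ∀ a xs → pos a (a ∷ xs) ≡ 0
pos-here a xs rewrite ≡ᵇ-refl a = refl

pos-there : ∀ {a x} xs → a ≢ x → pos a (x ∷ xs) ≡ suc (pos a xs)
pos-there xs a≢x rewrite ≢⇒≡ᵇ-false a≢x = refl

infix 4 _before_within_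
-- An absent letter has the length of the word as its position, so it counts as standing after every
-- letter that occurs.
_before_within_ : ℕ → ℕ → Word → Set
a before b within u = pos a u < pos b u

isBefore : ℕ → ℕ → Word → Bool
isBefore a b u = pos a u <ᵇ pos b u

isBefore-cons : ∀ a b x u v → isBefore a b u ≡ isBefore a b v → isBefore a b (x ∷ u) ≡ isBefore a b (x ∷ v)
isBefore-cons a b x u v eq with a ≡ᵇ x | b ≡ᵇ x
... | true  | true  = refl
... | true  | false = refl
... | false | true  = refl
... | false | false = eq

isBefore-++ : ∀ a b p u v → isBefore a b u ≡ isBefore a b v → isBefore a b (p ++ u) ≡ isBefore a b (p ++ v)
isBefore-++ a b [] u v eq = eq
isBefore-++ a b (x ∷ p) u v eq = isBefore-cons a b x (p ++ u) (p ++ v) (isBefore-++ a b p u v eq)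

isBefore-swap : ∀ a b c d xs → (a ≡ c → b ≢ d) → (a ≡ d → b ≢ c) →
  isBefore a b (c ∷ d ∷ xs) ≡ isBefore a b (d ∷ c ∷ xs)
isBefore-swap a b c d xs n₁ n₂
  with a ≡ᵇ c in ac | a ≡ᵇ d in ad | b ≡ᵇ c in bc | b ≡ᵇ d in bd
... | true  | _     | _     | true  = ⊥-elim (n₁ (≡ᵇ-true a c ac) (≡ᵇ-true b d bd))
... | _     | true  | true  | _     = ⊥-elim (n₂ (≡ᵇ-true a d ad) (≡ᵇ-true b c bc))
... | true  | true  | false | false = refl
... | true  | false | true  | false = refl
... | true  | false | false | false = refl
... | false | true  | false | true  = refl
... | false | true  | false | false = refl
... | false | false | true  | true  = refl
... | false | false | true  | false = refl
... | false | false | false | true  = refl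
... | false | false | false | false = refl

isBefore-move : ∀ a b y l xs → (∀ z → z ∈ l → a ≡ z → b ≢ y) → (∀ z → z ∈ l → a ≡ y → b ≢ z) →
  isBefore a b (l ++ y ∷ xs) ≡ isBefore a b (y ∷ l ++ xs)
isBefore-move a b y [] xs n₁ n₂ = refl
isBefore-move a b y (z ∷ l) xs n₁ n₂ = trans
  (isBefore-cons a b z (l ++ y ∷ xs) (y ∷ l ++ xs)
      (isBefore-move a b y l xs (λ z z∈l → n₁ z (there z∈l)) (λ z z∈l → n₂ z (there z∈l))))
  (isBefore-swap a b z y (l ++ xs) (n₁ z (here refl)) (n₂ z (here refl)))

before-split : ∀ {a b} xs ys → a ∈ xs → b ∉ xs → a before b within (xs ++ ys)
before-split {a} {b} (x ∷ xs) ys (here refl) b∉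
  rewrite pos-here a (xs ++ ys) | pos-there {b} (xs ++ ys) (λ e → b∉ (here e)) = z<s
before-split {a} {b} (x ∷ xs) ys (there a∈) b∉
  rewrite pos-there {b} {x} (xs ++ ys) (λ e → b∉ (here e)) with a ≡ᵇ x
... | true = z<s
... | false = s<s (before-split xs ys a∈ (λ b∈ → b∉ (there b∈)))

before-sorted : ∀ {a b} xs ys → AllPairs _<_ xs → a ∈ xs → b ∈ xs → a < b → a before b within (xs ++ ys)
before-sorted {a} {b} (x ∷ xs) ys _ (here refl) b∈ a<b
  rewrite pos-here a (xs ++ ys) | pos-there {b} (xs ++ ys) (≢-sym (<⇒≢ a<b)) = z<s
before-sorted (x ∷ xs) ys (px ∷ _) (there a∈) (here refl) a<b = ⊥-elim (<-asym a<b (All.lookup px a∈))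
before-sorted {a} {b} (x ∷ xs) ys (px ∷ ps) (there a∈) (there b∈) a<b
  rewrite pos-there {a} (xs ++ ys) (≢-sym (<⇒≢ (All.lookup px a∈)))
        | pos-there {b} (xs ++ ys) (≢-sym (<⇒≢ (All.lookup px b∈)))
  = s<s (before-sorted xs ys ps a∈ b∈ a<b)

pos-injective : ∀ {a b} u → a ∈ u → pos a u ≡ pos b u → a ≡ b
pos-injective {a} {b} (x ∷ u) a∈ eq with a ≡ᵇ x in ax | b ≡ᵇ x in bx
... | true | true = trans (≡ᵇ-true a x ax) (sym (≡ᵇ-true b x bx))
... | false | false with a∈
... | here refl = ⊥-elim (subst IsTrue (trans (sym (≡ᵇ-refl a)) ax) tt)
... | there a∈u = pos-injective u a∈u (suc-injective eq)

before-total : ∀ {a b} u → a ∈ u → a ≢ b → a before b within u ⊎ b before a within u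
before-total {a} {b} u a∈ a≢b with <-cmp (pos a u) (pos b u)
... | tri< lt _ _ = inj₁ lt
... | tri> _ _ gt = inj₂ gt
... | tri≈ _ eq _ = ⊥-elim (a≢b (pos-injective u a∈ eq))

-- A letter in `pre` would stand before z, and a letter that is neither in `pre` nor in `mid` is not
-- reached before the displayed x.
between-∈ : ∀ {z x d} pre mid {post} → z ∉ pre → x ∉ pre →
  z before d within (pre ++ z ∷ mid ++ x ∷ post) → d before x within (pre ++ z ∷ mid ++ x ∷ post) → d ∈ mid
between-∈ {z} {x} {d} [] mid {post} _ _ z<d d<x = go mid rest
  where
  rest : d before x within (mid ++ x ∷ post)
  rest with d ≡ᵇ z in dz
  ... | true = ⊥-elim (n≮0 z<d)
  ... | false with x ≡ᵇ z
  ...   | true = ⊥-elim (n≮0 d<x)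
  ...   | false = s<s⁻¹ d<x
  go : ∀ m → d before x within (m ++ x ∷ post) → d ∈ m
  go [] lt rewrite ≡ᵇ-refl x = ⊥-elim (n≮0 lt)
  go (e ∷ m) lt with d ≡ᵇ e in de
  ... | true = here (≡ᵇ-true d e de)
  ... | false with x ≡ᵇ e
  ...   | true = ⊥-elim (n≮0 lt)
  ...   | false = there (go m (s<s⁻¹ lt))
between-∈ {z} {x} {d} (e ∷ pre) mid {post} z∉ x∉ z<d d<x = between-∈ pre mid (λ p → z∉ (there p))
    (λ p → x∉ (there p))
    (s<s⁻¹ (subst₂ _<_ (pos-there w (λ p → z∉ (here p))) dd z<d))
    (s<s⁻¹ (subst₂ _<_ dd (pos-there w (λ p → x∉ (here p))) d<x))
  where
  w = pre ++ z ∷ mid ++ x ∷ post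
  dd : pos d (e ∷ w) ≡ suc (pos d w)
  dd = pos-there w λ p → n≮0 (subst (pos z (e ∷ w) <_)
      (trans (cong (λ t → pos t (e ∷ w)) p) (pos-here e w)) z<d)

-- With i = `suc k`, here and below, the letters i - 1, i, i + 1 are `k`, `suc k`, `2 + k`. Only
-- comparisons within this window enter `dVal`, so all others are free to change.
dVal-cong : ∀ k u v → (∀ a b → k ≤ a → a ≤ suc (suc k) → k ≤ b → b ≤ suc (suc k) →
    isBefore a b u ≡ isBefore a b v) →
  ∀ x → dVal (suc k) u x ≡ dVal (suc k) v x
dVal-cong k u v h x
  rewrite h k (suc k) ≤-refl (m≤n+m k 2) (n≤1+n k) (n≤1+n _)
        | h (suc k) k (n≤1+n k) (n≤1+n _) ≤-refl (m≤n+m k 2)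
        | h k (suc (suc k)) ≤-refl (m≤n+m k 2) (m≤n+m k 2) ≤-refl
        | h (suc (suc k)) k (m≤n+m k 2) ≤-refl ≤-refl (m≤n+m k 2)
        | h (suc k) (suc (suc k)) (n≤1+n k) (n≤1+n _) (m≤n+m k 2) ≤-refl
        | h (suc (suc k)) (suc k) (m≤n+m k 2) ≤-refl (n≤1+n k) (n≤1+n _)
  = refl

between-true : ∀ p q r → between p q r ≡ true → (p < q × q < r) ⊎ (r < q × q < p)
between-true p q r eq with p <ᵇ q in pq | q <ᵇ r in qr | r <ᵇ q in rq | q <ᵇ p in qp
... | true | true | _ | _ = inj₁ (<ᵇ-true p q pq , <ᵇ-true q r qr)
... | true | false | true | true = inj₂ (<ᵇ-true r q rq , <ᵇ-true q p qp)
... | false | _ | true | true = inj₂ (<ᵇ-true r q rq , <ᵇ-true q p qp)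

between-up : ∀ {p q r} → p < q → q < r → between p q r ≡ true
between-up p<q q<r rewrite <⇒<ᵇ-true p<q | <⇒<ᵇ-true q<r = refl

between-down : ∀ {p q r} → r < q → q < p → between p q r ≡ true
between-down {p} {q} {r} r<q q<p rewrite <⇒<ᵇ-true r<q | <⇒<ᵇ-true q<p with (p <ᵇ q) ∧ (q <ᵇ r)
... | true = refl
... | false = refl

data DView (k : ℕ) (u : Word) : Set where
  mid-i   : between (pos k u) (pos (suc k) u) (pos (2 + k) u) ≡ true →
            (∀ x → dVal (suc k) u x ≡ x) → DView k u
  mid-i-1 : (suc k before k within u × k before (2 + k) within u) ⊎
      ((2 + k) before k within u × k before suc k within u) →
            (∀ x → dVal (suc k) u x ≡ swapV (suc k) (2 + k) x) → DView k u
  mid-i+1 : (k before (2 + k) within u × (2 + k) before suc k within u) ⊎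
      (suc k before (2 + k) within u × (2 + k) before k within u) →
            (∀ x → dVal (suc k) u x ≡ swapV k (suc k) x) → DView k u

dView : ∀ k u → k ∈ u → suc k ∈ u → DView k u
dView k u k∈ sk∈ with between (pos k u) (pos (suc k) u) (pos (2 + k) u) in e₁
... | true = mid-i e₁ (λ x → dv x)
  where
  dv : ∀ x → dVal (suc k) u x ≡ x
  dv x rewrite e₁ = refl
... | false with between (pos (suc k) u) (pos k u) (pos (2 + k) u) in e₂
...   | true = mid-i-1 (between-true (pos (suc k) u) (pos k u) (pos (2 + k) u) e₂) dv
  where
  dv : ∀ x → dVal (suc k) u x ≡ swapV (suc k) (2 + k) x
  dv x rewrite e₁ | e₂ = refl
...   | false = mid-i+1 mid dv
  where
  dv : ∀ x → dVal (suc k) u x ≡ swapV k (suc k) x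
  dv x rewrite e₁ | e₂ = refl
  f≢t : false ≢ true
  f≢t ()
  mid : (k before (2 + k) within u × (2 + k) before suc k within u) ⊎
      (suc k before (2 + k) within u × (2 + k) before k within u)
  -- Of the orders of three letters, those with i or i - 1 in the middle contradict `e₁` or `e₂`;
  -- the two with i + 1 in the middle remain.
  mid with before-total u k∈ (<⇒≢ (n<1+n k)) | before-total u k∈ (<⇒≢ (m<n+m k {2} z<s)) | before-total u sk∈
      (<⇒≢ (n<1+n (suc k)))
  ... | inj₁ kB | _ | inj₁ BC = ⊥-elim (f≢t (trans (sym e₁) (between-up kB BC)))
  ... | inj₁ kB | inj₁ kC | inj₂ CB = inj₁ (kC , CB)
  ... | inj₁ kB | inj₂ Ck | inj₂ CB = ⊥-elim (f≢t (trans (sym e₂) (between-down Ck kB)))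
  ... | inj₂ Bk | inj₁ kC | _ = ⊥-elim (f≢t (trans (sym e₂) (between-up Bk kC)))
  ... | inj₂ Bk | inj₂ Ck | inj₁ BC = inj₂ (BC , Ck)
  ... | inj₂ Bk | inj₂ Ck | inj₂ CB = ⊥-elim (f≢t (trans (sym e₁) (between-down CB Bk)))

-- Row insertion and the relabelling d_i

unique-++ʳ : ∀ {A : Set} (xs : List A) {ys} → Unique (xs ++ ys) → Unique ys
unique-++ʳ [] u = u
unique-++ʳ (x ∷ xs) (_ ∷ u) = unique-++ʳ xs u

unique-disjoint : ∀ {A : Set} {z : A} (xs : List A) {ys} → Unique (xs ++ ys) → z ∈ xs → z ∉ ys
unique-disjoint (x ∷ xs) (px ∷ u) (here refl) z∈ys = All.lookup (Allₚ.++⁻ʳ xs px) z∈ys refl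
unique-disjoint (x ∷ xs) (_ ∷ u) (there z∈xs) z∈ys = unique-disjoint xs u z∈xs z∈ys

AllPairs-++ʳ : ∀ {A : Set} {R : A → A → Set} (xs : List A) {ys} → AllPairs R (xs ++ ys) → AllPairs R ys
AllPairs-++ʳ [] p = p
AllPairs-++ʳ (x ∷ xs) (_ ∷ p) = AllPairs-++ʳ xs p

AllPairs-++ : ∀ {A : Set} {R : A → A → Set} (xs : List A) {ys x y} → AllPairs R (xs ++ ys) → x ∈ xs → y ∈ ys →
    R x y
AllPairs-++ (x ∷ xs) (p ∷ _) (here refl) y∈ = All.lookup (Allₚ.++⁻ʳ xs p) y∈
AllPairs-++ (_ ∷ xs) (_ ∷ ps) (there x∈) y∈ = AllPairs-++ xs ps x∈ y∈

first-before : ∀ {z w} pre {rest} → w ∉ pre → z ≢ w → z before w within (pre ++ z ∷ rest)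
first-before {z} {w} [] {rest} w∉ z≢w rewrite pos-here z rest | pos-there {w} {z} rest (≢-sym z≢w) = z<s
first-before {z} {w} (e ∷ pre) {rest} w∉ z≢w
  rewrite pos-there {w} {e} (pre ++ z ∷ rest) (λ eq → w∉ (here eq)) with z ≡ᵇ e
... | true = z<s
... | false = s<s (first-before pre (λ p → w∉ (there p)) z≢w)

insertRow-fits : ∀ x {r} → All (_≤ x) r → insertRow x r ≡ (r ∷ʳ x , nothing)
insertRow-fits x [] = refl
insertRow-fits x {y ∷ r} (y≤x ∷ ps) rewrite ≤⇒<ᵇ-false {x} {y} y≤x | insertRow-fits x ps = refl

insertRow-bumps : ∀ x {l y h} → All (_≤ x) l → x < y → insertRow x (l ++ y ∷ h) ≡ (l ++ x ∷ h , just y)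
insertRow-bumps x [] x<y rewrite <⇒<ᵇ-true x<y = refl
insertRow-bumps x {z ∷ l} {y} {h} (z≤x ∷ ps) x<y rewrite ≤⇒<ᵇ-false {x} {z} z≤x | insertRow-bumps x {l} {y}
    {h} ps x<y = refl

data RowView (x : ℕ) : List ℕ → Set where
  fits  : ∀ {r} → All (_≤ x) r → RowView x r
  bumps : ∀ l y h → All (_≤ x) l → x < y → RowView x (l ++ y ∷ h)

rowView : ∀ x r → RowView x r
rowView x [] = fits []
rowView x (y ∷ r) with x <? y
... | yes x<y = bumps [] y r [] x<y
... | no x≮y with rowView x r
...   | fits ps = fits (≮⇒≥ x≮y ∷ ps)
...   | bumps l z h ps x<z = bumps (y ∷ l) z h (≮⇒≥ x≮y ∷ ps) x<z

insertT-fits : ∀ {x r r'} rs → insertRow x r ≡ (r' , nothing) → insertT x (r ∷ rs) ≡ r' ∷ rs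
insertT-fits rs eq rewrite eq = refl

insertT-bumps : ∀ {x r r' y} rs → insertRow x r ≡ (r' , just y) → insertT x (r ∷ rs) ≡ r' ∷ insertT y rs
insertT-bumps rs eq rewrite eq = refl

reading-∷ : ∀ r rs → reading (r ∷ rs) ≡ reading rs ++ r
reading-∷ r rs = begin
  concat (reverse (r ∷ rs))                ≡⟨ cong concat (unfold-reverse r rs) ⟩
  concat (reverse rs ++ r ∷ [])            ≡⟨ concat-++ (reverse rs) (r ∷ []) ⟨
  concat (reverse rs) ++ concat (r ∷ [])   ≡⟨ cong (concat (reverse rs) ++_) (++-identityʳ r) ⟩
  reading rs ++ r                          ∎
  where open ≡-Reasoning

-- The word (rows above, current row, letters still to be inserted) around the insertion of x into
-- the row l ++ y ∷ h, where it bumps y.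
beforeBump afterBump : (p l : Word) (y : ℕ) (h : Word) (x : ℕ) (q : Word) → Word
beforeBump p l y h x q = p ++ (l ++ y ∷ h) ++ x ∷ q
afterBump p l y h x q = p ++ y ∷ (l ++ x ∷ h) ++ q

-- The step moves x to the left across h and then y to the left across l. Only the comparisons of x
-- with letters of h and of y with letters of l can change.
isBefore-bump : ∀ a b p l y h x q →
  (∀ z → z ∈ l → a ≡ z → b ≢ y) → (∀ z → z ∈ l → a ≡ y → b ≢ z) →
  (∀ z → z ∈ h → a ≡ z → b ≢ x) → (∀ z → z ∈ h → a ≡ x → b ≢ z) →
  isBefore a b (beforeBump p l y h x q) ≡ isBefore a b (afterBump p l y h x q)
isBefore-bump a b p l y h x q n₁ n₂ n₃ n₄ = isBefore-++ a b p _ _ (begin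
  isBefore a b ((l ++ y ∷ h) ++ x ∷ q)   ≡⟨ cong (isBefore a b) (++-assoc l (y ∷ h) (x ∷ q)) ⟩
  isBefore a b (l ++ y ∷ h ++ x ∷ q)     ≡⟨ isBefore-++ a b l (y ∷ h ++ x ∷ q) (y ∷ x ∷ h ++ q)
      (isBefore-cons a b y (h ++ x ∷ q) (x ∷ h ++ q) (isBefore-move a b x h q n₃ n₄)) ⟩
  isBefore a b (l ++ y ∷ x ∷ h ++ q)     ≡⟨ isBefore-move a b y l (x ∷ h ++ q) n₁ n₂ ⟩
  isBefore a b (y ∷ l ++ x ∷ h ++ q)     ≡⟨ cong (λ t → isBefore a b (y ∷ t)) (++-assoc l (x ∷ h) q) ⟨
  isBefore a b (y ∷ (l ++ x ∷ h) ++ q)   ∎)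
  where open ≡-Reasoning

swapV-left : ∀ a b → swapV a b a ≡ b
swapV-left a b rewrite ≡ᵇ-refl a = refl

swapV-right : ∀ a b → swapV a b b ≡ a
swapV-right a b with b ≡ᵇ a in eq
... | true = ≡ᵇ-true b a eq
... | false rewrite ≡ᵇ-refl b = refl

swapV-other : ∀ {a b x} → x ≢ a → x ≢ b → swapV a b x ≡ x
swapV-other x≢a x≢b rewrite ≢⇒≡ᵇ-false x≢a | ≢⇒≡ᵇ-false x≢b = refl

-- No value lies between j and j + 1, so exchanging the two reverses the single inequality j < j +
-- 1.
swapV-mono : ∀ j {a b} → a < b → (a ≡ j → b ≢ suc j) → swapV j (suc j) a < swapV j (suc j) b
swapV-mono j {a} {b} a<b nj with a ≟ j | b ≟ suc j
swapV-mono j a<b nj | yes refl | yes b≡sj = ⊥-elim (nj refl b≡sj)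
swapV-mono j {b = b} a<b nj | yes refl | no b≢sj
  rewrite swapV-left j (suc j) | swapV-other {j} {suc j} (≢-sym (<⇒≢ a<b)) b≢sj = ≤∧≢⇒< a<b (≢-sym b≢sj)
swapV-mono j {a = a} a<b nj | no a≢j | yes refl
  rewrite swapV-right j (suc j) | swapV-other {j} {suc j} a≢j (<⇒≢ a<b) = ≤∧≢⇒< (s≤s⁻¹ a<b) a≢j
swapV-mono j {a} {b} a<b nj | no a≢j | no b≢sj with a ≟ suc j | b ≟ j
... | yes refl | yes refl = ⊥-elim (n≮n j (<-trans (n<1+n j) a<b))
... | yes refl | no b≢j rewrite swapV-right j (suc j) | swapV-other {j} {suc j} b≢j b≢sj = <-trans (n<1+n j) a<b
... | no a≢sj | yes refl rewrite swapV-left j (suc j) | swapV-other {j} {suc j} a≢j a≢sj = <-trans a<b (n<1+n j)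
... | no a≢sj | no b≢j rewrite swapV-other {j} {suc j} a≢j a≢sj | swapV-other {j} {suc j} b≢j b≢sj = a<b

-- In swapped, d is the one of i - 1, i, i + 1 that keeps its value.
data SwapView (τ : ℕ → ℕ) (k : ℕ) (u : Word) : Set where
  trivial : (∀ x → τ x ≡ x) → SwapView τ k u
  swapped : ∀ j d → (d ≡ 2 + j × j ≡ k) ⊎ suc d ≡ j → (∀ x → τ x ≡ swapV j (suc j) x) →
    (j before d within u × d before suc j within u) ⊎ (suc j before d within u × d before j within u) →
        SwapView τ k u

swapView : ∀ k u → k ∈ u → suc k ∈ u → SwapView (dVal (suc k) u) k u
swapView k u k∈ sk∈ with dView k u k∈ sk∈
... | mid-i _ eq = trivial eq
... | mid-i-1 o eq = swapped (suc k) k (inj₂ refl) eq o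
... | mid-i+1 o eq = swapped k (2 + k) (inj₁ (refl , refl)) eq o

-- The letter d separates the two letters that are exchanged, and the displayed order of z and w
-- rules out one of the two alternatives for it. Later a monotonicity failure is refuted by finding
-- no room for d in `mid`.
third-between : ∀ {u j d z w} pre mid post → u ≡ pre ++ z ∷ mid ++ w ∷ post → z ∉ pre → w ∉ pre →
  (z ≡ j × w ≡ suc j) ⊎ (z ≡ suc j × w ≡ j) →
  (j before d within u × d before suc j within u) ⊎ (suc j before d within u × d before j within u) → d ∈ mid
third-between pre mid post refl z∉ w∉ (inj₁ (refl , refl)) (inj₁ (o₁ , o₂)) = between-∈ pre mid z∉ w∉ o₁ o₂
third-between pre mid post refl z∉ w∉ (inj₁ (refl , refl)) (inj₂ (o₁ , o₂)) =
  ⊥-elim (<-asym (<-trans o₁ o₂) (first-before pre w∉ (<⇒≢ (n<1+n _))))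
third-between pre mid post refl z∉ w∉ (inj₂ (refl , refl)) (inj₂ (o₁ , o₂)) = between-∈ pre mid z∉ w∉ o₁ o₂
third-between pre mid post refl z∉ w∉ (inj₂ (refl , refl)) (inj₁ (o₁ , o₂)) =
  ⊥-elim (<-asym (<-trans o₁ o₂) (first-before pre w∉ (≢-sym (<⇒≢ (n<1+n _)))))

-- Converse to `dView`: the other two cases are incompatible with i + 1 standing in the middle.
dVal-i+1 : ∀ k u → k ∈ u → suc k ∈ u →
  (k before (2 + k) within u × (2 + k) before suc k within u) ⊎
      (suc k before (2 + k) within u × (2 + k) before k within u) →
  ∀ x → dVal (suc k) u x ≡ swapV k (suc k) x
dVal-i+1 k u k∈ sk∈ o with dView k u k∈ sk∈
... | mid-i+1 _ eq = eq
... | mid-i b _ with between-true (pos k u) (pos (suc k) u) (pos (2 + k) u) b | o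
...   | inj₁ (kB , BC) | inj₁ (kC , CB) = ⊥-elim (<-asym BC CB)
...   | inj₁ (kB , BC) | inj₂ (_ , Ck) = ⊥-elim (<-asym Ck (<-trans kB BC))
...   | inj₂ (CB , Bk) | inj₁ (kC , _) = ⊥-elim (<-asym kC (<-trans CB Bk))
...   | inj₂ (CB , Bk) | inj₂ (BC , Ck) = ⊥-elim (<-asym CB BC)
dVal-i+1 k u k∈ sk∈ o | mid-i-1 o' _ with o' | o
... | inj₁ (Bk , kC) | inj₁ (_ , CB) = ⊥-elim (<-asym CB (<-trans Bk kC))
... | inj₁ (Bk , kC) | inj₂ (BC , Ck) = ⊥-elim (<-asym kC Ck)
... | inj₂ (Ck , kB) | inj₁ (kC , CB) = ⊥-elim (<-asym kC Ck)
... | inj₂ (Ck , kB) | inj₂ (BC , _) = ⊥-elim (<-asym BC (<-trans Ck kB))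

dVal-i-1 : ∀ k u → k ∈ u → suc k ∈ u →
  (suc k before k within u × k before (2 + k) within u) ⊎
      ((2 + k) before k within u × k before suc k within u) →
  ∀ x → dVal (suc k) u x ≡ swapV (suc k) (2 + k) x
dVal-i-1 k u k∈ sk∈ o with dView k u k∈ sk∈
... | mid-i-1 _ eq = eq
... | mid-i b _ with between-true (pos k u) (pos (suc k) u) (pos (2 + k) u) b | o
...   | inj₁ (kB , BC) | inj₁ (Bk , kC) = ⊥-elim (<-asym kB Bk)
...   | inj₁ (kB , BC) | inj₂ (Ck , _) = ⊥-elim (<-asym Ck (<-trans kB BC))
...   | inj₂ (CB , Bk) | inj₁ (_ , kC) = ⊥-elim (<-asym kC (<-trans CB Bk))
...   | inj₂ (CB , Bk) | inj₂ (_ , kB) = ⊥-elim (<-asym Bk kB)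
dVal-i-1 k u k∈ sk∈ o | mid-i+1 o' _ with o | o'
... | inj₁ (Bk , kC) | inj₁ (_ , CB) = ⊥-elim (<-asym CB (<-trans Bk kC))
... | inj₁ (Bk , kC) | inj₂ (BC , Ck) = ⊥-elim (<-asym kC Ck)
... | inj₂ (Ck , kB) | inj₁ (kC , CB) = ⊥-elim (<-asym kC Ck)
... | inj₂ (Ck , kB) | inj₂ (BC , _) = ⊥-elim (<-asym BC (<-trans Ck kB))

bump-↭ : ∀ p l y h x q → beforeBump p l y h x q ↭ afterBump p l y h x q
bump-↭ p l y h x q = ++⁺ˡ p (↭-trans (↭-reflexive (++-assoc l (y ∷ h) (x ∷ q)))
  (↭-trans (shift y l (h ++ x ∷ q)) (prep y (↭-trans (++⁺ˡ l (shift x h q))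
      (↭-reflexive (sym (++-assoc l (x ∷ h) q)))))))

-- The comparisons that a bump can change have a third letter between them in value: z < x < y for z
-- in l, and x < y < z for z in h. If such a comparison lies in the window of d_i, all three letters
-- are determined.
squeeze : ∀ {k a b c} → k ≤ a → a < b → b < c → c ≤ 2 + k → a ≡ k × b ≡ suc k × c ≡ 2 + k
squeeze {k} {a} {b} {c} k≤a a<b b<c c≤ with a≤k | b≤
  where
  b≤ : b ≤ suc k
  b≤ = s≤s⁻¹ (≤-trans b<c c≤)
  a≤k : a ≤ k
  a≤k = s≤s⁻¹ (≤-trans a<b b≤)
... | a≤k | b≤ with ≤-antisym a≤k k≤a
... | refl with ≤-antisym b≤ a<b
... | refl = refl , refl , ≤-antisym c≤ b<c

map-split : ∀ (f : ℕ → ℕ) l y h → map f (l ++ y ∷ h) ≡ map f l ++ f y ∷ map f h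
map-split f l y h = map-++ f l (y ∷ h)

head-suc : ∀ {y h} → AllPairs _<_ (y ∷ h) → suc y ∈ h → ∃ λ h₀ → h ≡ suc y ∷ h₀
head-suc {h = _ ∷ h₀} _ (here refl) = h₀ , refl
head-suc {h = e ∷ h₀} ((y<e ∷ _) ∷ (pe ∷ _)) (there m) = ⊥-elim (n≮n e (≤-trans (All.lookup pe m) y<e))

module Bump (k : ℕ) (p l : Word) (y : ℕ) (h : Word) (x : ℕ) (q : Word)
  (inc : AllPairs _<_ (l ++ y ∷ h)) (l≤x : All (_≤ x) l) (x<y : x < y)
  (uq : Unique (beforeBump p l y h x q))
  (k∈ : k ∈ beforeBump p l y h x q) (sk∈ : suc k ∈ beforeBump p l y h x q) where

  u u' : Word
  u = beforeBump p l y h x q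
  u' = afterBump p l y h x q

  τ τ' : ℕ → ℕ
  τ = dVal (suc k) u
  τ' = dVal (suc k) u'

  row : Word
  row = l ++ y ∷ h

  x∉row : x ∉ row
  x∉row m = unique-disjoint row (unique-++ʳ p uq) m (here refl)

  l<x : ∀ {z} → z ∈ l → z < x
  l<x z∈ = ≤∧≢⇒< (All.lookup l≤x z∈) (λ { refl → x∉row (∈-++⁺ˡ z∈) })

  y<h : ∀ {z} → z ∈ h → y < z
  y<h z∈ with AllPairs-++ʳ l inc
  ... | py ∷ _ = All.lookup py z∈

  x<yh : ∀ {z} → z ∈ y ∷ h → x < z
  x<yh (here refl) = x<y
  x<yh (there z∈) = <-trans x<y (y<h z∈)

  p∌row : ∀ {z} → z ∈ p → z ∉ row
  p∌row z∈p z∈ = unique-disjoint p uq z∈p (∈-++⁺ˡ z∈)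

  p∌x : x ∉ p
  p∌x x∈p = unique-disjoint p uq x∈p (∈-++⁺ʳ row (here refl))

  q∌row : ∀ {z} → z ∈ q → z ∉ row
  q∌row z∈q z∈ = unique-disjoint row (unique-++ʳ p uq) z∈ (there z∈q)

  q∌x : x ∉ q
  q∌x x∈q with unique-++ʳ row (unique-++ʳ p uq)
  ... | px ∷ _ = All.lookup px x∈q refl

  y∈row : y ∈ row
  y∈row = ∈-++⁺ʳ l (here refl)

  h∈row : ∀ {z} → z ∈ h → z ∈ row
  h∈row z∈ = ∈-++⁺ʳ l (there z∈)

  -- In a Knuth move `τ` and `τ'` differ, but only on i - 1, i, i + 1, and then each of these is x
  -- or lies in the row. Hence agreement is claimed on p and q, while the row goes in labelled by
  -- `τ` and comes out labelled by `τ'`.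
  Goal : Set
  Goal = insertRow (τ x) (map τ (l ++ y ∷ h)) ≡ (map τ' (l ++ x ∷ h) , just (τ' y))
    × (∀ z → z ∈ p → τ z ≡ τ' z) × (∀ z → z ∈ q → τ z ≡ τ' z)

  -- On i - 1, i, i + 1, written 1, 2, 3, these are the Knuth moves 132 to 312 and 231 to 213. They
  -- are the only ways in which a bump changes the relative order of the three letters.
  Special₁ Special₂ : Set
  Special₁ = k ∈ l × x ≡ suc k × y ≡ 2 + k
  Special₂ = x ≡ k × y ≡ suc k × (2 + k) ∈ h

  module Generic (¬s₁ : ¬ Special₁) (¬s₂ : ¬ Special₂) where

    τ≡τ' : ∀ z → τ z ≡ τ' z
    τ≡τ' = dVal-cong k u u' λ a b k≤a a≤ k≤b b≤ → isBefore-bump a b p l y h x q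
      (λ { z z∈ refl refl → l-y z∈ k≤a b≤ }) (λ { z z∈ refl refl → l-y z∈ k≤b a≤ })
      (λ { z z∈ refl refl → h-x z∈ k≤b a≤ }) (λ { z z∈ refl refl → h-x z∈ k≤a b≤ })
      where
      l-y : ∀ {z} → z ∈ l → k ≤ z → y ≤ 2 + k → ⊥
      l-y z∈ k≤z y≤ with squeeze k≤z (l<x z∈) x<y y≤
      ... | refl , e₁ , e₂ = ¬s₁ (z∈ , e₁ , e₂)
      h-x : ∀ {z} → z ∈ h → k ≤ x → z ≤ 2 + k → ⊥
      h-x z∈ k≤x z≤ with squeeze k≤x x<y (y<h z∈) z≤
      ... | e₁ , e₂ , refl = ¬s₂ (e₁ , e₂ , z∈)

    sv : SwapView τ k u
    sv = swapView k u k∈ sk∈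

    τl≤τx : ∀ {z} → z ∈ l → τ z ≤ τ x
    τl≤τx {z} z∈ with sv
    ... | trivial eq rewrite eq z | eq x = <⇒≤ (l<x z∈)
    ... | swapped j d which eq o rewrite eq z | eq x = <⇒≤ (swapV-mono j (l<x z∈) bad)
      where
      -- The separating letter d would lie after z in the row. In `l₂` it would be strictly between
      -- j and j + 1 in value. From y on it exceeds x, which excludes d = j - 1; for d = j + 2 it is
      -- y itself, which is `Special₁`, since an entry of h exceeds y and hence j + 2.
      bad : z ≡ j → x ≢ suc j
      bad z≡j x≡sj with ∈-∃++ z∈
      ... | l₁ , l₂ , l≡ = conclude which (∈-++⁻ l₂ d∈)
        where
        u≡ : u ≡ (p ++ l₁) ++ z ∷ (l₂ ++ y ∷ h) ++ x ∷ q
        u≡ = begin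
          p ++ (l ++ y ∷ h) ++ x ∷ q                  ≡⟨ cong (λ t → p ++ (t ++ y ∷ h) ++ x ∷ q) l≡ ⟩
          p ++ ((l₁ ++ z ∷ l₂) ++ y ∷ h) ++ x ∷ q
              ≡⟨ cong (λ t → p ++ t ++ x ∷ q) (++-assoc l₁ (z ∷ l₂) (y ∷ h)) ⟩
          p ++ (l₁ ++ z ∷ l₂ ++ y ∷ h) ++ x ∷ q       ≡⟨ cong (p ++_) (++-assoc l₁ (z ∷ l₂ ++ y ∷ h) (x ∷ q)) ⟩
          p ++ l₁ ++ z ∷ (l₂ ++ y ∷ h) ++ x ∷ q       ≡⟨ ++-assoc p l₁ _ ⟨
          (p ++ l₁) ++ z ∷ (l₂ ++ y ∷ h) ++ x ∷ q     ∎
          where open ≡-Reasoning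
        uq' : Unique ((p ++ l₁) ++ z ∷ (l₂ ++ y ∷ h) ++ x ∷ q)
        uq' = subst Unique u≡ uq
        d∈ : d ∈ l₂ ++ y ∷ h
        d∈ = third-between (p ++ l₁) (l₂ ++ y ∷ h) q u≡ (λ m → unique-disjoint (p ++ l₁) uq' m (here refl))
          (λ m → unique-disjoint (p ++ l₁) uq' m (there (∈-++⁺ʳ (l₂ ++ y ∷ h) (here refl))))
              (inj₁ (z≡j , x≡sj)) o
        z<l₂ : ∀ {e} → e ∈ l₂ → z < e
        z<l₂ e∈ with AllPairs-++ʳ l₁ (subst (AllPairs _<_)
            (trans (cong (_++ y ∷ h) l≡) (++-assoc l₁ (z ∷ l₂) (y ∷ h))) inc)
        ... | pz ∷ _ = All.lookup pz (∈-++⁺ˡ e∈)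
        l₂<x : ∀ {e} → e ∈ l₂ → e < x
        l₂<x e∈ = l<x (subst (_ ∈_) (sym l≡) (∈-++⁺ʳ l₁ (there e∈)))
        conclude : (d ≡ 2 + j × j ≡ k) ⊎ suc d ≡ j → d ∈ l₂ ⊎ d ∈ y ∷ h → ⊥
        conclude _ (inj₁ d∈l₂) = n≮n z (≤-trans (z<l₂ d∈l₂)
            (≤-trans (s≤s⁻¹ (subst (d <_) x≡sj (l₂<x d∈l₂))) (≤-reflexive (sym z≡j))))
        conclude (inj₁ (d≡ , j≡k)) (inj₂ (here d≡y)) = ¬s₁
            (subst (_∈ l) (trans z≡j j≡k) z∈ , trans x≡sj (cong suc j≡k) , trans (sym d≡y)
            (trans d≡ (cong (2 +_) j≡k)))
        conclude (inj₁ (d≡ , _)) (inj₂ (there d∈h)) = n≮n y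
            (≤-trans (subst (y <_) d≡ (y<h d∈h)) (subst (λ t → suc t ≤ y) x≡sj x<y))
        conclude (inj₂ sd≡j) (inj₂ d∈yh) = n≮n x
            (<-trans (x<yh d∈yh) (≤-trans (n≤1+n _)
            (≤-trans (≤-reflexive (cong suc sd≡j)) (≤-reflexive (sym x≡sj)))))

    τx<τy : τ x < τ y
    τx<τy with sv
    ... | trivial eq rewrite eq x | eq y = x<y
    ... | swapped j d which eq o rewrite eq x | eq y = swapV-mono j x<y bad
      where
      -- Here d would lie in h and so exceed y: d = j + 2 is `Special₂`, and d = j - 1 is
      -- impossible.
      bad : x ≡ j → y ≢ suc j
      bad x≡j y≡sj = conclude which
        where
        u≡ : u ≡ (p ++ l) ++ y ∷ h ++ x ∷ q
        u≡ = trans (cong (p ++_) (++-assoc l (y ∷ h) (x ∷ q))) (sym (++-assoc p l _))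
        uq' : Unique ((p ++ l) ++ y ∷ h ++ x ∷ q)
        uq' = subst Unique u≡ uq
        d∈ : d ∈ h
        d∈ = third-between (p ++ l) h q u≡ (λ m → unique-disjoint (p ++ l) uq' m (here refl))
          (λ m → unique-disjoint (p ++ l) uq' m (there (∈-++⁺ʳ h (here refl)))) (inj₂ (y≡sj , x≡j)) o
        conclude : (d ≡ 2 + j × j ≡ k) ⊎ suc d ≡ j → ⊥
        conclude (inj₁ (refl , refl)) = ¬s₂ (x≡j , y≡sj , d∈)
        conclude (inj₂ sd≡j) = n≮n d (<-trans (≤-reflexive (trans sd≡j (sym x≡j))) (<-trans x<y (y<h d∈)))

    goal : Goal
    goal = (begin
      insertRow (τ x) (map τ (l ++ y ∷ h))          ≡⟨ cong (insertRow (τ x)) (map-split τ l y h) ⟩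
      insertRow (τ x) (map τ l ++ τ y ∷ map τ h)
          ≡⟨ insertRow-bumps (τ x) (Allₚ.map⁺ (All.tabulate τl≤τx)) τx<τy ⟩
      (map τ l ++ τ x ∷ map τ h , just (τ y))       ≡⟨ cong (λ t → t , just (τ y)) (map-split τ l x h) ⟨
      (map τ (l ++ x ∷ h) , just (τ y))
          ≡⟨ cong₂ (λ s t → s , just t) (map-cong τ≡τ' (l ++ x ∷ h)) (τ≡τ' y) ⟩
      (map τ' (l ++ x ∷ h) , just (τ' y))           ∎) ,
      (λ z _ → τ≡τ' z) , (λ z _ → τ≡τ' z)
      where open ≡-Reasoning

  k∈' : k ∈ u'
  k∈' = ∈-resp-↭ (bump-↭ p l y h x q) k∈
  sk∈' : suc k ∈ u'
  sk∈' = ∈-resp-↭ (bump-↭ p l y h x q) sk∈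

  -- In both Knuth moves i + 1 is in the middle before the step and i - 1 after it, so the exchange
  -- of i - 1, i turns into the exchange of i, i + 1.
  module Swaps (eq : ∀ z → τ z ≡ swapV k (suc k) z) (eq' : ∀ z → τ' z ≡ swapV (suc k) (2 + k) z) where
    elsewhere : ∀ {z} → z ≢ k → z ≢ suc k → z ≢ 2 + k → τ z ≡ τ' z
    elsewhere {z} n₁ n₂ n₃ = trans (eq z) (trans (swapV-other n₁ n₂) (sym (trans (eq' z) (swapV-other n₂ n₃))))
    τk : τ k ≡ suc k
    τk = trans (eq k) (swapV-left k (suc k))
    τsk : τ (suc k) ≡ k
    τsk = trans (eq (suc k)) (swapV-right k (suc k))
    τssk : τ (2 + k) ≡ 2 + k
    τssk = trans (eq _) (swapV-other (≢-sym (<⇒≢ (m<n+m k {2} z<s))) (≢-sym (<⇒≢ (n<1+n _))))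
    τ'k : τ' k ≡ k
    τ'k = trans (eq' k) (swapV-other (<⇒≢ (n<1+n k)) (<⇒≢ (m<n+m k {2} z<s)))
    τ'sk : τ' (suc k) ≡ 2 + k
    τ'sk = trans (eq' _) (swapV-left (suc k) (2 + k))
    τ'ssk : τ' (2 + k) ≡ suc k
    τ'ssk = trans (eq' _) (swapV-right (suc k) (2 + k))

  special₁ : Special₁ → Goal
  special₁ (k∈l , refl , refl) with ∈-∃++ k∈l
  -- The letter k is the last of l: an entry after it would lie strictly between k and x = k + 1.
  ... | l₁ , (e ∷ l₂) , refl = ⊥-elim (n≮n k (≤-trans k<e (s≤s⁻¹ (l<x (∈-++⁺ʳ l₁ (there (here refl)))))))
    where
    k<e : k < e
    k<e with AllPairs-++ʳ l₁ (subst (AllPairs _<_) (++-assoc l₁ (k ∷ e ∷ l₂) (y ∷ h)) inc)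
    ... | (pz ∷ _) ∷ _ = pz
  ... | l₁ , [] , refl = row-eq , (λ z z∈ → elsewhere (λ { refl → p∌row z∈ (∈-++⁺ˡ k∈l) })
      (λ { refl → p∌x z∈ }) (λ { refl → p∌row z∈ y∈row })) ,
      (λ z z∈ → elsewhere (λ { refl → q∌row z∈ (∈-++⁺ˡ k∈l) }) (λ { refl → q∌x z∈ })
          (λ { refl → q∌row z∈ y∈row }))
    where
    y∉pl : y ∉ p ++ l
    y∉pl m = unique-disjoint (p ++ l) (subst Unique
        (trans (cong (p ++_) (++-assoc l (y ∷ h) (x ∷ q))) (sym (++-assoc p l _))) uq) m (here refl)
    kC : k before y within u
    kC = subst (k before y within_) (sym (trans (cong (p ++_) (++-assoc l (y ∷ h) (x ∷ q)))
        (sym (++-assoc p l _))))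
      (before-split (p ++ l) (y ∷ h ++ x ∷ q) (∈-++⁺ʳ p k∈l) y∉pl)
    CB : y before x within u
    CB = subst (y before x within_) (++-assoc p row (x ∷ q))
      (before-split (p ++ row) (x ∷ q) (∈-++⁺ʳ p y∈row) (λ m → [ p∌x , x∉row ]′ (∈-++⁻ p m)))
    Ck' : y before k within u'
    Ck' = first-before p (λ m → p∌row m (∈-++⁺ˡ k∈l)) (≢-sym (<⇒≢ (m<n+m k {2} z<s)))
    kB' : k before x within u'
    kB' = subst (k before x within_) (trans (++-assoc p (y ∷ l) (x ∷ h ++ q))
        (cong (λ t → p ++ y ∷ t) (sym (++-assoc l (x ∷ h) q))))
      (before-split (p ++ y ∷ l) (x ∷ h ++ q) (∈-++⁺ʳ p (there k∈l)) λ m → [ p∌x ,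
          (λ { (here e) → <⇒≢ x<y e ; (there m') → n≮n x (l<x m') }) ]′ (∈-++⁻ p m))
    open Swaps (dVal-i+1 k u k∈ sk∈ (inj₁ (kC , CB))) (dVal-i-1 k u' k∈' sk∈' (inj₂ (Ck' , kB')))
    l₁<k : ∀ {z} → z ∈ l₁ → z < k
    l₁<k z∈ = AllPairs-++ l₁ (subst (AllPairs _<_) (++-assoc l₁ (k ∷ []) (y ∷ h)) inc) z∈ (here refl)
    τl₁ : ∀ {z} → z ∈ l₁ → τ z ≡ z
    τl₁ {z} z∈ = trans (dVal-i+1 k u k∈ sk∈ (inj₁ (kC , CB)) z)
        (swapV-other (<⇒≢ (l₁<k z∈)) (<⇒≢ (<-trans (l₁<k z∈) (n<1+n k))))
    l₁-same : map τ l₁ ≡ map τ' l₁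
    l₁-same = map-cong-local (All.tabulate λ z∈ → elsewhere (<⇒≢ (l₁<k z∈))
        (<⇒≢ (<-trans (l₁<k z∈) (n<1+n k))) (<⇒≢ (<-trans (l₁<k z∈) (m<n+m k {2} z<s))))
    h-same : map τ h ≡ map τ' h
    h-same = map-cong-local (All.tabulate λ z∈ → elsewhere (≢-sym (<⇒≢ (<-trans (m<n+m k {2} z<s) (y<h z∈))))
        (≢-sym (<⇒≢ (<-trans (n<1+n _) (y<h z∈)))) (≢-sym (<⇒≢ (y<h z∈))))
    row-eq : insertRow (τ x) (map τ (l ++ y ∷ h)) ≡ (map τ' (l ++ x ∷ h) , just (τ' y))
    -- After relabelling, the letter inserted is k and the former cell of k holds k + 1. The bump
    -- takes place there, one cell to the left of y, and ejects k + 1, which is `τ' y`.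
    row-eq = begin
      insertRow (τ x) (map τ ((l₁ ++ k ∷ []) ++ y ∷ h))
        ≡⟨ cong₂ insertRow τsk (trans (cong (map τ) (++-assoc l₁ (k ∷ []) (y ∷ h)))
            (trans (map-split τ l₁ k (y ∷ h)) (cong (λ t → map τ l₁ ++ t ∷ map τ (y ∷ h)) τk))) ⟩
      insertRow k (map τ l₁ ++ suc k ∷ map τ (y ∷ h))
        ≡⟨ insertRow-bumps k (Allₚ.map⁺ (All.tabulate λ z∈ → ≤-trans (≤-reflexive (τl₁ z∈)) (<⇒≤ (l₁<k z∈))))
            (n<1+n k) ⟩
      (map τ l₁ ++ k ∷ τ y ∷ map τ h , just (suc k))
        ≡⟨ cong₂ _,_ (cong₂ _++_ l₁-same (cong₂ _∷_ (sym τ'k) (cong₂ _∷_ (trans τssk (sym τ'sk)) h-same)))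
            (cong just (sym τ'ssk)) ⟩
      (map τ' l₁ ++ τ' k ∷ τ' x ∷ map τ' h , just (τ' y))
        ≡⟨ cong (λ t → t , just (τ' y)) (trans (cong (map τ') (++-assoc l₁ (k ∷ []) (x ∷ h)))
            (map-split τ' l₁ k (x ∷ h))) ⟨
      (map τ' ((l₁ ++ k ∷ []) ++ x ∷ h) , just (τ' y)) ∎
      where open ≡-Reasoning

  special₂ : Special₂ → Goal
  special₂ (refl , refl , C∈h) with head-suc (AllPairs-++ʳ l inc) C∈h
  ... | h₀ , refl = row-eq , (λ z z∈ → elsewhere (λ { refl → p∌x z∈ }) (λ { refl → p∌row z∈ y∈row })
      (λ { refl → p∌row z∈ C∈row })) ,
      (λ z z∈ → elsewhere (λ { refl → q∌x z∈ }) (λ { refl → q∌row z∈ y∈row }) (λ { refl → q∌row z∈ C∈row }))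
    where
    C∈row : 2 + k ∈ row
    C∈row = h∈row (here refl)
    C∉ply : 2 + k ∉ p ++ l ++ y ∷ []
    C∉ply m = unique-disjoint (p ++ l ++ y ∷ []) (subst Unique (sym assoc-ply) uq) m (here refl)
      where
      assoc-ply : (p ++ l ++ y ∷ []) ++ (2 + k) ∷ h₀ ++ x ∷ q ≡ p ++ row ++ x ∷ q
      assoc-ply = trans (++-assoc p (l ++ y ∷ []) _)
          (cong (p ++_) (trans (++-assoc l (y ∷ []) _) (sym (++-assoc l (y ∷ h) (x ∷ q)))))
    BC : y before 2 + k within u
    BC = subst (y before (2 + k) within_) (trans (++-assoc p (l ++ y ∷ []) _)
        (cong (p ++_) (trans (++-assoc l (y ∷ []) _) (sym (++-assoc l (y ∷ h) (x ∷ q))))))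
      (before-split (p ++ l ++ y ∷ []) ((2 + k) ∷ h₀ ++ x ∷ q) (∈-++⁺ʳ p (∈-++⁺ʳ l (here refl))) C∉ply)
    Ck : 2 + k before x within u
    Ck = subst (2 + k before x within_) (++-assoc p row (x ∷ q))
      (before-split (p ++ row) (x ∷ q) (∈-++⁺ʳ p C∈row) (λ m → [ p∌x , x∉row ]′ (∈-++⁻ p m)))
    Bk' : y before x within u'
    Bk' = first-before p p∌x (≢-sym (<⇒≢ x<y))
    kC' : x before 2 + k within u'
    kC' = subst (x before (2 + k) within_) (trans (++-assoc p (y ∷ l) _)
        (cong (λ t → p ++ y ∷ t) (sym (++-assoc l (x ∷ h) q))))
      (first-before (p ++ y ∷ l) (λ m → [ (λ m' → p∌row m' C∈row) ,
          (λ { (here e) → <⇒≢ (n<1+n _) (sym e) ; (there m') → n≮n x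
          (<-trans (m<n+m k {2} z<s) (l<x m')) }) ]′ (∈-++⁻ p m)) (<⇒≢ (m<n+m k {2} z<s)))
    eq : ∀ z → τ z ≡ swapV k (suc k) z
    eq = dVal-i+1 k u k∈ sk∈ (inj₂ (BC , Ck))
    open Swaps eq (dVal-i-1 k u' k∈' sk∈' (inj₁ (Bk' , kC')))
    τl : ∀ {z} → z ∈ l → τ z ≡ z
    τl {z} z∈ = trans (eq z) (swapV-other (<⇒≢ (l<x z∈)) (<⇒≢ (<-trans (l<x z∈) x<y)))
    l-same : map τ l ≡ map τ' l
    l-same = map-cong-local (All.tabulate λ z∈ → elsewhere (<⇒≢ (l<x z∈)) (<⇒≢ (<-trans (l<x z∈) x<y))
        (<⇒≢ (<-trans (l<x z∈) (m<n+m k {2} z<s))))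
    C<h₀ : ∀ {z} → z ∈ h₀ → 2 + k < z
    C<h₀ z∈ with AllPairs-++ʳ l inc
    ... | _ ∷ (pc ∷ _) = All.lookup pc z∈
    h-same : map τ h₀ ≡ map τ' h₀
    h-same = map-cong-local (All.tabulate λ z∈ → elsewhere (≢-sym (<⇒≢ (<-trans (m<n+m k {2} z<s) (C<h₀ z∈))))
        (≢-sym (<⇒≢ (y<h (there z∈)))) (≢-sym (<⇒≢ (C<h₀ z∈))))
    row-eq : insertRow (τ x) (map τ (l ++ y ∷ h)) ≡ (map τ' (l ++ x ∷ h) , just (τ' y))
    -- After relabelling, the letter inserted is k + 1 and the cell of y holds k. The bump takes
    -- place one cell further right and ejects k + 2, which is `τ' y`.
    row-eq = begin
      insertRow (τ x) (map τ (l ++ y ∷ (2 + k) ∷ h₀))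
        ≡⟨ cong₂ insertRow τk (trans (map-split τ l y h)
            (cong₂ (λ s t → map τ l ++ s ∷ t ∷ map τ h₀) τsk τssk)) ⟩
      insertRow (suc k) (map τ l ++ k ∷ (2 + k) ∷ map τ h₀)
        ≡⟨ cong (insertRow (suc k)) (sym (++-assoc (map τ l) (k ∷ []) _)) ⟩
      insertRow (suc k) ((map τ l ++ k ∷ []) ++ (2 + k) ∷ map τ h₀)
        ≡⟨ insertRow-bumps (suc k) (Allₚ.++⁺ (Allₚ.map⁺
            (All.tabulate λ z∈ → ≤-trans (≤-reflexive (τl z∈)) (<⇒≤ (<-trans (l<x z∈) x<y)))) (n≤1+n k ∷ []))
            (n<1+n (suc k)) ⟩
      ((map τ l ++ k ∷ []) ++ suc k ∷ map τ h₀ , just (2 + k))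
        ≡⟨ cong₂ _,_ (++-assoc (map τ l) (k ∷ []) _) (cong just (sym τ'sk)) ⟩
      (map τ l ++ k ∷ suc k ∷ map τ h₀ , just (τ' y))
        ≡⟨ cong (λ t → t , just (τ' y)) (cong₂ _++_ l-same
            (cong₂ _∷_ (sym τ'k) (cong₂ _∷_ (sym τ'ssk) h-same))) ⟩
      (map τ' l ++ τ' x ∷ τ' (2 + k) ∷ map τ' h₀ , just (τ' y))
        ≡⟨ cong (λ t → t , just (τ' y)) (map-split τ' l x h) ⟨
      (map τ' (l ++ x ∷ h) , just (τ' y)) ∎
      where open ≡-Reasoning

  special₁? : Dec Special₁
  special₁? = k ∈? l ×-dec (x ≟ suc k ×-dec y ≟ 2 + k)
  special₂? : Dec Special₂
  special₂? = x ≟ k ×-dec (y ≟ suc k ×-dec (2 + k) ∈? h)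

  goal : Goal
  goal with special₁? | special₂?
  ... | yes s | _ = special₁ s
  ... | no _ | yes s = special₂ s
  ... | no ¬s₁ | no ¬s₂ = Generic.goal ¬s₁ ¬s₂

-- Insertion tableaux

Unique-resp-↭ : ∀ {A : Set} {xs ys : List A} → xs ↭ ys → Unique xs → Unique ys
Unique-resp-↭ {A} p = PermS.Unique-resp-↭ (setoid A) (↭⇒↭ₛ p)

Increasing : List ℕ → Set
Increasing = AllPairs _<_

data Col : List ℕ → List ℕ → Set where
  []  : ∀ {r} → Col r []
  _∷_ : ∀ {x y r s} → x < y → Col r s → Col (x ∷ r) (y ∷ s)

Col-snoc : ∀ {r s} x → Col r s → Col (r ∷ʳ x) s
Col-snoc x [] = []
Col-snoc x (p ∷ c) = p ∷ Col-snoc x c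

Col-lower : ∀ l {x y h s} → x < y → Col (l ++ y ∷ h) s → Col (l ++ x ∷ h) s
Col-lower [] x<y [] = []
Col-lower (z ∷ l) x<y [] = []
Col-lower [] x<y (p ∷ c) = <-trans x<y p ∷ c
Col-lower (z ∷ l) x<y (p ∷ c) = p ∷ Col-lower l x<y c

-- An entry of s above the old cell of y exceeds y, so y enters s in that column or further left.
-- Below its new cell there is x or an entry of l, all smaller than y.
Col-bump : ∀ l {x y h s} → All (_≤ x) l → x < y → Col (l ++ y ∷ h) s →
  Col (l ++ x ∷ h) (proj₁ (insertRow y s))
Col-bump [] ps x<y [] = x<y ∷ []
Col-bump [] ps x<y (y<t ∷ c) rewrite <⇒<ᵇ-true y<t = x<y ∷ c
Col-bump (z ∷ l) (z≤x ∷ ps) x<y [] = ≤-<-trans z≤x x<y ∷ []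
Col-bump (z ∷ l) {y = y} (z≤x ∷ ps) x<y (_∷_ {y = t} z<t c) with y <ᵇ t
... | true = ≤-<-trans z≤x x<y ∷ Col-lower l x<y c
... | false = z<t ∷ Col-bump l ps x<y c

insertT-head : ∀ y s ss → ∃ λ tl → insertT y (s ∷ ss) ≡ proj₁ (insertRow y s) ∷ tl
insertT-head y s ss with insertRow y s
... | s' , nothing = ss , refl
... | s' , just z = insertT z ss , refl

insertT-fit : ∀ x r rs → All (_≤ x) r → insertT x (r ∷ rs) ≡ (r ∷ʳ x) ∷ rs
insertT-fit x r rs ps = insertT-fits {x} {r} rs (insertRow-fits x ps)

insertT-bump : ∀ x l y h rs → All (_≤ x) l → x < y → insertT x ((l ++ y ∷ h) ∷ rs) ≡ (l ++ x ∷ h) ∷ insertT y rs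
insertT-bump x l y h rs ps x<y = insertT-bumps {x} {l ++ y ∷ h} rs (insertRow-bumps x ps x<y)

insertT-Cols : ∀ x T → Linked Col T → Linked Col (insertT x T)
insertT-Cols x [] _ = [-]
insertT-Cols x (r ∷ rs) c with rowView x r
insertT-Cols x (r ∷ []) c | fits ps rewrite insertT-fit x r [] ps = [-]
insertT-Cols x (r ∷ s ∷ ss) (c ∷ cs) | fits ps rewrite insertT-fit x r (s ∷ ss) ps = Col-snoc x c ∷ cs
insertT-Cols x (_ ∷ []) c | bumps l y h ps x<y
  rewrite insertT-bump x l y h [] ps x<y = Col-bump l ps x<y [] ∷ [-]
insertT-Cols x (_ ∷ s ∷ ss) (c ∷ cs) | bumps l y h ps x<y
  rewrite insertT-bump x l y h (s ∷ ss) ps x<y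
  with insertT y (s ∷ ss) | insertT-head y s ss | insertT-Cols y (s ∷ ss) cs
... | _ | tl , refl | cs' = Col-bump l ps x<y c ∷ cs'

NonEmpty : List ℕ → Set
NonEmpty r = 1 ≤ length r

insertT-nonEmpty : ∀ x T → All NonEmpty T → All NonEmpty (insertT x T)
insertT-nonEmpty x [] _ = s≤s z≤n ∷ []
insertT-nonEmpty x (r ∷ rs) (p ∷ ps) with rowView x r
... | fits q rewrite insertT-fit x r rs q =
  ≤-trans (s≤s z≤n) (≤-reflexive (sym (length-++-sucʳ r x []))) ∷ ps
... | bumps l y h q x<y rewrite insertT-bump x l y h rs q x<y =
  ≤-trans (s≤s z≤n) (≤-reflexive (sym (length-++-sucʳ l x h))) ∷ insertT-nonEmpty y rs ps

reading-fits : ∀ r rs x q → reading (r ∷ rs) ++ x ∷ q ≡ reading ((r ∷ʳ x) ∷ rs) ++ q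
reading-fits r rs x q = begin
  reading (r ∷ rs) ++ x ∷ q           ≡⟨ cong (_++ x ∷ q) (reading-∷ r rs) ⟩
  (reading rs ++ r) ++ x ∷ q          ≡⟨ ++-assoc (reading rs ++ r) (x ∷ []) q ⟨
  ((reading rs ++ r) ++ x ∷ []) ++ q  ≡⟨ cong (_++ q) (++-assoc (reading rs) r (x ∷ [])) ⟩
  (reading rs ++ r ∷ʳ x) ++ q         ≡⟨ cong (_++ q) (reading-∷ (r ∷ʳ x) rs) ⟨
  reading ((r ∷ʳ x) ∷ rs) ++ q        ∎
  where open ≡-Reasoning

reading-bumps : ∀ r rs q → reading (r ∷ rs) ++ q ≡ reading rs ++ r ++ q
reading-bumps r rs q = trans (cong (_++ q) (reading-∷ r rs)) (++-assoc (reading rs) r q)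

-- When y goes on to the rows above, the finished row `l ++ x ∷ h` joins the pending letters. Hence
-- q is arbitrary in this and the following statements about `insertT`.
insertT-↭ : ∀ x T q → reading T ++ x ∷ q ↭ reading (insertT x T) ++ q
insertT-↭ x [] q = ↭-refl
insertT-↭ x (r ∷ rs) q with rowView x r
... | fits ps rewrite insertT-fit x r rs ps = ↭-reflexive (reading-fits r rs x q)
... | bumps l y h ps x<y rewrite insertT-bump x l y h rs ps x<y =
  ↭-trans (↭-reflexive (reading-bumps (l ++ y ∷ h) rs (x ∷ q)))
  (↭-trans (bump-↭ (reading rs) l y h x q)
  (↭-trans (insertT-↭ y rs ((l ++ x ∷ h) ++ q))
  (↭-reflexive (sym (reading-bumps (l ++ x ∷ h) (insertT y rs) q)))))

bump-unique : ∀ l y h rs x q → Unique (reading ((l ++ y ∷ h) ∷ rs) ++ x ∷ q) → Unique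
    (beforeBump (reading rs) l y h x q)
bump-unique l y h rs x q = subst Unique (reading-bumps (l ++ y ∷ h) rs (x ∷ q))

Increasing-snoc : ∀ {r x} → Increasing r → All (_< x) r → Increasing (r ∷ʳ x)
Increasing-snoc inc ps = AllPairsₚ.++⁺ inc ([] ∷ []) (All.map (_∷ []) ps)

Increasing-replace : ∀ l {x y h} → Increasing (l ++ y ∷ h) → All (_< x) l → x < y → Increasing (l ++ x ∷ h)
Increasing-replace [] (p ∷ ps) _ x<y = All.map (<-trans x<y) p ∷ ps
Increasing-replace (z ∷ l) (p ∷ ps) (z<x ∷ qs) x<y =
  Allₚ.++⁺ (Allₚ.++⁻ˡ l p) (z<x ∷ All.tail (Allₚ.++⁻ʳ l p)) ∷ Increasing-replace l ps qs x<y

insertT-increasing : ∀ x T q → All Increasing T → Unique (reading T ++ x ∷ q) → All Increasing (insertT x T)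
insertT-increasing x [] q _ _ = ([] ∷ []) ∷ []
insertT-increasing x (r ∷ rs) q (inc ∷ incs) uq with rowView x r
... | fits ps rewrite insertT-fit x r rs ps =
  Increasing-snoc inc (All.tabulate λ z∈ → ≤∧≢⇒< (All.lookup ps z∈)
    λ { refl → unique-disjoint r (unique-++ʳ (reading rs) (subst Unique (reading-bumps r rs (x ∷ q)) uq)) z∈
        (here refl) }) ∷ incs
... | bumps l y h ps x<y rewrite insertT-bump x l y h rs ps x<y =
  Increasing-replace l inc (All.tabulate λ z∈ → ≤∧≢⇒< (All.lookup ps z∈)
    λ { refl → unique-disjoint (l ++ y ∷ h) (unique-++ʳ (reading rs) uq') (∈-++⁺ˡ z∈) (here refl) }) x<y
  ∷ insertT-increasing y rs ((l ++ x ∷ h) ++ q) incs (Unique-resp-↭ (bump-↭ (reading rs) l y h x q) uq')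
  where
  uq' : Unique (beforeBump (reading rs) l y h x q)
  uq' = bump-unique l y h rs x q uq

-- A letter z of l satisfies z < x < y and a letter z of h satisfies x < y < z, so no comparison
-- that the bump can change is between consecutive values.
insertT-isBefore : ∀ j x T q → All Increasing T → Unique (reading T ++ x ∷ q) →
  isBefore j (suc j) (reading T ++ x ∷ q) ≡ isBefore j (suc j) (reading (insertT x T) ++ q)
insertT-isBefore j x [] q _ _ = refl
insertT-isBefore j x (r ∷ rs) q (inc ∷ incs) uq with rowView x r
... | fits ps rewrite insertT-fit x r rs ps = cong (isBefore j (suc j)) (reading-fits r rs x q)
... | bumps l y h ps x<y rewrite insertT-bump x l y h rs ps x<y =
  trans (cong (isBefore j (suc j)) (reading-bumps (l ++ y ∷ h) rs (x ∷ q)))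
  (trans (isBefore-bump j (suc j) (reading rs) l y h x q
      (λ { z z∈ refl refl → n≮n z (<-≤-trans (l<x z∈) (s≤s⁻¹ x<y)) })
      (λ { z z∈ refl refl → n≮n y (<-trans (n<1+n y) (<-trans (l<x z∈) x<y)) })
      (λ { z z∈ refl refl → n≮n z (<-trans (n<1+n z) (<-trans x<y (y<h z∈))) })
      (λ { z z∈ refl refl → n≮n x (<-≤-trans x<y (s≤s⁻¹ (y<h z∈))) }))
  (trans (insertT-isBefore j y rs ((l ++ x ∷ h) ++ q) incs (Unique-resp-↭ (bump-↭ (reading rs) l y h x q) uq'))
  (cong (isBefore j (suc j)) (sym (reading-bumps (l ++ x ∷ h) (insertT y rs) q)))))
  where
  uq' : Unique (beforeBump (reading rs) l y h x q)
  uq' = bump-unique l y h rs x q uq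
  l<x : ∀ {z} → z ∈ l → z < x
  l<x z∈ = ≤∧≢⇒< (All.lookup ps z∈)
    λ { refl → unique-disjoint (l ++ y ∷ h) (unique-++ʳ (reading rs) uq') (∈-++⁺ˡ z∈) (here refl) }
  y<h : ∀ {z} → z ∈ h → y < z
  y<h z∈ with AllPairs-++ʳ l inc
  ... | py ∷ _ = All.lookup py z∈

-- Nothing is bumped before the relabelling, and nothing may be bumped after it. A failure would
-- need z = j and x = j + 1 with d between them in the row, hence strictly between them in value.
fits-relabelled : ∀ k {u} p r x q → u ≡ p ++ r ++ x ∷ q → Increasing r → All (_≤ x) r →
  Unique u → k ∈ u → suc k ∈ u → All (_≤ dVal (suc k) u x) (map (dVal (suc k) u) r)
fits-relabelled k {u} p r x q refl inc ps uq k∈ sk∈ = Allₚ.map⁺ (All.tabulate le)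
  where
  r<x : ∀ {z} → z ∈ r → z < x
  r<x z∈ = ≤∧≢⇒< (All.lookup ps z∈) λ { refl → unique-disjoint r (unique-++ʳ p uq) z∈ (here refl) }
  le : ∀ {z} → z ∈ r → dVal (suc k) u z ≤ dVal (suc k) u x
  le {z} z∈ with swapView k u k∈ sk∈
  ... | trivial eq rewrite eq z | eq x = <⇒≤ (r<x z∈)
  ... | swapped j d _ eq o rewrite eq z | eq x = <⇒≤ (swapV-mono j (r<x z∈) bad)
    where
    bad : z ≡ j → x ≢ suc j
    bad z≡j x≡sj with ∈-∃++ z∈
    ... | r₁ , r₂ , r≡ = n≮n z (≤-trans z<d (s≤s⁻¹
        (≤-trans d<x (≤-reflexive (trans x≡sj (cong suc (sym z≡j)))))))
      where
      u≡ : u ≡ (p ++ r₁) ++ z ∷ r₂ ++ x ∷ q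
      u≡ = trans (cong (λ t → p ++ t ++ x ∷ q) r≡)
          (trans (cong (p ++_) (++-assoc r₁ (z ∷ r₂) (x ∷ q))) (sym (++-assoc p r₁ _)))
      uq' : Unique ((p ++ r₁) ++ z ∷ r₂ ++ x ∷ q)
      uq' = subst Unique u≡ uq
      d∈ : d ∈ r₂
      d∈ = third-between (p ++ r₁) r₂ q u≡ (λ m → unique-disjoint (p ++ r₁) uq' m (here refl))
        (λ m → unique-disjoint (p ++ r₁) uq' m (there (∈-++⁺ʳ r₂ (here refl)))) (inj₁ (z≡j , x≡sj)) o
      z<d : z < d
      z<d with AllPairs-++ʳ r₁ (subst Increasing r≡ inc)
      ... | pz ∷ _ = All.lookup pz d∈
      d<x : d < x
      d<x = r<x (subst (d ∈_) (sym r≡) (∈-++⁺ʳ r₁ (there d∈)))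

-- Pending letters are relabelled according to u before the step and according to u' after it; the
-- second component makes this the same. In the induction it also settles the lower row, which has
-- become pending.
insertT-dVal : ∀ k x T q {u u'} → u ≡ reading T ++ x ∷ q → u' ≡ reading (insertT x T) ++ q →
  All Increasing T → Unique u → k ∈ u → suc k ∈ u →
  insertT (dVal (suc k) u x) (map (map (dVal (suc k) u)) T) ≡ map (map (dVal (suc k) u')) (insertT x T)
  × (∀ z → z ∈ q → dVal (suc k) u z ≡ dVal (suc k) u' z)
insertT-dVal k x [] q refl refl _ _ _ _ = refl , λ _ _ → refl
insertT-dVal k x (r ∷ rs) q {u} refl u'≡ (inc ∷ incs) uq k∈ sk∈ with rowView x r
insertT-dVal k x (r ∷ rs) q {u} {u'} refl u'≡ (inc ∷ incs) uq k∈ sk∈ | fits ps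
  with trans u'≡ (trans (cong (λ t → reading t ++ q) (insertT-fit x r rs ps)) (sym (reading-fits r rs x q)))
... | refl = (begin
    insertT (τ x) (map τ r ∷ map (map τ) rs)
      ≡⟨ insertT-fit (τ x) (map τ r) (map (map τ) rs)
          (fits-relabelled k (reading rs) r x q (reading-bumps r rs (x ∷ q)) inc ps uq k∈ sk∈) ⟩
    (map τ r ∷ʳ τ x) ∷ map (map τ) rs
      ≡⟨ cong (_∷ map (map τ) rs) (map-++ τ r (x ∷ [])) ⟨
    map (map τ) ((r ∷ʳ x) ∷ rs)
      ≡⟨ cong (map (map τ)) (insertT-fit x r rs ps) ⟨
    map (map τ) (insertT x (r ∷ rs)) ∎) , λ _ _ → refl
  where
  open ≡-Reasoning
  τ = dVal (suc k) u
insertT-dVal k x (r ∷ rs) q {u} {u'} refl u'≡ (inc ∷ incs) uq k∈ sk∈ | bumps l y h ps x<y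
  with reading ((l ++ y ∷ h) ∷ rs) ++ x ∷ q | reading-bumps (l ++ y ∷ h) rs (x ∷ q)
... | _ | refl = (begin
    insertT (τ x) (map τ (l ++ y ∷ h) ∷ map (map τ) rs)
      ≡⟨ insertT-bumps {τ x} {map τ (l ++ y ∷ h)} (map (map τ) rs) (proj₁ step) ⟩
    map τ₁ (l ++ x ∷ h) ∷ insertT (τ₁ y) (map (map τ) rs)
      ≡⟨ cong (λ t → map τ₁ (l ++ x ∷ h) ∷ insertT (τ₁ y) t) rs-agree ⟩
    map τ₁ (l ++ x ∷ h) ∷ insertT (τ₁ y) (map (map τ₁) rs)
      ≡⟨ cong₂ _∷_ (map-cong-local (All.tabulate λ z∈ → proj₂ ih _ (∈-++⁺ˡ z∈))) (proj₁ ih) ⟩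
    map τ' (l ++ x ∷ h) ∷ map (map τ') (insertT y rs)
      ≡⟨ cong (map (map τ')) (insertT-bump x l y h rs ps x<y) ⟨
    map (map τ') (insertT x ((l ++ y ∷ h) ∷ rs)) ∎) ,
    λ z z∈ → trans (proj₂ (proj₂ step) z z∈) (proj₂ ih z (∈-++⁺ʳ (l ++ x ∷ h) z∈))
  where
  open ≡-Reasoning
  module B = Bump k (reading rs) l y h x q inc ps x<y uq k∈ sk∈
  τ τ₁ τ' : ℕ → ℕ
  τ = B.τ
  τ₁ = B.τ'
  τ' = dVal (suc k) u'
  step : B.Goal
  step = B.goal
  perm : B.u ↭ B.u'
  perm = bump-↭ (reading rs) l y h x q
  ih : insertT (τ₁ y) (map (map τ₁) rs) ≡ map (map τ') (insertT y rs) ×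
      (∀ z → z ∈ (l ++ x ∷ h) ++ q → τ₁ z ≡ τ' z)
  ih = insertT-dVal k y rs ((l ++ x ∷ h) ++ q) refl
    (trans u'≡ (trans (cong (λ t → reading t ++ q) (insertT-bump x l y h rs ps x<y))
        (reading-bumps (l ++ x ∷ h) (insertT y rs) q)))
    incs (Unique-resp-↭ perm uq) (∈-resp-↭ perm k∈) (∈-resp-↭ perm sk∈)
  in-reading : ∀ {z} s ss → z ∈ s → s ∈ ss → z ∈ reading ss
  in-reading s (_ ∷ ss) z∈ (here refl) = subst (_ ∈_) (sym (reading-∷ s ss)) (∈-++⁺ʳ (reading ss) z∈)
  in-reading s (s' ∷ ss) z∈ (there s∈) = subst (_ ∈_) (sym (reading-∷ s' ss)) (∈-++⁺ˡ (in-reading s ss z∈ s∈))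
  rs-agree : map (map τ) rs ≡ map (map τ₁) rs
  rs-agree = map-cong-local (All.tabulate λ {s} s∈ → map-cong-local
      (All.tabulate λ {z} z∈ → proj₁ (proj₂ step) z (in-reading s rs z∈ s∈)))

foldl-insertT : (Q : Tableau → Word → Set) → (∀ T x q → Q T (x ∷ q) → Q (insertT x T) q) →
  ∀ T v → Q T v → Q (foldl (λ T x → insertT x T) T v) []
foldl-insertT Q step T [] z = z
foldl-insertT Q step T (x ∷ v) z = foldl-insertT Q step (insertT x T) v (step T x v z)

record Standard (T : Tableau) : Set where
  field
    rows     : All Increasing T
    cols     : Linked Col T
    nonEmpty : All NonEmpty T
    letters  : Unique (reading T)
open Standard public

module _ (v : Word) (uq : Unique v) where
  private
    Inv : Tableau → Word → Set
    Inv T q = All Increasing T × Linked Col T × All NonEmpty T × (v ↭ reading T ++ q)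
      × (∀ j → isBefore j (suc j) v ≡ isBefore j (suc j) (reading T ++ q))

    inv : Inv (P v) []
    inv = foldl-insertT Inv step [] v ([] , [] , [] , ↭-refl , λ _ → refl)
      where
      step : ∀ T x q → Inv T (x ∷ q) → Inv (insertT x T) q
      step T x q (i , c , ne , p , b) = insertT-increasing x T q i uq' , insertT-Cols x T c ,
          insertT-nonEmpty x T ne ,
          ↭-trans p (insertT-↭ x T q) , λ j → trans (b j) (insertT-isBefore j x T q i uq')
        where uq' = Unique-resp-↭ p uq

  P-↭ : v ↭ reading (P v)
  P-↭ = subst (v ↭_) (++-identityʳ _) (proj₁ (proj₂ (proj₂ (proj₂ inv))))

  P-isBefore : ∀ j → isBefore j (suc j) v ≡ isBefore j (suc j) (reading (P v))
  P-isBefore j = trans (proj₂ (proj₂ (proj₂ (proj₂ inv))) j)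
      (cong (isBefore j (suc j)) (++-identityʳ (reading (P v))))

  P-standard : Standard (P v)
  P-standard = record { rows = proj₁ inv ; cols = proj₁ (proj₂ inv) ; nonEmpty = proj₁
      (proj₂ (proj₂ inv)) ; letters = Unique-resp-↭ P-↭ uq }

  P-dW : ∀ k → k ∈ v → suc k ∈ v → P (dW (suc k) v) ≡ dT (suc k) (P v)
  P-dW k k∈ sk∈ = sym (trans (cong (λ u → map (map (dVal (suc k) u)) (P v))
      (sym (++-identityʳ (reading (P v))))) (proj₂ (proj₂ result)))
    where
    Q : Tableau → Word → Set
    -- The relabelling always refers to the current word `reading T ++ q`. With T empty the equation
    -- holds by definition of P (d_i v); with q empty its left side is d_i (P v).
    Q T q = All Increasing T × (v ↭ reading T ++ q) × foldl (λ T x → insertT x T)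
        (map (map (dVal (suc k) (reading T ++ q))) T) (map (dVal (suc k) (reading T ++ q)) q) ≡ P (dW (suc k) v)
    step : ∀ T x q → Q T (x ∷ q) → Q (insertT x T) q
    step T x q (i , p , eq) with insertT-dVal k x T q refl refl i (Unique-resp-↭ p uq) (∈-resp-↭ p k∈)
        (∈-resp-↭ p sk∈)
    ... | ins≡ , agree = insertT-increasing x T q i (Unique-resp-↭ p uq) , ↭-trans p (insertT-↭ x T q) ,
      trans (cong₂ (foldl (λ T x → insertT x T)) (sym ins≡)
          (sym (map-cong-local (All.tabulate λ z∈ → agree _ z∈)))) eq
    result : Q (P v) []
    result = foldl-insertT Q step [] v ([] , ↭-refl , refl)

-- The morphism

∧-true : ∀ {a b} → a ∧ b ≡ true → a ≡ true × b ≡ true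
∧-true {true} {true} refl = refl , refl

true-∧ : ∀ {a b} → a ≡ true → b ≡ true → a ∧ b ≡ true
true-∧ refl refl = refl

≤⇒≤ᵇ-true : ∀ {m n} → m ≤ n → (m ≤ᵇ n) ≡ true
≤⇒≤ᵇ-true {zero} _ = refl
≤⇒≤ᵇ-true {suc m} lt = <⇒<ᵇ-true lt

≤ᵇ-true : ∀ m n → (m ≤ᵇ n) ≡ true → m ≤ n
≤ᵇ-true m n eq = ≤ᵇ⇒≤ m n (subst IsTrue (sym eq) _)

≡⇒≡ᵇ-true : ∀ {m n} → m ≡ n → (m ≡ᵇ n) ≡ true
≡⇒≡ᵇ-true {m} refl = ≡ᵇ-refl m

allB⁺ : ∀ {A : Set} {p : A → Bool} {xs} → All (λ x → p x ≡ true) xs → allB p xs ≡ true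
allB⁺ [] = refl
allB⁺ (px ∷ ps) = true-∧ px (allB⁺ ps)

allB⁻ : ∀ {A : Set} {p : A → Bool} xs → allB p xs ≡ true → All (λ x → p x ≡ true) xs
allB⁻ [] _ = []
allB⁻ (x ∷ xs) eq = proj₁ (∧-true eq) ∷ allB⁻ xs (proj₂ (∧-true eq))

countV-∷-≡ : ∀ c xs → countV c (c ∷ xs) ≡ suc (countV c xs)
countV-∷-≡ c xs rewrite ≡ᵇ-refl c = refl

countV-∷-≢ : ∀ {c x} xs → c ≢ x → countV c (x ∷ xs) ≡ countV c xs
countV-∷-≢ xs c≢x rewrite ≢⇒≡ᵇ-false c≢x = refl

countV-++ : ∀ c xs ys → countV c (xs ++ ys) ≡ countV c xs + countV c ys
countV-++ c [] ys = refl
countV-++ c (x ∷ xs) ys with c ≡ᵇ x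
... | true = cong suc (countV-++ c xs ys)
... | false = countV-++ c xs ys

countV-∉ : ∀ {c} xs → c ∉ xs → countV c xs ≡ 0
countV-∉ [] _ = refl
countV-∉ {c} (x ∷ xs) c∉ rewrite ≢⇒≡ᵇ-false {c} {x} (λ e → c∉ (here e)) = countV-∉ xs (λ m → c∉ (there m))

countV-∈ : ∀ {c xs} → c ∈ xs → 0 < countV c xs
countV-∈ {c} {x ∷ xs} (here refl) rewrite ≡ᵇ-refl c = z<s
countV-∈ {c} {x ∷ xs} (there m) with c ≡ᵇ x
... | true = z<s
... | false = countV-∈ m

countV-pos : ∀ {c} xs → 0 < countV c xs → c ∈ xs
countV-pos {c} (x ∷ xs) lt with c ≡ᵇ x in eq
... | true = here (≡ᵇ-true c x eq)
... | false = there (countV-pos xs lt)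

countV-unique : ∀ {c xs} → Unique xs → c ∈ xs → countV c xs ≡ 1
countV-unique {c} {x ∷ xs} (px ∷ _) (here refl) = trans (countV-∷-≡ c xs)
    (cong suc (countV-∉ xs (λ m → All.lookup px m refl)))
countV-unique {c} {x ∷ xs} (px ∷ u) (there m) = trans
    (countV-∷-≢ {c} {x} xs (λ { refl → All.lookup px m refl })) (countV-unique u m)

countV-↭ : ∀ c {xs ys} → xs ↭ ys → countV c xs ≡ countV c ys
countV-↭ c Perm.refl = refl
countV-↭ c (Perm.prep x p) with c ≡ᵇ x
... | true = cong suc (countV-↭ c p)
... | false = countV-↭ c p
countV-↭ c (Perm.swap {xs} {ys} x y p) = begin
  countV c (x ∷ y ∷ xs)                               ≡⟨ countV-++ c (x ∷ []) (y ∷ xs) ⟩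
  countV c (x ∷ []) + countV c (y ∷ xs)               ≡⟨ cong (countV c (x ∷ []) +_) (countV-++ c (y ∷ []) xs) ⟩
  countV c (x ∷ []) + (countV c (y ∷ []) + countV c xs)
      ≡⟨ cong (λ t → countV c (x ∷ []) + (countV c (y ∷ []) + t)) (countV-↭ c p) ⟩
  countV c (x ∷ []) + (countV c (y ∷ []) + countV c ys)
      ≡⟨ x∙yz≈y∙xz (countV c (x ∷ [])) (countV c (y ∷ [])) (countV c ys) ⟩
  countV c (y ∷ []) + (countV c (x ∷ []) + countV c ys)
      ≡⟨ cong (countV c (y ∷ []) +_) (countV-++ c (x ∷ []) ys) ⟨
  countV c (y ∷ []) + countV c (x ∷ ys)               ≡⟨ countV-++ c (y ∷ []) (x ∷ ys) ⟨
  countV c (y ∷ x ∷ ys)                               ∎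
  where open ≡-Reasoning
countV-↭ c (Perm.trans p q) = trans (countV-↭ c p) (countV-↭ c q)

range1-unique : ∀ n → Unique (range1 n)
range1-unique n = Uniqueₚ.map⁺ suc-injective (Uniqueₚ.upTo⁺ n)

∈-range1⁺ : ∀ {n j} → 1 ≤ j → j ≤ n → j ∈ range1 n
∈-range1⁺ {j = suc j} _ j≤n = ∈-map⁺ suc (∈-upTo⁺ j≤n)

∈-range1⁻ : ∀ {n j} → j ∈ range1 n → 1 ≤ j × j ≤ n
∈-range1⁻ m with ∈-map⁻ suc m
... | _ , i∈ , refl = s≤s z≤n , ∈-upTo⁻ i∈

length-range1 : ∀ n → length (range1 n) ≡ n
length-range1 n = trans (length-map suc (upTo n)) (length-upTo n)

range1-∷ʳ : ∀ n → range1 (suc n) ≡ range1 n ∷ʳ suc n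
range1-∷ʳ n = trans (cong (map suc) (sym (upTo-∷ʳ n))) (map-++ suc (upTo n) (n ∷ []))

sgnAt-applyUpTo : ∀ (f : ℕ → Bool) m j → j < m → sgnAt (applyUpTo f m) (suc j) ≡ f j
sgnAt-applyUpTo f (suc m) zero _ = refl
sgnAt-applyUpTo f (suc m) (suc j) (s≤s lt) = sgnAt-applyUpTo (f ∘ suc) m j lt

sgnAt-sig : ∀ n w j → 1 ≤ j → j < n → sgnAt (sig n w) j ≡ isBefore j (suc j) w
sgnAt-sig (suc n) w (suc j) _ (s≤s lt) = trans
  (cong (λ t → sgnAt t (suc j)) (trans (cong (map (λ i → isBefore i (suc i) w)) (map-upTo suc n))
      (map-applyUpTo suc (λ i → isBefore i (suc i) w) n)))
  (sgnAt-applyUpTo (λ i → isBefore (suc i) (2 + i) w) n j lt)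

Increasing⇒incr : ∀ {r} → Increasing r → incr r ≡ true
Increasing⇒incr [] = refl
Increasing⇒incr (_ ∷ []) = refl
Increasing⇒incr ((lt ∷ _) ∷ inc@(_ ∷ _)) = true-∧ (<⇒<ᵇ-true lt) (Increasing⇒incr inc)

Weak : List ℕ → Set
Weak = AllPairs _≤_

Weak⇒wincr : ∀ {r} → Weak r → wincr r ≡ true
Weak⇒wincr [] = refl
Weak⇒wincr (_ ∷ []) = refl
Weak⇒wincr ((le ∷ _) ∷ inc@(_ ∷ _)) = true-∧ (≤⇒≤ᵇ-true le) (Weak⇒wincr inc)

wincr⇒Weak : ∀ r → wincr r ≡ true → Weak r
wincr⇒Weak [] _ = []
wincr⇒Weak (x ∷ []) _ = [] ∷ []
wincr⇒Weak (x ∷ y ∷ r) eq = extend (≤ᵇ-true x y (proj₁ (∧-true eq)))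
    (wincr⇒Weak (y ∷ r) (proj₂ (∧-true {x ≤ᵇ y} eq)))
  where
  extend : x ≤ y → Weak (y ∷ r) → Weak (x ∷ y ∷ r)
  extend x≤y (py ∷ w) = (x≤y ∷ All.map (≤-trans x≤y) py) ∷ (py ∷ w)

Col-length : ∀ {r s} → Col r s → length s ≤ length r
Col-length [] = z≤n
Col-length (_ ∷ c) = s≤s (Col-length c)

Col⇒colAbove : ∀ {r s} → Col r s → colAbove r s ≡ true
Col⇒colAbove c = true-∧ (≤⇒≤ᵇ-true (Col-length c)) (go c)
  where
  go : ∀ {r s} → Col r s → allB (λ p → proj₁ p <ᵇ proj₂ p) (zip r s) ≡ true
  go {[]} [] = refl
  go {_ ∷ _} [] = refl
  go (lt ∷ c) = true-∧ (<⇒<ᵇ-true lt) (go c)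

colAbove⇒Col : ∀ r s → colAbove r s ≡ true → Col r s
colAbove⇒Col r s eq with ∧-true {length s ≤ᵇ length r} eq
... | le , all = go r s (≤ᵇ-true (length s) (length r) le) all
  where
  go : ∀ r s → length s ≤ length r → allB (λ p → proj₁ p <ᵇ proj₂ p) (zip r s) ≡ true → Col r s
  go r [] _ _ = []
  go (x ∷ r) (y ∷ s) (s≤s le) eq with ∧-true {x <ᵇ y} eq
  ... | lt , eq' = <ᵇ-true x y lt ∷ go r s le eq'

Cols⇒colsStrict : ∀ {T} → Linked Col T → colsStrict T ≡ true
Cols⇒colsStrict [] = refl
Cols⇒colsStrict [-] = refl
Cols⇒colsStrict (c ∷ cs) = true-∧ (Col⇒colAbove c) (Cols⇒colsStrict cs)

colsStrict⇒Cols : ∀ T → colsStrict T ≡ true → Linked Col T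
colsStrict⇒Cols [] _ = []
colsStrict⇒Cols (r ∷ []) _ = [-]
colsStrict⇒Cols (r ∷ s ∷ rs) eq = colAbove⇒Col r s (proj₁ (∧-true eq)) ∷ colsStrict⇒Cols (s ∷ rs)
    (proj₂ (∧-true {colAbove r s} eq))

Cols⇒wdecr : ∀ {T} → Linked Col T → wdecr (map length T) ≡ true
Cols⇒wdecr [] = refl
Cols⇒wdecr [-] = refl
Cols⇒wdecr (c ∷ cs) = true-∧ (≤⇒≤ᵇ-true (Col-length c)) (Cols⇒wdecr cs)

concat-↭-reading : ∀ T → concat T ↭ reading T
concat-↭-reading [] = ↭-refl
concat-↭-reading (r ∷ rs) = ↭-trans (++⁺ˡ r (concat-↭-reading rs))
  (↭-trans (++-comm r (reading rs)) (↭-reflexive (sym (reading-∷ r rs))))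

IsPerm⇒Unique : ∀ {n v} → IsPerm n v → Unique v
IsPerm⇒Unique {n} p = Unique-resp-↭ (↭-sym p) (range1-unique n)

IsPerm-∈ : ∀ {n v j} → IsPerm n v → 1 ≤ j → j ≤ n → j ∈ v
IsPerm-∈ p 1≤j j≤n = ∈-resp-↭ (↭-sym p) (∈-range1⁺ 1≤j j≤n)

Standard⇒isSYT : ∀ {n T} → Standard T → reading T ↭ range1 n → isSYT n T ≡ true
Standard⇒isSYT {n} {T} st p =
  true-∧ (allB⁺ (All.map ≤⇒≤ᵇ-true (nonEmpty st)))
  (true-∧ (Cols⇒wdecr (cols st))
  (true-∧ (true-∧ (≡⇒≡ᵇ-true (trans (↭-length p') (length-range1 n)))
                  (allB⁺ {xs = range1 n} (All.tabulate λ {j} j∈ → ≡⇒≡ᵇ-true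
                      (trans (countV-↭ j p') (countV-unique (range1-unique n) j∈)))))
  (true-∧ (allB⁺ (All.map Increasing⇒incr (rows st)))
  (Cols⇒colsStrict (cols st)))))
  where
  p' : concat T ↭ range1 n
  p' = ↭-trans (concat-↭-reading T) p

P-sig : ∀ n v → Unique v → sig n (reading (P v)) ≡ sig n v
P-sig n v uq = map-cong (λ j → sym (P-isBefore v uq j)) (range1 (n ∸ 1))

map-reading : ∀ (f : ℕ → ℕ) T → reading (map (map f) T) ≡ map f (reading T)
map-reading f [] = refl
map-reading f (r ∷ rs) = trans (reading-∷ (map f r) (map (map f) rs))
  (trans (cong (_++ map f r) (map-reading f rs))
      (trans (sym (map-++ f (reading rs) r)) (cong (map f) (sym (reading-∷ r rs)))))

map-fixes : ∀ (f : ℕ → ℕ) xs {z} → map f xs ≡ xs → z ∈ xs → f z ≡ z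
map-fixes f (x ∷ xs) eq (here refl) = ∷-injectiveˡ eq
map-fixes f (x ∷ xs) eq (there m) = map-fixes f xs (∷-injectiveʳ eq) m

-- Opposite signs exclude i from the middle, so d_i exchanges i with a neighbour; i occurs in T and
-- is moved.
dT-moves : ∀ k T → k ∈ reading T → suc k ∈ reading T →
  isBefore k (suc k) (reading T) ≢ isBefore (suc k) (2 + k) (reading T) → dT (suc k) T ≢ T
dT-moves k T k∈ sk∈ signs fixed with dView k (reading T) k∈ sk∈
... | mid-i b _ with between-true (pos k (reading T)) (pos (suc k) (reading T)) (pos (2 + k) (reading T)) b
...   | inj₁ (kB , BC) = signs (trans (<⇒<ᵇ-true kB) (sym (<⇒<ᵇ-true BC)))
...   | inj₂ (CB , Bk) = signs (trans (≤⇒<ᵇ-false (<⇒≤ Bk)) (sym (≤⇒<ᵇ-false (<⇒≤ CB))))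
dT-moves k T k∈ sk∈ signs fixed | mid-i-1 _ eq = <⇒≢ (n<1+n (suc k))
    (sym (trans (sym (trans (eq (suc k)) (swapV-left (suc k) (2 + k))))
    (map-fixes _ (reading T) (trans (sym (map-reading _ T)) (cong reading fixed)) sk∈)))
dT-moves k T k∈ sk∈ signs fixed | mid-i+1 _ eq = <⇒≢ (n<1+n k)
    (trans (sym (trans (eq (suc k)) (swapV-right k (suc k))))
    (map-fixes _ (reading T) (trans (sym (map-reading _ T)) (cong reading fixed)) sk∈))

module Morphism (n : ℕ) (G : SCGraph n) (ax : Axiom1 G)
  (perm : ∀ v → v ∈ V G → IsPerm n v)
  (σ≡ : ∀ v → v ∈ V G → σ G v ≡ sig n v)
  (knuth : ∀ i v w → 1 < i → i < n → v ∈ V G → Admits G i v → E G i v w → KnuthEq w (dW i v)) where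

  uniq : ∀ {v} → v ∈ V G → Unique v
  uniq v∈ = IsPerm⇒Unique (perm _ v∈)

  edge-dT : ∀ {k v w} → 1 ≤ k → suc k < n → E G (suc k) v w → P w ≡ dT (suc k) (P v)
  edge-dT {k} {v} {w} 1≤k k<n e = trans (knuth (suc k) v w (s≤s 1≤k) k<n v∈
      (Axiom1.onlyAdmitting ax (suc k) (s≤s 1≤k) k<n v w e) e)
    (P-dW v (uniq v∈) k (IsPerm-∈ (perm v v∈) 1≤k (<⇒≤ (<-trans (n<1+n k) k<n)))
        (IsPerm-∈ (perm v v∈) (s≤s z≤n) (<⇒≤ k<n)))
    where
    v∈ : v ∈ V G
    v∈ = proj₁ (E-inV G (suc k) v w e)

  P-morphism : IsPMorphism G
  P-morphism = (λ v v∈ → Standard⇒isSYT (P-standard v (uniq v∈))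
      (↭-trans (↭-sym (P-↭ v (uniq v∈))) (perm v v∈)) ,
                 trans (P-sig n v (uniq v∈)) (sym (σ≡ v v∈))) ,
               edges
    where
    edges : ∀ i v w → 1 < i → i < n → E G i v w → TEdge i (P v) (P w)
    edges (suc k) v w (s≤s 1≤k) k<n e = inj₁ (sym (edge-dT 1≤k k<n e) , dT-moves k (P v)
        (into k 1≤k (<⇒≤ (<-trans (n<1+n k) k<n))) (into (suc k) (s≤s z≤n) (<⇒≤ k<n)) signs)
      where
      v∈ : v ∈ V G
      v∈ = proj₁ (E-inV G (suc k) v w e)
      into : ∀ j → 1 ≤ j → j ≤ n → j ∈ reading (P v)
      into j 1≤j j≤n = ∈-resp-↭ (P-↭ v (uniq v∈)) (IsPerm-∈ (perm v v∈) 1≤j j≤n)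
      sign : ∀ j → 1 ≤ j → j < n → sgnAt (σ G v) j ≡ isBefore j (suc j) (reading (P v))
      sign j 1≤j j<n = trans (cong (λ t → sgnAt t j) (σ≡ v v∈))
          (trans (sgnAt-sig n v j 1≤j j<n) (P-isBefore v (uniq v∈) j))
      signs : isBefore k (suc k) (reading (P v)) ≢ isBefore (suc k) (2 + k) (reading (P v))
      signs eq = Axiom1.onlyAdmitting ax (suc k) (s≤s 1≤k) k<n v w e
        (trans (sign k 1≤k (<-trans (n<1+n k) k<n)) (trans eq (sym (sign (suc k) (s≤s z≤n) k<n))))

-- Biwords

-- A total function, empty above the top row, so that removing the last cell of a row leaves the
-- indexing of the others untouched.
Rows : Set
Rows = ℕ → List ℕ

readRows : ℕ → Rows → Word
readRows zero S = []
readRows (suc k) S = S k ++ readRows k S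

∈-readRows : ∀ {x r} k (S : Rows) → r < k → x ∈ S r → x ∈ readRows k S
∈-readRows {r = r} (suc k) S r<k x∈ with r ≟ k
... | yes refl = ∈-++⁺ˡ x∈
... | no r≢k = ∈-++⁺ʳ (S k) (∈-readRows k S (≤∧≢⇒< (s≤s⁻¹ r<k) r≢k) x∈)

-- Standardisation numbers equal letters in reading order, from the top row down, so the last cell
-- added is the one holding the largest letter in the lowest possible row.
lowestRow : ∀ {c} k (S : Rows) → c ∈ readRows k S → ∃ λ a → a < k × c ∈ S a × (∀ r → c ∈ S r → a ≤ r)
lowestRow {c} (suc k) S c∈ with c ∈? readRows k S
... | yes m with lowestRow k S m
...   | a , a<k , c∈a , least = a , <-trans a<k (n<1+n k) , c∈a , least
lowestRow {c} (suc k) S c∈ | no n with ∈-++⁻ (S k) c∈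
... | inj₂ m = ⊥-elim (n m)
... | inj₁ m = k , n<1+n k , m , λ r c∈r → ≮⇒≥ λ r<k → n (∈-readRows k S r<k c∈r)

Weak-max-last : ∀ {c} xs → Weak xs → c ∈ xs → All (_≤ c) xs → ∃ λ ys → xs ≡ ys ∷ʳ c
Weak-max-last (x ∷ []) _ (here refl) _ = [] , refl
Weak-max-last (x ∷ y ∷ xs) ((x≤y ∷ _) ∷ w) (here refl) (_ ∷ y≤c ∷ ps) with ≤-antisym x≤y y≤c
... | refl with Weak-max-last (y ∷ xs) w (here refl) (y≤c ∷ ps)
...   | ys , eq = x ∷ ys , cong (x ∷_) eq
Weak-max-last (x ∷ xs) (_ ∷ w) (there m) (_ ∷ ps) with Weak-max-last xs w m ps
... | ys , eq = x ∷ ys , cong (x ∷_) eq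

AllPairs-++ˡ : ∀ {A : Set} {R : A → A → Set} (xs : List A) {ys} → AllPairs R (xs ++ ys) → AllPairs R xs
AllPairs-++ˡ [] _ = []
AllPairs-++ˡ (x ∷ xs) (p ∷ ps) = Allₚ.++⁻ˡ xs p ∷ AllPairs-++ˡ xs ps

update : ℕ → List ℕ → Rows → Rows
update a t S r = if a ≡ᵇ r then t else S r

update-≡ : ∀ a t S → update a t S a ≡ t
update-≡ a t S rewrite ≡ᵇ-refl a = refl

update-≢ : ∀ {a r} t S → a ≢ r → update a t S r ≡ S r
update-≢ t S a≢r rewrite ≢⇒≡ᵇ-false a≢r = refl

readRows-cong : ∀ k {S S' : Rows} → (∀ r → r < k → S r ≡ S' r) → readRows k S ≡ readRows k S'
readRows-cong zero eq = refl
readRows-cong (suc k) eq = cong₂ _++_ (eq k (n<1+n k))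
    (readRows-cong k (λ r r<k → eq r (<-trans r<k (n<1+n k))))

countV-∷ : ∀ c x xs → countV c (x ∷ xs) ≡ countV c (x ∷ []) + countV c xs
countV-∷ c x xs = countV-++ c (x ∷ []) xs

countV-update : ∀ x {c a} k {S : Rows} {t} → a < k → S a ≡ t ∷ʳ c →
  countV x (readRows k S) ≡ countV x (c ∷ readRows k (update a t S))
countV-update x {c} {a} (suc k) {S} {t} a<k eq with a ≟ k
... | yes refl = begin
    countV x (S a ++ readRows a S)
        ≡⟨ cong₂ (λ u v → countV x (u ++ v)) eq
        (readRows-cong a λ r r<a → sym (update-≢ t S (≢-sym (<⇒≢ r<a)))) ⟩
    countV x ((t ∷ʳ c) ++ rest)                        ≡⟨ cong (countV x) (++-assoc t (c ∷ []) rest) ⟩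
    countV x (t ++ c ∷ rest)                           ≡⟨ countV-++ x t (c ∷ rest) ⟩
    countV x t + countV x (c ∷ rest)                   ≡⟨ cong (countV x t +_) (countV-∷ x c rest) ⟩
    countV x t + (countV x (c ∷ []) + countV x rest)
        ≡⟨ x∙yz≈y∙xz (countV x t) (countV x (c ∷ [])) (countV x rest) ⟩
    countV x (c ∷ []) + (countV x t + countV x rest)   ≡⟨ cong (countV x (c ∷ []) +_) (countV-++ x t rest) ⟨
    countV x (c ∷ []) + countV x (t ++ rest)           ≡⟨ countV-∷ x c (t ++ rest) ⟨
    countV x (c ∷ t ++ rest)
        ≡⟨ cong (λ u → countV x (c ∷ u ++ rest)) (update-≡ a t S) ⟨
    countV x (c ∷ update a t S a ++ rest)              ∎
  where
  open ≡-Reasoning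
  rest = readRows a (update a t S)
... | no a≢k = begin
    countV x (S k ++ readRows k S)                      ≡⟨ countV-++ x (S k) (readRows k S) ⟩
    countV x (S k) + countV x (readRows k S)
        ≡⟨ cong (countV x (S k) +_) (trans (countV-update x k (≤∧≢⇒< (s≤s⁻¹ a<k) a≢k) eq) (countV-∷ x c rest)) ⟩
    countV x (S k) + (countV x (c ∷ []) + countV x rest)
        ≡⟨ x∙yz≈y∙xz (countV x (S k)) (countV x (c ∷ [])) (countV x rest) ⟩
    countV x (c ∷ []) + (countV x (S k) + countV x rest)
        ≡⟨ cong (countV x (c ∷ []) +_) (countV-++ x (S k) rest) ⟨
    countV x (c ∷ []) + countV x (S k ++ rest)          ≡⟨ countV-∷ x c (S k ++ rest) ⟨
    countV x (c ∷ S k ++ rest)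
        ≡⟨ cong (λ u → countV x (c ∷ u ++ rest)) (update-≢ t S a≢k) ⟨
    countV x (c ∷ update a t S k ++ rest)               ∎
  where
  open ≡-Reasoning
  rest = readRows k (update a t S)

record Semistandard (k : ℕ) (S : Rows) : Set where
  field
    weak  : ∀ r → Weak (S r)
    col   : ∀ r → Col (S r) (S (suc r))
    empty : ∀ r → k ≤ r → S r ≡ []

-- No cell can rest on the removed one: its entry would exceed c.
Col-unsnocˡ : ∀ t {c s} → Col (t ∷ʳ c) s → All (_≤ c) s → Col t s
Col-unsnocˡ [] [] _ = []
Col-unsnocˡ (_ ∷ _) [] _ = []
Col-unsnocˡ [] (lt ∷ _) (le ∷ _) = ⊥-elim (n≮n _ (<-≤-trans lt le))
Col-unsnocˡ (x ∷ t) (lt ∷ c) (_ ∷ ps) = lt ∷ Col-unsnocˡ t c ps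

Col-unsnocʳ : ∀ {r c} t → Col r (t ∷ʳ c) → Col r t
Col-unsnocʳ [] _ = []
Col-unsnocʳ (x ∷ t) (lt ∷ c) = lt ∷ Col-unsnocʳ t c

-- The biword of row indices y and letters s records the filling of a tableau one cell at
-- a time, the last added cell first; rowS r y s is row r of the resulting tableau.
rowS : ℕ → List ℕ → List ℕ → List ℕ
rowS r (a ∷ y) (c ∷ s) = if a ≡ᵇ r then rowS r y s ∷ʳ c else rowS r y s
rowS r _ _ = []

rowS-≡ : ∀ a y c s → rowS a (a ∷ y) (c ∷ s) ≡ rowS a y s ∷ʳ c
rowS-≡ a y c s rewrite ≡ᵇ-refl a = refl

rowS-≢ : ∀ {a r} y c s → a ≢ r → rowS r (a ∷ y) (c ∷ s) ≡ rowS r y s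
rowS-≢ y c s a≢r rewrite ≢⇒≡ᵇ-false a≢r = refl

length-rowS : ∀ r y s → length y ≡ length s → length (rowS r y s) ≡ countV r y
length-rowS r [] s _ = refl
length-rowS r (a ∷ y) (c ∷ s) eq with a ≟ r
... | yes refl rewrite rowS-≡ a y c s = trans (length-++ (rowS a y s))
    (trans (+-comm _ 1) (trans (cong suc (length-rowS a y s (suc-injective eq))) (sym (countV-∷-≡ a y))))
... | no a≢r rewrite rowS-≢ y c s a≢r = trans (length-rowS r y s (suc-injective eq))
    (sym (countV-∷-≢ y (≢-sym a≢r)))

Lattice : List ℕ → Set
Lattice [] = ⊤
Lattice (a ∷ y) = (∀ r → countV (suc r) (a ∷ y) ≤ countV r (a ∷ y)) × Lattice y

-- Equal letters are added from the top row down.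
Compatible : List ℕ → List ℕ → Set
Compatible (a ∷ y) (c ∷ s) = (∀ r → c ∈ rowS r y s → a ≤ r) × Compatible y s
Compatible _ _ = ⊤

-- Standardisation of S: y lists the rows of its cells, the last added first, and s their letters.
record Filling (k : ℕ) (s : List ℕ) (S : Rows) : Set where
  field
    y          : List ℕ
    length-y   : length y ≡ length s
    y<k        : All (_< k) y
    lattice    : Lattice y
    compatible : Compatible y s
    rows≡      : ∀ r → rowS r y s ≡ S r

  counts : ∀ r → countV r y ≡ length (S r)
  counts r = trans (sym (length-rowS r y s length-y)) (cong length (rows≡ r))

-- Induction by removing the largest letter from the lowest row that has it. The lattice condition
-- says that the cells present at each stage form a partition shape, which `Col` provides.
filling : ∀ k s S → AllPairs _≥_ s → Semistandard k S →
  (∀ c → countV c (readRows k S) ≡ countV c s) → Filling k s S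
filling k [] S _ ss content = record
  { y = [] ; length-y = refl ; y<k = [] ; lattice = tt ; compatible = tt ; rows≡ = λ r → sym (rows-empty r) }
  where
  rows-empty : ∀ r → S r ≡ []
  rows-empty r with r <? k
  ... | no r≮k = Semistandard.empty ss r (≮⇒≥ r≮k)
  ... | yes r<k with S r in eq
  ...   | [] = refl
  ...   | x ∷ xs = ⊥-elim (n≮0 (subst (0 <_) (content x)
      (countV-∈ (∈-readRows k S r<k (subst (x ∈_) (sym eq) (here refl))))))
filling k (c ∷ s) S (c≥s ∷ dec) ss content with lowestRow {c} k S
    (countV-pos _ (subst (0 <_) (sym (content c)) (countV-∈ {c} (here refl))))
... | a , a<k , c∈a , least = result
  where
  letters≤c : ∀ r → All (_≤ c) (S r)
  letters≤c r = All.tabulate λ {x} x∈ → le x (in-s x x∈)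
    where
    in-s : ∀ x → x ∈ S r → x ∈ c ∷ s
    in-s x x∈ with r <? k
    ... | yes r<k = countV-pos _ (subst (0 <_) (content x) (countV-∈ (∈-readRows k S r<k x∈)))
    ... | no r≮k with subst (x ∈_) (Semistandard.empty ss r (≮⇒≥ r≮k)) x∈
    ...   | ()
    le : ∀ x → x ∈ c ∷ s → x ≤ c
    le x (here refl) = ≤-refl
    le x (there m) = All.lookup c≥s m
  t : List ℕ
  t = proj₁ (Weak-max-last (S a) (Semistandard.weak ss a) c∈a (letters≤c a))
  Sa≡ : S a ≡ t ∷ʳ c
  Sa≡ = proj₂ (Weak-max-last (S a) (Semistandard.weak ss a) c∈a (letters≤c a))
  S' : Rows
  S' = update a t S
  weak' : ∀ r → Weak (S' r)
  weak' r with a ≟ r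
  ... | yes refl rewrite update-≡ a t S = AllPairs-++ˡ t (subst Weak Sa≡ (Semistandard.weak ss a))
  ... | no a≢r rewrite update-≢ t S a≢r = Semistandard.weak ss r
  col' : ∀ r → Col (S' r) (S' (suc r))
  col' r with a ≟ r | a ≟ suc r
  ... | yes refl | yes a≡ = ⊥-elim (<⇒≢ (n<1+n a) a≡)
  ... | yes refl | no a≢ rewrite update-≡ a t S | update-≢ t S a≢ =
    Col-unsnocˡ t (subst (λ u → Col u (S (suc a))) Sa≡ (Semistandard.col ss a)) (letters≤c (suc a))
  ... | no a≢r | yes refl rewrite update-≡ (suc r) t S | update-≢ t S a≢r =
    Col-unsnocʳ t (subst (Col (S r)) Sa≡ (Semistandard.col ss r))
  ... | no a≢r | no a≢ rewrite update-≢ t S a≢ | update-≢ t S a≢r = Semistandard.col ss r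
  ss' : Semistandard k S'
  ss' = record { weak = weak' ; col = col' ; empty = λ r k≤r → trans
      (update-≢ {a} {r} t S (λ { refl → n≮n k (≤-<-trans k≤r a<k) })) (Semistandard.empty ss r k≤r) }
  content' : ∀ x → countV x (readRows k S') ≡ countV x s
  content' x = +-cancelˡ-≡ (countV x (c ∷ [])) _ _ (trans (sym (countV-∷ x c _))
    (trans (sym (countV-update x k a<k Sa≡)) (trans (content x) (countV-∷ x c s))))
  ih : Filling k s S'
  ih = filling k s S' dec ss' content'
  open Filling ih renaming (y to y')
  extended : ∀ r → rowS r (a ∷ y') (c ∷ s) ≡ S r
  extended r with a ≟ r
  ... | yes refl = trans (rowS-≡ a y' c s) (trans (cong (_∷ʳ c) (trans (rows≡ a) (update-≡ a t S))) (sym Sa≡))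
  ... | no a≢r = trans (rowS-≢ y' c s a≢r) (trans (rows≡ r) (update-≢ t S a≢r))
  below : ∀ r → c ∈ rowS r y' s → a ≤ r
  below r c∈ with a ≟ r
  ... | yes refl = ≤-refl
  ... | no a≢r = least r (subst (c ∈_) (trans (rows≡ r) (update-≢ t S a≢r)) c∈)
  result : Filling k (c ∷ s) S
  result = record
    { y = a ∷ y' ; length-y = cong suc length-y ; y<k = a<k ∷ y<k
    ; lattice = (λ r → subst₂ _≤_ (cnt (suc r)) (cnt r) (Col-length (Semistandard.col ss r))) , lattice
    ; compatible = below , compatible ; rows≡ = extended }
    where
    cnt : ∀ r → length (S r) ≡ countV r (a ∷ y')
    cnt r = trans (sym (cong length (extended r))) (length-rowS r (a ∷ y') (c ∷ s) (cong suc length-y))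

-- The rows alone do not tell in which order equal letters were added. Compatibility does: the last
-- letter c must sit in the lowest row that contains c, so a and a' bound each other.
rowS-injective : ∀ y y' s → length y ≡ length s → length y' ≡ length s → Compatible y s → Compatible y' s →
  (∀ r → rowS r y s ≡ rowS r y' s) → y ≡ y'
rowS-injective [] [] [] _ _ _ _ _ = refl
rowS-injective (a ∷ y) (a' ∷ y') (c ∷ s) l l' (low , cp) (low' , cp') eq = go (<-cmp a a')
  where
  last∈ : ∀ a y → c ∈ rowS a (a ∷ y) (c ∷ s)
  last∈ a y = subst (c ∈_) (sym (rowS-≡ a y c s)) (∈-++⁺ʳ (rowS a y s) (here refl))
  go : Tri (a < a') (a ≡ a') (a > a') → a ∷ y ≡ a' ∷ y'
  go (tri< lt ne _) = ⊥-elim (n≮n a (<-≤-trans lt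
      (low' a (subst (c ∈_) (trans (eq a) (rowS-≢ y' c s (≢-sym ne))) (last∈ a y)))))
  go (tri> _ ne gt) = ⊥-elim (n≮n a' (<-≤-trans gt
      (low a' (subst (c ∈_) (trans (sym (eq a')) (rowS-≢ y c s ne)) (last∈ a' y')))))
  go (tri≈ _ refl _) = cong (a ∷_) (rowS-injective y y' s (suc-injective l) (suc-injective l') cp cp' earlier)
    where
    earlier : ∀ r → rowS r y s ≡ rowS r y' s
    earlier r with a ≟ r
    ... | yes refl = ∷ʳ-injectiveˡ _ _ (trans (sym (rowS-≡ a y c s)) (trans (eq a) (rowS-≡ a y' c s)))
    ... | no a≢r = trans (sym (rowS-≢ y c s a≢r)) (trans (eq r) (rowS-≢ y' c s a≢r))

-- Connectivity of lattice words

-- One step exchanges the rows of the two largest letters when the third largest sits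
-- between them in the reading word; this is the effect of d_i with i - 1 in the middle.
infix 4 _∼_
data _∼_ : List ℕ → List ℕ → Set where
  stay : ∀ {y} → y ∼ y
  _then_ : ∀ {x y z} → x ∼ y → y ∼ z → x ∼ z
  add  : ∀ a {y z} → y ∼ z → a ∷ y ∼ a ∷ z
  exchange : ∀ {a b c z} → (b ≤ c × c < a) ⊎ (a ≤ c × c < b) → a ∷ b ∷ c ∷ z ∼ b ∷ a ∷ c ∷ z

∼-count : ∀ r {y z} → y ∼ z → countV r y ≡ countV r z
∼-count r stay = refl
∼-count r (p then q) = trans (∼-count r p) (∼-count r q)
∼-count r (add a {y} {z} p) = trans (countV-∷ r a y)
    (trans (cong (countV r (a ∷ []) +_) (∼-count r p)) (sym (countV-∷ r a z)))
∼-count r (exchange {a} {b} {c} {z} _) = countV-↭ r (Perm.swap a b Perm.refl)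

∼-length : ∀ {y z} → y ∼ z → length y ≡ length z
∼-length stay = refl
∼-length (p then q) = trans (∼-length p) (∼-length q)
∼-length (add a p) = cong suc (∼-length p)
∼-length (exchange _) = refl

∼-prepend : ∀ p {y z} → y ∼ z → p ++ y ∼ p ++ z
∼-prepend [] q = q
∼-prepend (a ∷ p) q = add a (∼-prepend p q)

-- With a and b the rows of the two largest letters, a lattice word admits a third corner c between
-- them, so the induction hypothesis puts the third largest letter there and the exchange applies.
raise : ∀ m y b → length y ≤ m → Lattice y → countV (suc b) y < countV b y → ∃ λ y' → y ∼ b ∷ y' × Lattice
    (b ∷ y')
raise m [] b _ _ lt = ⊥-elim (n≮0 lt)
raise (suc m) (a ∷ z) b (s≤s len) (lat , lat-z) corner with a ≟ b
... | yes refl = z , stay , lat , lat-z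
... | no a≢b with raise m z b len lat-z corner-z
  where
  corner-z : countV (suc b) z < countV b z
  corner-z = ≤-<-trans (subst (countV (suc b) z ≤_) (sym (countV-∷ (suc b) a z)) (m≤n+m _ _))
      (subst (countV (suc b) (a ∷ z) <_) (countV-∷-≢ z (≢-sym a≢b)) corner)
... | z' , z∼ , lat-b , lat-z' = finish
  where
  y : List ℕ
  y = a ∷ z
  y∼ : y ∼ a ∷ b ∷ z'
  y∼ = add a z∼
  count-y : ∀ r → countV r y ≡ countV r (a ∷ b ∷ z')
  count-y r = ∼-count r y∼
  count-b : ∀ r → b ≢ r → countV r y ≡ countV r (a ∷ z')
  count-b r b≢r = trans (count-y r) (trans (∼-swap r) (countV-∷-≢ (a ∷ z') (≢-sym b≢r)))
    where
    ∼-swap : ∀ r → countV r (a ∷ b ∷ z') ≡ countV r (b ∷ a ∷ z')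
    ∼-swap r = countV-↭ r (Perm.swap a b Perm.refl)
  count-bb : countV b y ≡ suc (countV b (a ∷ z'))
  count-bb = trans (count-y b) (trans (countV-∷-≢ (b ∷ z') (≢-sym a≢b))
      (trans (countV-∷-≡ b z') (cong suc (sym (countV-∷-≢ z' (≢-sym a≢b))))))
  -- The induction hypothesis gives the lattice condition for b ∷ z'; for a ∷ z' it comes from that
  -- of y with b deleted, and the corner at b enters when r = b.
  lat-az' : ∀ r → countV (suc r) (a ∷ z') ≤ countV r (a ∷ z')
  lat-az' r with b ≟ r | b ≟ suc r
  ... | yes refl | _ = s≤s⁻¹ (subst₂ _≤_ (cong suc (count-b (suc b) (<⇒≢ (n<1+n b)))) count-bb corner)
  ... | no b≢r | yes refl = ≤-trans (n≤1+n _) (subst₂ _≤_ count-bb (count-b r b≢r) (lat r))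
  ... | no b≢r | no b≢sr = subst₂ _≤_ (count-b (suc r) b≢sr) (count-b r b≢r) (lat r)
  len' : length z' ≤ m
  len' = ≤-trans (n≤1+n _) (subst (_≤ m) (∼-length z∼) len)
  -- Take c directly below the higher of the rows a and b. The lattice inequality at c, with the
  -- letter of that higher row still present, becomes strict when this letter is removed, so z' has
  -- a corner in row c.
  between-rows : ∃ λ c → ((b ≤ c × c < a) ⊎ (a ≤ c × c < b)) × countV (suc c) z' < countV c z'
  between-rows with <-cmp a b
  between-rows | tri≈ _ a≡b _ = ⊥-elim (a≢b a≡b)
  between-rows | tri> _ _ (s≤s {n = c} b≤c) = c , inj₁ (b≤c , n<1+n c) ,
    subst₂ _≤_ (countV-∷-≡ a z') (countV-∷-≢ z' (<⇒≢ (n<1+n c))) (lat-az' c)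
  between-rows | tri< (s≤s {n = c} a≤c) _ _ = c , inj₂ (a≤c , n<1+n c) ,
    subst₂ _≤_ (countV-∷-≡ b z') (countV-∷-≢ z' (<⇒≢ (n<1+n c))) (lat-b c)
  finish : ∃ λ y' → a ∷ z ∼ b ∷ y' × Lattice (b ∷ y')
  finish with between-rows
  ... | c , mid , corner-c with raise m z' c len' lat-z' corner-c
  ...   | z'' , z'∼ , lat-c = a ∷ c ∷ z'' , y∼b , lat-final
    where
    y∼b : a ∷ z ∼ b ∷ a ∷ c ∷ z''
    y∼b = y∼ then (add a (add b z'∼) then exchange mid)
    lat-final : Lattice (b ∷ a ∷ c ∷ z'')
    lat-final = (λ r → subst₂ _≤_ (∼-count (suc r) y∼b) (∼-count r y∼b) (lat r)) ,
      (λ r → subst₂ _≤_ (∼-count (suc r) (add a z'∼)) (∼-count r (add a z'∼)) (lat-az' r)) , lat-c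

-- For c the row lengths of λ, this is the lattice word of U_λ.
superstandard : (ℕ → ℕ) → ℕ → List ℕ
superstandard c zero = []
superstandard c (suc k) = replicate (c k) k ++ superstandard c k

superstandard-cong : ∀ k {c c'} → (∀ r → r < k → c r ≡ c' r) → superstandard c k ≡ superstandard c' k
superstandard-cong zero eq = refl
superstandard-cong (suc k) eq = cong₂ (λ m t → replicate m k ++ t) (eq k (n<1+n k))
    (superstandard-cong k (λ r r<k → eq r (<-trans r<k (n<1+n k))))

-- Row k is the highest one in use, so it has a corner as long as it is not empty, and `raise` can
-- be repeated.
raise-all : ∀ m k y → Lattice y → (∀ r → k < r → countV r y ≡ 0) → countV k y ≡ m →
  ∃ λ y' → y ∼ replicate m k ++ y' × Lattice y' × (∀ r → k ≤ r → countV r y' ≡ 0) ×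
      (∀ r → r < k → countV r y ≡ countV r y')
raise-all zero k y lat above eq = y , stay , lat , above' , λ _ _ → refl
  where
  above' : ∀ r → k ≤ r → countV r y ≡ 0
  above' r k≤r with k ≟ r
  ... | yes refl = eq
  ... | no k≢r = above r (≤∧≢⇒< k≤r k≢r)
raise-all (suc m) k y lat above eq with raise (length y) y k ≤-refl lat
    (subst₂ _<_ (sym (above (suc k) (n<1+n k))) (sym eq) z<s)
... | y₁ , y∼ , _ , lat₁ with raise-all m k y₁ lat₁
        (λ r k<r → trans (sym (countV-∷-≢ y₁ (≢-sym (<⇒≢ k<r)))) (trans (sym (∼-count r y∼)) (above r k<r)))
        (suc-injective (trans (sym (countV-∷-≡ k y₁)) (trans (sym (∼-count k y∼)) eq)))
...   | y' , y₁∼ , lat' , above' , below' = y' , (y∼ then add k y₁∼) , lat' , above' ,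
        λ r r<k → trans (∼-count r y∼) (trans (countV-∷-≢ y₁ (<⇒≢ r<k)) (below' r r<k))

∼-superstandard : ∀ k y → Lattice y → (∀ r → k ≤ r → countV r y ≡ 0) → y ∼ superstandard (λ r → countV r y) k
∼-superstandard zero [] _ _ = stay
∼-superstandard zero (a ∷ y) _ none = ⊥-elim (n≮0
    (subst (0 <_) (trans (sym (countV-∷-≡ a y)) (none a z≤n)) z<s))
∼-superstandard (suc k) y lat above with raise-all (countV k y) k y lat above refl
... | y' , y∼ , lat' , above' , below' = y∼ then subst
    (λ t → replicate (countV k y) k ++ y' ∼ replicate (countV k y) k ++ t)
  (superstandard-cong k λ r r<k → sym (below' r r<k))
      (∼-prepend (replicate (countV k y) k) (∼-superstandard k y' lat' above'))

-- Tableaux of lattice words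

-- Indices start at 1 and count from the end of the list.
at : List ℕ → ℕ → ℕ
at [] j = 0
at (c ∷ s) j = if j ≡ᵇ suc (length s) then c else at s j

at-head : ∀ c s → at (c ∷ s) (suc (length s)) ≡ c
at-head c s rewrite ≡ᵇ-refl (length s) = refl

at-tail : ∀ c s {j} → j ≤ length s → at (c ∷ s) j ≡ at s j
at-tail c s {j} j≤ rewrite ≢⇒≡ᵇ-false {j} {suc (length s)} (<⇒≢ (s≤s j≤)) = refl

at-++ : ∀ p s {j} → j ≤ length s → at (p ++ s) j ≡ at s j
at-++ [] s _ = refl
at-++ (e ∷ p) s j≤ = trans (at-tail e (p ++ s)
    (≤-trans j≤ (≤-trans (m≤n+m _ (length p)) (≤-reflexive (sym (length-++ p)))))) (at-++ p s j≤)

down : ℕ → List ℕ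
down zero = []
down (suc n) = suc n ∷ down n

length-down : ∀ n → length (down n) ≡ n
length-down zero = refl
length-down (suc n) = cong suc (length-down n)

at-down : ∀ n {j} → 1 ≤ j → j ≤ n → at (down n) j ≡ j
at-down zero (s≤s _) ()
at-down (suc n) {j} 1≤j j≤ with j ≟ suc n
... | yes refl = trans (cong (at (down (suc n))) (cong suc (sym (length-down n)))) (at-head (suc n) (down n))
... | no j≢ = trans (at-tail (suc n) (down n) (subst (j ≤_) (sym (length-down n)) j≤n)) (at-down n 1≤j j≤n)
  where
  j≤n : j ≤ n
  j≤n = s≤s⁻¹ (≤∧≢⇒< j≤ j≢)

down-≤ : ∀ {x} n → x ∈ down n → 1 ≤ x × x ≤ n
down-≤ (suc n) (here refl) = s≤s z≤n , ≤-refl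
down-≤ (suc n) (there m) = proj₁ (down-≤ n m) , ≤-trans (proj₂ (down-≤ n m)) (n≤1+n n)

rowS-∈⁻ : ∀ {c} r y s → length y ≡ length s → c ∈ rowS r y s →
  ∃ λ j → 1 ≤ j × j ≤ length s × at s j ≡ c × at y j ≡ r
rowS-∈⁻ {c} r (a ∷ y) (e ∷ s) len c∈ = go (a ≟ r)
  where
  lift : c ∈ rowS r y s → ∃ λ j → 1 ≤ j × j ≤ length (e ∷ s) × at (e ∷ s) j ≡ c × at (a ∷ y) j ≡ r
  lift m with rowS-∈⁻ r y s (suc-injective len) m
  ... | j , 1≤j , j≤ , e₁ , e₂ = j , 1≤j , ≤-trans j≤ (n≤1+n _) , trans (at-tail e s j≤) e₁ ,
    trans (at-tail a y (subst (j ≤_) (sym (suc-injective len)) j≤)) e₂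
  go : Dec (a ≡ r) → ∃ λ j → 1 ≤ j × j ≤ length (e ∷ s) × at (e ∷ s) j ≡ c × at (a ∷ y) j ≡ r
  go (no a≢r) = lift (subst (c ∈_) (rowS-≢ y e s a≢r) c∈)
  go (yes refl) with ∈-++⁻ (rowS a y s) (subst (c ∈_) (rowS-≡ a y e s) c∈)
  ... | inj₁ m = lift m
  ... | inj₂ (here refl) = suc (length s) , s≤s z≤n , ≤-refl , at-head e s ,
    trans (cong (at (a ∷ y)) (sym len)) (at-head a y)

rowS-∷ : ∀ {x} r a y e s → x ∈ rowS r y s → x ∈ rowS r (a ∷ y) (e ∷ s)
rowS-∷ r a y e s m with a ≡ᵇ r
... | true = ∈-++⁺ˡ m
... | false = m

rowS-∈⁺ : ∀ y s {j} → length y ≡ length s → 1 ≤ j → j ≤ length s → at s j ∈ rowS (at y j) y s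
rowS-∈⁺ [] [] _ (s≤s _) ()
rowS-∈⁺ (a ∷ y) (e ∷ s) {j} len 1≤j j≤ with j ≟ suc (length s)
... | yes refl rewrite at-head e s | trans (cong (at (a ∷ y)) (sym len)) (at-head a y) | rowS-≡ a y e s =
    ∈-++⁺ʳ (rowS a y s) (here refl)
... | no j≢ = subst₂ (λ u v → u ∈ rowS v (a ∷ y) (e ∷ s)) (sym (at-tail e s j≤'))
    (sym (at-tail a y (subst (j ≤_) (sym (suc-injective len)) j≤')))
      (rowS-∷ (at y j) a y e s (rowS-∈⁺ y s (suc-injective len) 1≤j j≤'))
  where
  j≤' : j ≤ length s
  j≤' = s≤s⁻¹ (≤∧≢⇒< j≤ j≢)

rowS-⊆ : ∀ {x} r y s → x ∈ rowS r y s → x ∈ s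
rowS-⊆ r (a ∷ y) (e ∷ s) m with a ≡ᵇ r
... | false = there (rowS-⊆ r y s m)
... | true with ∈-++⁻ (rowS r y s) m
...   | inj₁ m' = there (rowS-⊆ r y s m')
...   | inj₂ (here refl) = here refl

-- The rows of the standard tableau encoded by y: cell j lies in row `at y j`.
numbered : List ℕ → Rows
numbered y r = rowS r y (down (length y))

numbered-≡ : ∀ a y → numbered (a ∷ y) a ≡ numbered y a ∷ʳ suc (length y)
numbered-≡ a y = rowS-≡ a y (suc (length y)) (down (length y))

numbered-≢ : ∀ {a r} y → a ≢ r → numbered (a ∷ y) r ≡ numbered y r
numbered-≢ y = rowS-≢ y (suc (length y)) (down (length y))

numbered-increasing : ∀ y r → Increasing (numbered y r)
numbered-increasing [] r = []
numbered-increasing (a ∷ y) r with a ≡ᵇ r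
... | false = numbered-increasing y r
... | true = Increasing-snoc (numbered-increasing y r)
    (All.tabulate λ m → s≤s (proj₂ (down-≤ (length y) (rowS-⊆ r y _ m))))

numbered-∈⁻ : ∀ {x} y r → x ∈ numbered y r → 1 ≤ x × x ≤ length y × at y x ≡ r
numbered-∈⁻ y r m with rowS-∈⁻ r y (down (length y)) (sym (length-down (length y))) m
... | j , 1≤j , j≤ , e₁ , e₂ with trans (sym e₁)
    (at-down (length y) 1≤j (subst (j ≤_) (length-down (length y)) j≤))
...   | refl = 1≤j , subst (j ≤_) (length-down (length y)) j≤ , e₂

numbered-∈⁺ : ∀ y {j} → 1 ≤ j → j ≤ length y → j ∈ numbered y (at y j)
numbered-∈⁺ y {j} 1≤j j≤ = subst (_∈ numbered y (at y j)) (at-down (length y) 1≤j j≤)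
  (rowS-∈⁺ y (down (length y)) (sym (length-down (length y))) 1≤j
      (subst (j ≤_) (sym (length-down (length y))) j≤))

-- Destandardisation: the number of a cell is replaced by the letter of the content that was added
-- with it.
map-at-numbered : ∀ r y s → length y ≡ length s → map (at s) (numbered y r) ≡ rowS r y s
map-at-numbered r [] [] _ = refl
map-at-numbered r (a ∷ y) (c ∷ s) len with a ≡ᵇ r
... | false = trans (map-cong-local (All.tabulate λ m → at-tail c s
    (subst (_ ≤_) (suc-injective len) (proj₁ (proj₂ (numbered-∈⁻ y r m))))))
    (map-at-numbered r y s (suc-injective len))
... | true = trans (map-++ (at (c ∷ s)) (numbered y r) _)
  (cong₂ (λ u v → u ∷ʳ v)
    (trans (map-cong-local (All.tabulate λ m → at-tail c s
        (subst (_ ≤_) (suc-injective len) (proj₁ (proj₂ (numbered-∈⁻ y r m))))))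
        (map-at-numbered r y s (suc-injective len)))
    (trans (cong (at (c ∷ s)) len) (at-head c s)))

tableau : ℕ → Rows → Tableau
tableau k S = map S (upTo k)

tableau-cong : ∀ k {S S'} → (∀ r → S r ≡ S' r) → tableau k S ≡ tableau k S'
tableau-cong k eq = map-cong eq (upTo k)

tableau-suc : ∀ k S → tableau (suc k) S ≡ tableau k S ∷ʳ S k
tableau-suc k S = trans (cong (map S) (sym (upTo-∷ʳ k))) (map-++ S (upTo k) (k ∷ []))

reading-∷ʳ : ∀ T r → reading (T ∷ʳ r) ≡ r ++ reading T
reading-∷ʳ T r = cong concat (reverse-++ T (r ∷ []))

reading-tableau : ∀ k S → reading (tableau k S) ≡ readRows k S
reading-tableau zero S = refl
reading-tableau (suc k) S = trans (cong reading (tableau-suc k S))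
    (trans (reading-∷ʳ (tableau k S) (S k)) (cong (S k ++_) (reading-tableau k S)))

rowAt : Tableau → Rows
rowAt [] r = []
rowAt (x ∷ T) zero = x
rowAt (x ∷ T) (suc r) = rowAt T r

applyUpTo-cong : ∀ {A : Set} k {f g : ℕ → A} → (∀ i → i < k → f i ≡ g i) → applyUpTo f k ≡ applyUpTo g k
applyUpTo-cong zero eq = refl
applyUpTo-cong (suc k) eq = cong₂ _∷_ (eq 0 z<s) (applyUpTo-cong k (λ i i<k → eq (suc i) (s<s i<k)))

tableau-rowAt : ∀ T → tableau (length T) (rowAt T) ≡ T
tableau-rowAt T = trans (map-upTo (rowAt T) (length T)) (go T)
  where
  go : ∀ T → applyUpTo (rowAt T) (length T) ≡ T
  go [] = refl
  go (x ∷ T) = cong (x ∷_) (go T)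

numbered-superstandard-above : ∀ k c r → k ≤ r → numbered (superstandard c k) r ≡ []

numbered-replicate : ∀ m k y r → k ≢ r → numbered (replicate m k ++ y) r ≡ numbered y r
numbered-replicate zero k y r _ = refl
numbered-replicate (suc m) k y r k≢r = trans (numbered-≢ (replicate m k ++ y) k≢r)
    (numbered-replicate m k y r k≢r)

numbered-replicate-≡ : ∀ m k y → numbered (replicate m k ++ y) k ≡ numbered y k ++ map (length y +_) (range1 m)
numbered-replicate-≡ zero k y = sym (++-identityʳ _)
numbered-replicate-≡ (suc m) k y = begin
  numbered (k ∷ replicate m k ++ y) k                           ≡⟨ numbered-≡ k (replicate m k ++ y) ⟩
  numbered (replicate m k ++ y) k ∷ʳ suc (length (replicate m k ++ y))
      ≡⟨ cong₂ _∷ʳ_ (numbered-replicate-≡ m k y) len ⟩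
  (numbered y k ++ map (length y +_) (range1 m)) ∷ʳ (length y + suc m) ≡⟨ ++-assoc (numbered y k) _ _ ⟩
  numbered y k ++ map (length y +_) (range1 m) ∷ʳ
      (length y + suc m) ≡⟨ cong (numbered y k ++_) (map-++ (length y +_) (range1 m) (suc m ∷ [])) ⟨
  numbered y k ++ map (length y +_) (range1 m ∷ʳ suc m)
      ≡⟨ cong (λ t → numbered y k ++ map (length y +_) t) (range1-∷ʳ m) ⟨
  numbered y k ++ map (length y +_) (range1 (suc m))            ∎
  where
  open ≡-Reasoning
  len : suc (length (replicate m k ++ y)) ≡ length y + suc m
  len = trans (cong suc (trans (length-++ (replicate m k)) (cong (_+ length y) (length-replicate m))))
      (+-comm (suc m) (length y))

numbered-superstandard-above zero c r _ = refl
numbered-superstandard-above (suc k) c r k<r = trans (numbered-replicate (c k) k _ r (<⇒≢ k<r))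
    (numbered-superstandard-above k c r (<⇒≤ k<r))

-- The word is read from its end, so all lower rows are complete when row r begins; their total size
-- is the offset.
numbered-superstandard : ∀ k c r → r < k → numbered (superstandard c k) r ≡ map
    (length (superstandard c r) +_) (range1 (c r))
numbered-superstandard (suc k) c r r<k with k ≟ r
... | yes refl = trans (numbered-replicate-≡ (c k) k (superstandard c k))
    (cong (_++ map (length (superstandard c k) +_) (range1 (c k))) (numbered-superstandard-above k c k ≤-refl))
... | no k≢r = trans (numbered-replicate (c k) k _ r k≢r)
    (numbered-superstandard k c r (≤∧≢⇒< (s≤s⁻¹ r<k) (≢-sym k≢r)))

part : List ℕ → ℕ → ℕ
part [] r = 0
part (l ∷ ls) zero = l
part (l ∷ ls) (suc r) = part ls r

Ufill-superstandard : ∀ la j c → (∀ i → c (j + i) ≡ part la i) →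
  Ufill (length (superstandard c j)) la ≡ applyUpTo
      (λ i → map (length (superstandard c (j + i)) +_) (range1 (c (j + i)))) (length la)
Ufill-superstandard [] j c _ = refl
Ufill-superstandard (l ∷ ls) j c eq = cong₂ _∷_
  (cong₂ (λ u v → map (length (superstandard c u) +_) (range1 v)) (sym (+-identityʳ j)) (sym (eq 0)))
  (trans (cong (λ t → Ufill t ls) len) (trans (Ufill-superstandard ls (suc j) c
      (λ i → trans (cong c (sym (+-suc j i))) (eq (suc i))))
    (applyUpTo-cong (length ls) λ i _ → cong (λ u → map (length (superstandard c u) +_) (range1 (c u)))
        (sym (+-suc j i)))))
  where
  len : length (superstandard c j) + l ≡ length (superstandard c (suc j))
  len = trans (+-comm _ l) (sym (trans (length-++ (replicate (c j) j))
      (cong (_+ length (superstandard c j)) (trans (length-replicate (c j))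
      (trans (cong c (sym (+-identityʳ j))) (eq 0))))))

U-superstandard : ∀ la → tableau (length la) (numbered (superstandard (part la) (length la))) ≡ U la
U-superstandard la = trans (map-upTo _ (length la))
    (trans (applyUpTo-cong (length la) (λ i i<k → numbered-superstandard (length la) (part la) i i<k))
  (sym (Ufill-superstandard la 0 (part la) λ _ → refl)))

-- Reading order of cells and the exchange as d_i

before-skip : ∀ {a b} p u → a ∉ p → b ∉ p → a before b within u → a before b within (p ++ u)
before-skip [] u _ _ lt = lt
before-skip {a} {b} (e ∷ p) u a∉ b∉ lt
  rewrite pos-there {a} {e} (p ++ u) (λ eq → a∉ (here eq)) | pos-there {b} {e} (p ++ u) (λ eq → b∉ (here eq))
  = s<s (before-skip p u (a∉ ∘ there) (b∉ ∘ there) lt)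

-- Higher rows are read first, and each row is increasing.
before-numbered : ∀ y k {i j} → 1 ≤ i → i ≤ length y → 1 ≤ j → j ≤ length y → at y i < k →
  at y j < at y i ⊎ (at y j ≡ at y i × i < j) → i before j within (readRows k (numbered y))
before-numbered y (suc k) {i} {j} 1≤i i≤ 1≤j j≤ i<k o with at y i ≟ k
... | no i≢k = before-skip (numbered y k) _ (λ m → i≢k (proj₂ (proj₂ (numbered-∈⁻ y k m))))
      (λ m → n≮n k (≤-<-trans (subst (_≤ at y i) (proj₂ (proj₂ (numbered-∈⁻ y k m))) (row-≤ o)) i<k'))
      (before-numbered y k 1≤i i≤ 1≤j j≤ i<k' o)
  where
  i<k' : at y i < k
  i<k' = ≤∧≢⇒< (s≤s⁻¹ i<k) i≢k
  row-≤ : at y j < at y i ⊎ (at y j ≡ at y i × i < j) → at y j ≤ at y i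
  row-≤ (inj₁ lt) = <⇒≤ lt
  row-≤ (inj₂ (eq , _)) = ≤-reflexive eq
before-numbered y (suc k) {i} {j} 1≤i i≤ 1≤j j≤ i<k (inj₁ lt) | yes refl =
  before-split (numbered y k) _ (numbered-∈⁺ y 1≤i i≤) (λ m → <⇒≢ lt (proj₂ (proj₂ (numbered-∈⁻ y k m))))
before-numbered y (suc k) {i} {j} 1≤i i≤ 1≤j j≤ i<k (inj₂ (eq , i<j)) | yes refl =
  before-sorted (numbered y k) _ (numbered-increasing y k) (numbered-∈⁺ y 1≤i i≤)
      (subst (λ r → j ∈ numbered y r) eq (numbered-∈⁺ y 1≤j j≤)) i<j

-- The exchanged cells lie in different rows, so each row receives its entries in the same order and
-- only the numbers N + 1 and N + 2 change places.
rowS-exchange : ∀ r p {a b w} → a ≢ b → let N = length w in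
  numbered (p ++ b ∷ a ∷ w) r ≡ map (swapV (suc N) (2 + N)) (numbered (p ++ a ∷ b ∷ w) r)
rowS-exchange r (e ∷ p) {a} {b} {w} a≢b with e ≡ᵇ r
... | false = rowS-exchange r p a≢b
... | true = trans (cong₂ _∷ʳ_ (rowS-exchange r p a≢b) top)
    (sym (map-++ (swapV (suc N) (2 + N)) (numbered (p ++ a ∷ b ∷ w) r) _))
  where
  N = length w
  len : ∀ c d → length (p ++ c ∷ d ∷ w) ≡ length p + (2 + N)
  len c d = length-++ p
  big : 2 + N < suc (length (p ++ a ∷ b ∷ w))
  big = s≤s (subst (2 + N ≤_) (sym (len a b)) (m≤n+m _ _))
  top : suc (length (p ++ b ∷ a ∷ w)) ≡ swapV (suc N) (2 + N) (suc (length (p ++ a ∷ b ∷ w)))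
  top = trans (cong suc (trans (len b a) (sym (len a b))))
      (sym (swapV-other (≢-sym (<⇒≢ (<-trans (n<1+n _) big))) (≢-sym (<⇒≢ big))))
rowS-exchange r [] {a} {b} {w} a≢b = go (a ≟ r) (b ≟ r)
  where
  N = length w
  sw = swapV (suc N) (2 + N)
  R = numbered w r
  fixed : R ≡ map sw R
  fixed = sym (map-id-local (All.tabulate λ m → swapV-other (<⇒≢ (s≤s (small m)))
      (<⇒≢ (s≤s (≤-trans (small m) (n≤1+n _))))))
    where
    small : ∀ {x} → x ∈ R → x ≤ N
    small m = proj₁ (proj₂ (numbered-∈⁻ w r m))
  go : Dec (a ≡ r) → Dec (b ≡ r) → numbered (b ∷ a ∷ w) r ≡ map sw (numbered (a ∷ b ∷ w) r)
  go (yes refl) (yes refl) = ⊥-elim (a≢b refl)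
  go (yes refl) (no b≢r) = trans (numbered-≢ (a ∷ w) b≢r) (trans (numbered-≡ a w)
    (trans (cong₂ _∷ʳ_ fixed (sym (swapV-right (suc N) (2 + N))))
    (trans (sym (map-++ sw R (2 + N ∷ []))) (cong (map sw)
        (sym (trans (numbered-≡ a (b ∷ w)) (cong (_∷ʳ (2 + N)) (numbered-≢ w b≢r))))))))
  go (no a≢r) (yes refl) = trans (numbered-≡ b (a ∷ w)) (trans (cong (_∷ʳ (2 + N)) (numbered-≢ w a≢r))
    (trans (cong₂ _∷ʳ_ fixed (sym (swapV-left (suc N) (2 + N))))
    (trans (sym (map-++ sw R (suc N ∷ []))) (cong (map sw)
        (sym (trans (numbered-≢ (b ∷ w) a≢r) (numbered-≡ b w)))))))
  go (no a≢r) (no b≢r) = trans (numbered-≢ (a ∷ w) b≢r) (trans (numbered-≢ w a≢r)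
    (trans fixed (cong (map sw) (sym (trans (numbered-≢ (b ∷ w) a≢r) (numbered-≢ w b≢r))))))

module Exchange (k : ℕ) (p : List ℕ) (a b c : ℕ) (z : List ℕ)
  (mid : (b ≤ c × c < a) ⊎ (a ≤ c × c < b)) (y<k : All (_< k) (p ++ a ∷ b ∷ c ∷ z)) where

  private
    y : List ℕ
    y = p ++ a ∷ b ∷ c ∷ z
    -- The cells of c, b, a bear the numbers m, m + 1, m + 2. Thus i = m + 1, and the cell of c
    -- plays the part of i - 1.
    m : ℕ
    m = suc (length z)
    u : Word
    u = reading (tableau k (numbered y))
    m≤ : 2 + m ≤ length y
    m≤ = ≤-trans (m≤n+m (2 + m) (length p)) (≤-reflexive (sym (length-++ p)))
    at-a : at y (2 + m) ≡ a
    at-a = trans (at-++ p (a ∷ b ∷ c ∷ z) ≤-refl) (at-head a (b ∷ c ∷ z))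
    at-b : at y (suc m) ≡ b
    at-b = trans (at-++ p (a ∷ b ∷ c ∷ z) (n≤1+n _)) (trans (at-tail a (b ∷ c ∷ z) ≤-refl) (at-head b (c ∷ z)))
    at-c : at y m ≡ c
    at-c = trans (at-++ p (a ∷ b ∷ c ∷ z) (m≤n+m m 2))
        (trans (at-tail a (b ∷ c ∷ z) (n≤1+n _)) (trans (at-tail b (c ∷ z) ≤-refl) (at-head c z)))
    rows<k : ∀ {x} → x ∈ a ∷ b ∷ c ∷ z → x < k
    rows<k x∈ = All.lookup y<k (∈-++⁺ʳ p x∈)
    order : ∀ {i j} → 1 ≤ i → i ≤ 2 + m → 1 ≤ j → j ≤ 2 + m → at y i < k →
      at y j < at y i ⊎ (at y j ≡ at y i × i < j) → i before j within u
    order {i} {j} 1≤i i≤ 1≤j j≤ i<k o = subst (i before j within_) (sym (reading-tableau k (numbered y)))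
      (before-numbered y k 1≤i (≤-trans i≤ m≤) 1≤j (≤-trans j≤ m≤) i<k o)
    split : ∀ {r r'} → r ≤ r' → r < r' ⊎ r ≡ r'
    split le = m≤n⇒m<n∨m≡n le

  -- A tie with the row of c is settled by the numbers: m is the smallest and is read first within
  -- its row. This is why `exchange` has a weak inequality on one side of c and a strict one on the
  -- other.
  positions : (suc m before m within u × m before (2 + m) within u) ⊎
      ((2 + m) before m within u × m before suc m within u)
  positions = go mid
    where
    go : (b ≤ c × c < a) ⊎ (a ≤ c × c < b) → (suc m before m within u × m before (2 + m) within u) ⊎
        ((2 + m) before m within u × m before suc m within u)
    go (inj₁ (b≤c , c<a)) = inj₂
      ( order (s≤s z≤n) ≤-refl (s≤s z≤n) (m≤n+m m 2) (subst (_< k) (sym at-a) (rows<k (here refl)))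
          (inj₁ (subst₂ _<_ (sym at-c) (sym at-a) c<a))
      , order (s≤s z≤n) (m≤n+m m 2) (s≤s z≤n) (n≤1+n _)
          (subst (_< k) (sym at-c) (rows<k (there (there (here refl)))))
          (tie (split b≤c)))
      where
      tie : b < c ⊎ b ≡ c → at y (suc m) < at y m ⊎ (at y (suc m) ≡ at y m × m < suc m)
      tie (inj₁ lt) = inj₁ (subst₂ _<_ (sym at-b) (sym at-c) lt)
      tie (inj₂ eq) = inj₂ (trans at-b (trans eq (sym at-c)) , n<1+n m)
    go (inj₂ (a≤c , c<b)) = inj₁
      ( order (s≤s z≤n) (n≤1+n _) (s≤s z≤n) (m≤n+m m 2) (subst (_< k) (sym at-b) (rows<k (there (here refl))))
          (inj₁ (subst₂ _<_ (sym at-c) (sym at-b) c<b))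
      , order (s≤s z≤n) (m≤n+m m 2) (s≤s z≤n) ≤-refl
          (subst (_< k) (sym at-c) (rows<k (there (there (here refl)))))
          (tie (split a≤c)))
      where
      tie : a < c ⊎ a ≡ c → at y (2 + m) < at y m ⊎ (at y (2 + m) ≡ at y m × m < 2 + m)
      tie (inj₁ lt) = inj₁ (subst₂ _<_ (sym at-a) (sym at-c) lt)
      tie (inj₂ eq) = inj₂ (trans at-a (trans eq (sym at-c)) , m<n+m m {2} z<s)

  private
    ∈u : ∀ {j} → 1 ≤ j → j ≤ 2 + m → at y j < k → j ∈ u
    ∈u {j} 1≤j j≤ j<k = subst (j ∈_) (sym (reading-tableau k (numbered y)))
        (∈-readRows k (numbered y) j<k (numbered-∈⁺ y 1≤j (≤-trans j≤ m≤)))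

  a≢b : a ≢ b
  a≢b = [ (λ (b≤c , c<a) → ≢-sym (<⇒≢ (≤-<-trans b≤c c<a))) , (λ (a≤c , c<b) → <⇒≢ (≤-<-trans a≤c c<b)) ]′ mid

  dT-exchange : dT (suc m) (tableau k (numbered y)) ≡ tableau k (numbered (p ++ b ∷ a ∷ c ∷ z))
  dT-exchange = trans (map-cong (map-cong (dVal-i-1 m u
      (∈u (s≤s z≤n) (m≤n+m m 2) (subst (_< k) (sym at-c) (rows<k (there (there (here refl))))))
      (∈u (s≤s z≤n) (n≤1+n _) (subst (_< k) (sym at-b) (rows<k (there (here refl))))) positions))
          (tableau k (numbered y)))
    (trans (sym (map-∘ (upTo k))) (map-cong (λ r → sym (rowS-exchange r p a≢b)) (upTo k)))

  signs-differ : isBefore m (suc m) u ≢ isBefore (suc m) (2 + m) u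
  signs-differ eq with positions
  ... | inj₁ (Bm , mC) = case (trans (sym (≤⇒<ᵇ-false (<⇒≤ Bm))) (trans eq (<⇒<ᵇ-true (<-trans Bm mC))))
    where
    case : false ≡ true → ⊥
    case ()
  ... | inj₂ (Cm , mB) = case (trans (sym (<⇒<ᵇ-true mB)) (trans eq (≤⇒<ᵇ-false (<⇒≤ (<-trans Cm mB)))))
    where
    case : true ≡ false → ⊥
    case ()

-- Counting

tally : ∀ {A : Set} → (A → Bool) → List A → ℕ
tally p xs = length (filterᵇ p xs)

bit : Bool → ℕ
bit b = if b then 1 else 0

tally-sum : ∀ {A : Set} (p : A → Bool) xs → tally p xs ≡ sum (map (bit ∘ p) xs)
tally-sum p [] = refl
tally-sum p (x ∷ xs) with p x
... | true = cong suc (tally-sum p xs)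
... | false = tally-sum p xs

∈-filterᵇ⁺ : ∀ {A : Set} (p : A → Bool) {x xs} → x ∈ xs → p x ≡ true → x ∈ filterᵇ p xs
∈-filterᵇ⁺ p x∈ px = ∈-filter⁺ (T? ∘ p) x∈ (Equivalence.from T-≡ px)

∈-filterᵇ⁻ : ∀ {A : Set} (p : A → Bool) {x} xs → x ∈ filterᵇ p xs → x ∈ xs × p x ≡ true
∈-filterᵇ⁻ p xs x∈ with ∈-filter⁻ (T? ∘ p) {xs = xs} x∈
... | x∈xs , px = x∈xs , Equivalence.to T-≡ px

sum-cong : ∀ {A : Set} {f g : A → ℕ} xs → (∀ x → x ∈ xs → f x ≡ g x) → sum (map f xs) ≡ sum (map g xs)
sum-cong xs eq = cong sum (map-cong-local (All.tabulate λ {x} → eq x))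

sum-zero : ∀ {A : Set} {f : A → ℕ} xs → (∀ x → x ∈ xs → f x ≡ 0) → sum (map f xs) ≡ 0
sum-zero [] _ = refl
sum-zero (x ∷ xs) eq = cong₂ _+_ (eq x (here refl)) (sum-zero xs (λ z m → eq z (there m)))

sum-const : ∀ {A : Set} c (xs : List A) → sum (map (λ _ → c) xs) ≡ c * length xs
sum-const c [] = sym (*-zeroʳ c)
sum-const c (x ∷ xs) = trans (cong (c +_) (sum-const c xs)) (sym (*-suc c (length xs)))

sum-+ : ∀ {A : Set} (f g : A → ℕ) xs → sum (map (λ x → f x + g x) xs) ≡ sum (map f xs) + sum (map g xs)
sum-+ f g [] = refl
sum-+ f g (x ∷ xs) = trans (cong (f x + g x +_) (sum-+ f g xs))
    (interchange (f x) (g x) (sum (map f xs)) (sum (map g xs)))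

sum-swap : ∀ {A B : Set} (f : A → B → ℕ) xs ys →
  sum (map (λ x → sum (map (f x) ys)) xs) ≡ sum (map (λ y → sum (map (λ x → f x y) xs)) ys)
sum-swap f [] ys = sym (sum-zero ys (λ _ _ → refl))
sum-swap f (x ∷ xs) ys = trans (cong (sum (map (f x) ys) +_) (sum-swap f xs ys))
    (sym (sum-+ (f x) (λ y → sum (map (λ x → f x y) xs)) ys))

tally-swap : ∀ {A B : Set} (R : A → B → Bool) xs ys →
  sum (map (λ y → tally (λ x → R x y) xs) ys) ≡ sum (map (λ x → tally (R x) ys) xs)
tally-swap R xs ys = trans (sum-cong ys (λ y _ → tally-sum (λ x → R x y) xs))
  (trans (sum-swap (λ y x → bit (R x y)) ys xs) (sum-cong xs (λ x _ → sym (tally-sum (R x) ys))))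

sum-single : ∀ {A : Set} (f : A → ℕ) {x₀ xs} → Unique xs → x₀ ∈ xs → (∀ x → x ∈ xs → x ≢ x₀ → f x ≡ 0) → sum
    (map f xs) ≡ f x₀
sum-single f {x₀} {x ∷ xs} (px ∷ u) (here refl) zeros =
  trans (cong (f x +_) (sum-zero xs λ z m → zeros z (there m) λ { refl → All.lookup px m refl }))
      (+-identityʳ (f x))
sum-single f {x₀} {x ∷ xs} (px ∷ u) (there m) zeros =
  cong₂ _+_ (zeros x (here refl) λ { refl → All.lookup px m refl })
      (sum-single f u m λ z z∈ → zeros z (there z∈))

tally-single : ∀ {A : Set} (p : A → Bool) {x₀ xs} → Unique xs → x₀ ∈ xs →
    (∀ x → x ∈ xs → p x ≡ true → x ≡ x₀) → tally p xs ≡ bit (p x₀)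
tally-single p {x₀} {xs} u x₀∈ only = trans (tally-sum p xs) (sum-single (bit ∘ p) u x₀∈ zeros)
  where
  zeros : ∀ x → x ∈ xs → x ≢ x₀ → bit (p x) ≡ 0
  zeros x x∈ x≢ with p x in eq
  ... | false = refl
  ... | true = ⊥-elim (x≢ (only x x∈ eq))

tally-zero : ∀ {A : Set} (p : A → Bool) xs → (∀ x → x ∈ xs → p x ≡ false) → tally p xs ≡ 0
tally-zero p xs none = trans (tally-sum p xs) (sum-zero xs λ x m → cong bit (none x m))

tally-cong : ∀ {A : Set} {p q : A → Bool} xs → (∀ x → x ∈ xs → p x ≡ q x) → tally p xs ≡ tally q xs
tally-cong {p = p} {q} xs eq = trans (tally-sum p xs)
    (trans (sum-cong xs λ x m → cong bit (eq x m)) (sym (tally-sum q xs)))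

bool-ext : ∀ {a b : Bool} → (a ≡ true → b ≡ true) → (b ≡ true → a ≡ true) → a ≡ b
bool-ext {true} {b} f _ = sym (f refl)
bool-ext {false} {true} _ g = g refl
bool-ext {false} {false} _ _ = refl

-- Stated for a relation because the edges of a graph are given as one. The partner of the first
-- element is deleted from `ys`; by injectivity no other element has the same partner.
pigeonhole : ∀ {A : Set} {R : A → A → Set} → (∀ {x x' y} → R x y → R x' y → x ≡ x') →
  ∀ {xs} ys → Unique xs → (∀ x → x ∈ xs → ∃ λ y → y ∈ ys × R x y) → length xs ≤ length ys
pigeonhole inj {[]} ys _ _ = z≤n
pigeonhole {R = R} inj {x ∷ xs} ys (px ∷ u) f with f x (here refl)
... | y , y∈ , xRy with ∈-∃++ y∈
...   | l , r , refl = subst (suc (length xs) ≤_) (sym (length-++-sucʳ l y r))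
    (s≤s (pigeonhole inj (l ++ r) u g))
  where
  g : ∀ x' → x' ∈ xs → ∃ λ y' → y' ∈ l ++ r × R x' y'
  g x' x'∈ with f x' (there x'∈)
  ... | y' , y'∈ , x'Ry' with ∈-++⁻ l y'∈
  ...   | inj₁ m = y' , ∈-++⁺ˡ m , x'Ry'
  ...   | inj₂ (there m) = y' , ∈-++⁺ʳ l m , x'Ry'
  ...   | inj₂ (here refl) = ⊥-elim (All.lookup px x'∈ (inj xRy x'Ry'))

-- Enumerations of words, fillings and partitions

-- The common recursion step of `wordsOver`, `fillings` and `partsB`; membership and uniqueness are
-- proved here for all three.
extensions : ∀ {A : Set} → List A → (A → List (List A)) → List (List A)
extensions xs L = concatMap (λ a → map (a ∷_) (L a)) xs

∈-extensions⁺ : ∀ {A : Set} {a t} {xs : List A} (L : A → List (List A)) → a ∈ xs → t ∈ L a →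
    (a ∷ t) ∈ extensions xs L
∈-extensions⁺ L (here refl) t∈ = ∈-++⁺ˡ (∈-map⁺ _ t∈)
∈-extensions⁺ {xs = x ∷ xs} L (there a∈) t∈ = ∈-++⁺ʳ (map (x ∷_) (L x)) (∈-extensions⁺ L a∈ t∈)

∈-extensions⁻ : ∀ {A : Set} {t} (xs : List A) (L : A → List (List A)) → t ∈ extensions xs L →
  ∃ λ a → ∃ λ t' → t ≡ a ∷ t' × a ∈ xs × t' ∈ L a
∈-extensions⁻ (x ∷ xs) L m with ∈-++⁻ (map (x ∷_) (L x)) m
... | inj₁ m' with ∈-map⁻ (x ∷_) m'
...   | t' , t'∈ , refl = x , t' , refl , here refl , t'∈
∈-extensions⁻ (x ∷ xs) L m | inj₂ m' with ∈-extensions⁻ xs L m'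
... | a , t' , eq , a∈ , t'∈ = a , t' , eq , there a∈ , t'∈

extensions-unique : ∀ {A : Set} {xs : List A} (L : A → List (List A)) → Unique xs → (∀ a → Unique (L a)) →
    Unique (extensions xs L)
extensions-unique L [] _ = []
extensions-unique {xs = x ∷ xs} L (px ∷ u) uL = Uniqueₚ.++⁺ (Uniqueₚ.map⁺ ∷-injectiveʳ (uL x))
    (extensions-unique L u uL) disjoint
  where
  disjoint : ∀ {t} → t ∈ map (x ∷_) (L x) × t ∈ extensions xs L → ⊥
  disjoint (m₁ , m₂) with ∈-map⁻ (x ∷_) m₁ | ∈-extensions⁻ xs L m₂
  ... | _ , _ , refl | _ , _ , refl , a∈ , _ = All.lookup px a∈ refl

Letter : ℕ → ℕ → Set
Letter ℓ x = 1 ≤ x × x ≤ ℓ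

wordsOver-unique : ∀ m ℓ → Unique (wordsOver m ℓ)
wordsOver-unique zero ℓ = [] ∷ []
wordsOver-unique (suc m) ℓ = extensions-unique _ (range1-unique ℓ) (λ _ → wordsOver-unique m ℓ)

∈-wordsOver⁺ : ∀ {ℓ} t → All (Letter ℓ) t → t ∈ wordsOver (length t) ℓ
∈-wordsOver⁺ [] [] = here refl
∈-wordsOver⁺ {ℓ} (x ∷ t) ((1≤x , x≤) ∷ ps) = ∈-extensions⁺ (λ _ → wordsOver (length t) ℓ) (∈-range1⁺ 1≤x x≤)
    (∈-wordsOver⁺ t ps)

∈-wordsOver⁻ : ∀ m {ℓ t} → t ∈ wordsOver m ℓ → length t ≡ m × All (Letter ℓ) t
∈-wordsOver⁻ zero (here refl) = refl , []
∈-wordsOver⁻ (suc m) {ℓ} t∈ with ∈-extensions⁻ (range1 ℓ) (λ _ → wordsOver m ℓ) t∈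
... | a , t' , refl , a∈ , t'∈ with ∈-wordsOver⁻ m t'∈
...   | len , ps = cong suc len , ∈-range1⁻ a∈ ∷ ps

fillings-unique : ∀ la ℓ → Unique (fillings la ℓ)
fillings-unique [] ℓ = [] ∷ []
fillings-unique (l ∷ la) ℓ = extensions-unique _ (wordsOver-unique l ℓ) (λ _ → fillings-unique la ℓ)

∈-fillings⁺ : ∀ {ℓ} T → All (All (Letter ℓ)) T → T ∈ fillings (map length T) ℓ
∈-fillings⁺ [] [] = here refl
∈-fillings⁺ {ℓ} (r ∷ T) (p ∷ ps) = ∈-extensions⁺ (λ _ → fillings (map length T) ℓ) (∈-wordsOver⁺ r p)
    (∈-fillings⁺ T ps)

∈-fillings⁻ : ∀ la {ℓ T} → T ∈ fillings la ℓ → map length T ≡ la × All (All (Letter ℓ)) T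
∈-fillings⁻ [] (here refl) = refl , []
∈-fillings⁻ (l ∷ la) {ℓ} T∈ with ∈-extensions⁻ (wordsOver l ℓ) (λ _ → fillings la ℓ) T∈
... | r , T' , refl , r∈ , T'∈ with ∈-wordsOver⁻ l r∈ | ∈-fillings⁻ la T'∈
...   | refl , p | refl , ps = refl , p ∷ ps

partsB-unique : ∀ f m k → Unique (partsB f m k)
partsB-unique f zero k = [] ∷ []
partsB-unique zero (suc m) k = []
partsB-unique (suc f) (suc m) k = extensions-unique _ (Uniqueₚ.filter⁺ (T? ∘ (_≤ᵇ k)) (range1-unique (suc m)))
    (λ p → partsB-unique f (suc m ∸ p) p)

partsB-sum : ∀ f m k {la} → la ∈ partsB f m k → sum la ≡ m
partsB-sum f zero k (here refl) = refl
partsB-sum (suc f) (suc m) k la∈ with ∈-extensions⁻ (filterᵇ (λ p → p ≤ᵇ k) (range1 (suc m)))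
    (λ p → partsB f (suc m ∸ p) p) la∈
... | p , la' , refl , p∈ , la'∈ = trans (cong (p +_) (partsB-sum f (suc m ∸ p) p la'∈))
  (m+[n∸m]≡n (proj₂ (∈-range1⁻ (proj₁ (∈-filterᵇ⁻ (λ p → p ≤ᵇ k) (range1 (suc m)) p∈)))))

∈-partsB : ∀ f m k la → m ≤ f → sum la ≡ m → All (1 ≤_) la → All (_≤ k) la → AllPairs _≥_ la → la ∈ partsB f m k
∈-partsB f zero k [] _ _ _ _ _ = here refl
∈-partsB f zero k (zero ∷ la) _ _ (() ∷ _) _ _
∈-partsB (suc f) (suc m) k (p ∷ la) (s≤s m≤f) eq (1≤p ∷ pos) (p≤k ∷ _) (dec ∷ decs) =
  ∈-extensions⁺ (λ p → partsB f (suc m ∸ p) p)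
    (∈-filterᵇ⁺ (λ p → p ≤ᵇ k) (∈-range1⁺ 1≤p (≤-trans (m≤m+n p (sum la)) (≤-reflexive eq))) (≤⇒≤ᵇ-true p≤k))
    (∈-partsB f (suc m ∸ p) p la rest≤f (trans (sym (m+n∸m≡n p (sum la))) (cong (_∸ p) eq)) pos dec decs)
  where
  rest≤f : suc m ∸ p ≤ f
  rest≤f = ≤-trans (∸-monoʳ-≤ (suc m) 1≤p) m≤f

Weak-ext : ∀ xs ys → Weak xs → Weak ys → (∀ c → countV c xs ≡ countV c ys) → xs ≡ ys
Weak-ext [] [] _ _ _ = refl
Weak-ext [] (y ∷ ys) _ _ eq = ⊥-elim (n≮0 (subst (0 <_) (sym (eq y)) (countV-∈ {y} {y ∷ ys} (here refl))))
Weak-ext (x ∷ xs) [] _ _ eq = ⊥-elim (n≮0 (subst (0 <_) (eq x) (countV-∈ {x} {x ∷ xs} (here refl))))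
Weak-ext (x ∷ xs) (y ∷ ys) (px ∷ wx) (py ∷ wy) eq = go (≤-antisym (least py x x∈) (least px y y∈))
  where
  x∈ : x ∈ y ∷ ys
  x∈ = countV-pos _ (subst (0 <_) (eq x) (countV-∈ {x} {x ∷ xs} (here refl)))
  y∈ : y ∈ x ∷ xs
  y∈ = countV-pos _ (subst (0 <_) (sym (eq y)) (countV-∈ {y} {y ∷ ys} (here refl)))
  least : ∀ {z zs} → All (z ≤_) zs → ∀ w → w ∈ z ∷ zs → z ≤ w
  least _ w (here refl) = ≤-refl
  least p w (there m) = All.lookup p m
  go : y ≡ x → x ∷ xs ≡ y ∷ ys
  go refl = cong (x ∷_) (Weak-ext xs ys wx wy λ c → +-cancelˡ-≡ (countV c (x ∷ [])) _ _
      (trans (sym (countV-∷ c x xs)) (trans (eq c) (countV-∷ c x ys))))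

-- Contents and signs

descFrom : List Bool → ℕ → List ℕ → Bool
descFrom σ j [] = true
descFrom σ j (x ∷ []) = true
descFrom σ j (x ∷ y ∷ ys) = (not (x ≡ᵇ y) ∨ sgnAt σ j) ∧ descFrom σ (suc j) (y ∷ ys)

-- The local functions of descOK and hasContent cannot be named here: each underscore below is
-- solved by unification with the one in question at its use after the with-abstraction.
mutual
  desc-aux : ∀ σ s j xs → _ ≡ descFrom σ j xs
  descOK≡ : ∀ σ s → descOK σ s ≡ descFrom σ 1 s
  descOK≡ σ [] = refl
  descOK≡ σ (x ∷ []) = refl
  descOK≡ σ (x ∷ y ∷ ys) with x List.∷ y List.∷ ys
  ... | p with y List.∷ ys | 2
  ... | w | j = cong (_ ∧_) (desc-aux σ p j w)
  desc-aux σ s j [] = refl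
  desc-aux σ s j (x ∷ []) = refl
  desc-aux σ s j (x ∷ y ∷ ys) = cong (_ ∧_) (desc-aux σ s (suc j) (y ∷ ys))

contFrom : List ℕ → ℕ → List ℕ → Bool
contFrom s c [] = true
contFrom s c (a ∷ as) = (countV c s ≡ᵇ a) ∧ contFrom s (suc c) as

mutual
  cont-aux : ∀ α s c as → _ ≡ contFrom s c as
  hasContent≡ : ∀ α s → hasContent α s ≡ ((length s ≡ᵇ sum α) ∧ contFrom s 1 α)
  hasContent≡ [] s = refl
  hasContent≡ (a ∷ as) s with length s ≡ᵇ sum (a ∷ as) 
  ... | b with a List.∷ as | 2
  ... | p | c  = cong (b ∧_) (cong (_ ∧_) (cont-aux p s c as))
  cont-aux α s c [] = refl
  cont-aux α s c (a ∷ as) = cong (_ ∧_) (cont-aux α s (suc c) as)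

-- Weakly decreasing, since a biword lists the last added cell first.
sortedWord : ℕ → List ℕ → List ℕ
sortedWord c [] = []
sortedWord c (a ∷ α) = sortedWord (suc c) α ++ replicate a c

length-sortedWord : ∀ c α → length (sortedWord c α) ≡ sum α
length-sortedWord c [] = refl
length-sortedWord c (a ∷ α) = trans (length-++ (sortedWord (suc c) α))
  (trans (cong₂ _+_ (length-sortedWord (suc c) α) (length-replicate a)) (+-comm (sum α) a))

∈-replicate : ∀ {x c : ℕ} a → x ∈ replicate a c → x ≡ c
∈-replicate (suc a) (here refl) = refl
∈-replicate (suc a) (there m) = ∈-replicate a m

sortedWord-letters : ∀ c α {x} → x ∈ sortedWord c α → c ≤ x × x < c + length α
sortedWord-letters c (a ∷ α) {x} x∈ with ∈-++⁻ (sortedWord (suc c) α) x∈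
... | inj₁ m with sortedWord-letters (suc c) α m
...   | c<x , x< = <⇒≤ c<x , subst (x <_) (sym (+-suc c (length α))) x<
sortedWord-letters c (a ∷ α) x∈ | inj₂ m with ∈-replicate a m
... | refl = ≤-refl , m<m+n c z<s

replicate-antitone : ∀ a (c : ℕ) → AllPairs _≥_ (replicate a c)
replicate-antitone zero c = []
replicate-antitone (suc a) c = All.tabulate (λ m → ≤-reflexive (∈-replicate a m)) ∷ replicate-antitone a c

sortedWord-antitone : ∀ c α → AllPairs _≥_ (sortedWord c α)
sortedWord-antitone c [] = []
sortedWord-antitone c (a ∷ α) = AllPairsₚ.++⁺ (sortedWord-antitone (suc c) α) (replicate-antitone a c)
  (All.tabulate λ m → All.tabulate λ m' → ≤-trans (≤-reflexive (∈-replicate a m'))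
      (<⇒≤ (proj₁ (sortedWord-letters (suc c) α m))))

countV-replicate : ∀ a c → countV c (replicate a c) ≡ a
countV-replicate zero c = refl
countV-replicate (suc a) c = trans (countV-∷-≡ c (replicate a c)) (cong suc (countV-replicate a c))

sortedWord-count-≡ : ∀ c a α → countV c (sortedWord c (a ∷ α)) ≡ a
sortedWord-count-≡ c a α = trans (countV-++ c (sortedWord (suc c) α) (replicate a c))
  (cong₂ _+_ (countV-∉ (sortedWord (suc c) α) λ m → n≮n c (proj₁ (sortedWord-letters (suc c) α m)))
      (countV-replicate a c))

sortedWord-count-> : ∀ {c x} a α → c < x → countV x (sortedWord c (a ∷ α)) ≡ countV x (sortedWord (suc c) α)
sortedWord-count-> {c} {x} a α c<x = trans (countV-++ x (sortedWord (suc c) α) (replicate a c))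
  (trans (cong (countV x (sortedWord (suc c) α) +_)
      (countV-∉ (replicate a c) λ m → <⇒≢ c<x (sym (∈-replicate a m)))) (+-identityʳ _))

contFrom⇒count : ∀ t c α → contFrom t c α ≡ true → ∀ x → c ≤ x → x < c + length α → countV x t ≡ countV x
    (sortedWord c α)
contFrom⇒count t c [] _ x c≤x x< = ⊥-elim (n≮n x (<-≤-trans x< (≤-trans (≤-reflexive (+-identityʳ c)) c≤x)))
contFrom⇒count t c (a ∷ α) eq x c≤x x< with ∧-true {countV c t ≡ᵇ a} eq | c ≟ x
... | e , _ | yes refl = trans (≡ᵇ-true _ _ e) (sym (sortedWord-count-≡ c a α))
... | _ , eq' | no c≢x = trans (contFrom⇒count t (suc c) α eq' x (≤∧≢⇒< c≤x c≢x)
    (subst (x <_) (+-suc c (length α)) x<))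
  (sym (sortedWord-count-> a α (≤∧≢⇒< c≤x c≢x)))

count⇒contFrom : ∀ t c α → (∀ x → c ≤ x → countV x t ≡ countV x (sortedWord c α)) → contFrom t c α ≡ true
count⇒contFrom t c [] _ = refl
count⇒contFrom t c (a ∷ α) eq = true-∧ (≡⇒≡ᵇ-true (trans (eq c ≤-refl) (sortedWord-count-≡ c a α)))
  (count⇒contFrom t (suc c) α λ x c<x → trans (eq x (<⇒≤ c<x)) (sortedWord-count-> a α c<x))

hasContent⇒length : ∀ α t → hasContent α t ≡ true → length t ≡ sum α
hasContent⇒length α t eq = ≡ᵇ-true _ _ (proj₁ (∧-true (trans (sym (hasContent≡ α t)) eq)))

hasContent⇒count : ∀ α t → All (Letter (length α)) t → hasContent α t ≡ true → ∀ x → countV x t ≡ countV x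
    (sortedWord 1 α)
hasContent⇒count α t ps eq x with 1 ≤? x | x ≤? length α
... | yes 1≤x | yes x≤ = contFrom⇒count t 1 α (proj₂
    (∧-true {length t ≡ᵇ sum α} (trans (sym (hasContent≡ α t)) eq))) x 1≤x (s≤s x≤)
... | no ¬1≤x | _ = trans (countV-∉ t λ m → ¬1≤x (proj₁ (All.lookup ps m)))
    (sym (countV-∉ (sortedWord 1 α) λ m → ¬1≤x (proj₁ (sortedWord-letters 1 α m))))
... | yes _ | no x≰ = trans (countV-∉ t λ m → x≰ (proj₂ (All.lookup ps m)))
    (sym (countV-∉ (sortedWord 1 α) λ m → x≰ (s≤s⁻¹ (proj₂ (sortedWord-letters 1 α m)))))

count⇒hasContent : ∀ α t → length t ≡ sum α → (∀ x → countV x t ≡ countV x (sortedWord 1 α)) →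
    hasContent α t ≡ true
count⇒hasContent α t len eq = trans (hasContent≡ α t)
    (true-∧ (≡⇒≡ᵇ-true len) (count⇒contFrom t 1 α λ x _ → eq x))

-- Compatibility of row words, contents and signatures

map-at-range1 : ∀ s → map (at s) (range1 (length s)) ≡ reverse s
map-at-range1 [] = refl
map-at-range1 (c ∷ s) = begin
  map (at (c ∷ s)) (range1 (suc (length s)))            ≡⟨ cong (map (at (c ∷ s))) (range1-∷ʳ (length s)) ⟩
  map (at (c ∷ s)) (range1 (length s) ∷ʳ suc (length s))
      ≡⟨ map-++ (at (c ∷ s)) (range1 (length s)) (suc (length s) ∷ []) ⟩
  map (at (c ∷ s)) (range1 (length s)) ∷ʳ at (c ∷ s) (suc (length s))
    ≡⟨ cong₂ _∷ʳ_ (map-cong-local (All.tabulate λ m → at-tail c s (proj₂ (∈-range1⁻ m)))) (at-head c s) ⟩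
  map (at s) (range1 (length s)) ∷ʳ c                   ≡⟨ cong (_∷ʳ c) (map-at-range1 s) ⟩
  reverse s ∷ʳ c                                        ≡⟨ unfold-reverse c s ⟨
  reverse (c ∷ s)                                       ∎
  where open ≡-Reasoning

at-∈ : ∀ s {j} → 1 ≤ j → j ≤ length s → at s j ∈ s
at-∈ s {j} 1≤j j≤ = ∈-resp-↭ (↭-reverse s) (subst (at s j ∈_) (map-at-range1 s)
    (∈-map⁺ (at s) (∈-range1⁺ 1≤j j≤)))

at-mono : ∀ s {i j} → AllPairs _≥_ s → 1 ≤ i → i ≤ j → j ≤ length s → at s i ≤ at s j
at-mono [] _ (s≤s _) (s≤s _) ()
at-mono (c ∷ s) {i} {j} (pc ∷ dec) 1≤i i≤j j≤ with j ≟ suc (length s) | i ≟ suc (length s)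
... | yes refl | yes refl = ≤-refl
... | yes refl | no i≢ = subst₂ _≤_ (sym (at-tail c s i≤)) (sym (at-head c s)) (All.lookup pc (at-∈ s 1≤i i≤))
  where
  i≤ : i ≤ length s
  i≤ = s≤s⁻¹ (≤∧≢⇒< i≤j i≢)
... | no j≢ | _ = subst₂ _≤_ (sym (at-tail c s (≤-trans i≤j j≤'))) (sym (at-tail c s j≤'))
    (at-mono s dec 1≤i i≤j j≤')
  where
  j≤' : j ≤ length s
  j≤' = s≤s⁻¹ (≤∧≢⇒< j≤ j≢)

Weak-at : ∀ s → AllPairs _≥_ s → Weak (reverse s)
Weak-at [] _ = []
Weak-at (c ∷ s) (pc ∷ dec) = subst Weak (sym (unfold-reverse c s))
  (AllPairsₚ.++⁺ (Weak-at s dec) ([] ∷ []) (All.tabulate λ m → All.lookup pc (∈-resp-↭ (↭-reverse s) m) ∷ []))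

-- The signature sees only neighbouring letters of the content, whereas strictness of columns
-- compares arbitrary equal letters. `Compatible` is the inductive form of the same condition that
-- suits biwords.
AdjacentCompatible FullyCompatible : List ℕ → List ℕ → Set
AdjacentCompatible y s = ∀ j → 1 ≤ j → j < length s → at s j ≡ at s (suc j) → at y (suc j) ≤ at y j
FullyCompatible y s = ∀ i j → 1 ≤ i → i ≤ j → j ≤ length s → at s i ≡ at s j → at y j ≤ at y i

-- In a sorted word equal letters are contiguous, so the adjacent inequalities chain.
adjacent⇒full : ∀ y s → AllPairs _≥_ s → AdjacentCompatible y s → FullyCompatible y s
adjacent⇒full y s dec adj i j 1≤i i≤j = go j (≤⇒≤′ i≤j)
  where
  go : ∀ j → i ≤′ j → j ≤ length s → at s i ≡ at s j → at y j ≤ at y i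
  go j ≤′-refl _ _ = ≤-refl
  go (suc j) (≤′-step i≤′j) j< eq = ≤-trans (adj j (≤-trans 1≤i (≤′⇒≤ i≤′j)) j< (trans (sym i≡j) eq))
      (go j i≤′j (<⇒≤ j<) i≡j)
    where
    i≡j : at s i ≡ at s j
    i≡j = ≤-antisym (at-mono s dec 1≤i (≤′⇒≤ i≤′j) (<⇒≤ j<))
      (≤-trans (at-mono s dec (≤-trans 1≤i (≤′⇒≤ i≤′j)) (n≤1+n j) j<) (≤-reflexive (sym eq)))

full⇒compatible : ∀ y s → length y ≡ length s → FullyCompatible y s → Compatible y s
full⇒compatible [] _ _ _ = tt
full⇒compatible (a ∷ y) (c ∷ s) len full = top , full⇒compatible y s (suc-injective len) λ i j 1≤i i≤j j≤ eq →
    subst₂ _≤_ (at-tail a y (≤-trans j≤ (≤-reflexive (sym (suc-injective len)))))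
        (at-tail a y (≤-trans (≤-trans i≤j j≤) (≤-reflexive (sym (suc-injective len)))))
      (full i j 1≤i i≤j (≤-trans j≤ (n≤1+n _))
          (trans (at-tail c s (≤-trans i≤j j≤)) (trans eq (sym (at-tail c s j≤)))))
  where
  top : ∀ r → c ∈ rowS r y s → a ≤ r
  top r m with rowS-∈⁻ r y s (suc-injective len) m
  ... | j , 1≤j , j≤ , e₁ , refl = subst₂ _≤_ (trans (cong (at (a ∷ y)) (sym len)) (at-head a y))
      (at-tail a y (≤-trans j≤ (≤-reflexive (sym (suc-injective len)))))
      (full j (suc (length s)) 1≤j (≤-trans j≤ (n≤1+n _)) ≤-refl
          (trans (at-tail c s j≤) (trans e₁ (sym (at-head c s)))))

compatible⇒full : ∀ y s → length y ≡ length s → Compatible y s → FullyCompatible y s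
compatible⇒full [] [] _ _ _ _ (s≤s _) (s≤s _) ()
compatible⇒full (a ∷ y) (c ∷ s) len (top , cp) i j 1≤i i≤j j≤ eq with j ≟ suc (length s) | i ≟ suc (length s)
... | yes refl | yes refl = ≤-refl
... | yes refl | no i≢ = subst₂ _≤_ (sym (trans (cong (at (a ∷ y)) (sym len)) (at-head a y)))
    (sym (at-tail a y (≤-trans i≤ (≤-reflexive (sym (suc-injective len))))))
    (top (at y i) (subst (_∈ rowS (at y i) y s) (trans (sym (at-tail c s i≤)) (trans eq (at-head c s)))
        (rowS-∈⁺ y s (suc-injective len) 1≤i i≤)))
  where
  i≤ : i ≤ length s
  i≤ = s≤s⁻¹ (≤∧≢⇒< i≤j i≢)
... | no j≢ | _ = subst₂ _≤_ (sym (at-tail a y (≤-trans j≤' (≤-reflexive (sym (suc-injective len))))))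
    (sym (at-tail a y (≤-trans (≤-trans i≤j j≤') (≤-reflexive (sym (suc-injective len))))))
    (compatible⇒full y s (suc-injective len) cp i j 1≤i i≤j j≤'
        (trans (sym (at-tail c s (≤-trans i≤j j≤'))) (trans eq (at-tail c s j≤'))))
  where
  j≤' : j ≤ length s
  j≤' = s≤s⁻¹ (≤∧≢⇒< j≤ j≢)

descFrom-applyUpTo⁺ : ∀ σ m j g → (∀ i → suc i < m → g i ≡ g (suc i) → sgnAt σ (j + i) ≡ true) → descFrom σ j
    (applyUpTo g m) ≡ true
descFrom-applyUpTo⁺ σ zero j g _ = refl
descFrom-applyUpTo⁺ σ (suc zero) j g _ = refl
descFrom-applyUpTo⁺ σ (suc (suc m)) j g h = true-∧ first (descFrom-applyUpTo⁺ σ (suc m) (suc j) (g ∘ suc)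
    λ i lt eq → subst (λ t → sgnAt σ t ≡ true) (+-suc j i) (h (suc i) (s≤s lt) eq))
  where
  first : not (g 0 ≡ᵇ g 1) ∨ sgnAt σ j ≡ true
  first with g 0 ≡ᵇ g 1 in eq
  ... | false = refl
  ... | true = subst (λ t → sgnAt σ t ≡ true) (+-identityʳ j) (h 0 (s≤s (s≤s z≤n)) (≡ᵇ-true _ _ eq))

descFrom-applyUpTo⁻ : ∀ σ m j g → descFrom σ j (applyUpTo g m) ≡ true → ∀ i → suc i < m → g i ≡ g (suc i) →
    sgnAt σ (j + i) ≡ true
descFrom-applyUpTo⁻ σ (suc zero) j g _ _ (s≤s ()) _
descFrom-applyUpTo⁻ σ (suc (suc m)) j g d zero _ eq = subst (λ t → sgnAt σ t ≡ true) (sym (+-identityʳ j))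
    (strip eq (proj₁ (∧-true d)))
  where
  strip : g 0 ≡ g 1 → not (g 0 ≡ᵇ g 1) ∨ sgnAt σ j ≡ true → sgnAt σ j ≡ true
  strip e first rewrite ≡⇒≡ᵇ-true e = first
descFrom-applyUpTo⁻ σ (suc (suc m)) j g d (suc i) (s≤s lt) eq = subst (λ t → sgnAt σ t ≡ true) (sym (+-suc j i))
  (descFrom-applyUpTo⁻ σ (suc m) (suc j) (g ∘ suc) (proj₂ (∧-true {not (g 0 ≡ᵇ g 1) ∨ sgnAt σ j} d)) i lt eq)

reverse-at : ∀ s → reverse s ≡ applyUpTo (λ i → at s (suc i)) (length s)
reverse-at s = trans (sym (map-at-range1 s)) (trans (cong (map (at s)) (map-upTo suc (length s)))
    (map-applyUpTo suc (at s) (length s)))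

-- For s the sorted word of content α, this decides whether x^α occurs in the fundamental
-- quasisymmetric function of v.
signCompatible : ℕ → List ℕ → Word → Bool
signCompatible n s v = descFrom (sig n v) 1 (reverse s)

-- The sign at j is +1 exactly when cell j + 1 of P v lies weakly below cell j. Demanding sign +1
-- wherever neighbouring letters of s are equal is thus adjacent compatibility of y with s.
module _ {n k : ℕ} {v y s : List ℕ} (uq : Unique v) (P≡ : P v ≡ tableau k (numbered y)) (y<k : All (_< k) y)
  (len-y : length y ≡ n) (len-s : length s ≡ n) where

  private
    sign-row : ∀ j → 1 ≤ j → j < n → sgnAt (sig n v) j ≡ isBefore j (suc j) (readRows k (numbered y))
    sign-row j 1≤j j<n = trans (sgnAt-sig n v j 1≤j j<n)
        (trans (P-isBefore v uq j) (cong (isBefore j (suc j))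
        (trans (cong reading P≡) (reading-tableau k (numbered y)))))
    at<k : ∀ {j} → 1 ≤ j → j ≤ n → at y j < k
    at<k 1≤j j≤n = All.lookup y<k (at-∈ y 1≤j (≤-trans j≤n (≤-reflexive (sym len-y))))
    ≤n⇒ : ∀ {j} → j ≤ n → j ≤ length y
    ≤n⇒ j≤n = ≤-trans j≤n (≤-reflexive (sym len-y))

    sign⁺ : ∀ j → 1 ≤ j → j < n → at y (suc j) ≤ at y j → sgnAt (sig n v) j ≡ true
    sign⁺ j 1≤j j<n le = trans (sign-row j 1≤j j<n)
        (<⇒<ᵇ-true (before-numbered y k 1≤j (≤n⇒ (<⇒≤ j<n)) (s≤s z≤n) (≤n⇒ j<n) (at<k 1≤j (<⇒≤ j<n))
        (o (m≤n⇒m<n∨m≡n le))))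
      where
      o : at y (suc j) < at y j ⊎ at y (suc j) ≡ at y j → at y (suc j) < at y j ⊎
          (at y (suc j) ≡ at y j × j < suc j)
      o (inj₁ lt) = inj₁ lt
      o (inj₂ eq) = inj₂ (eq , n<1+n j)

    sign⁻ : ∀ j → 1 ≤ j → j < n → sgnAt (sig n v) j ≡ true → at y (suc j) ≤ at y j
    sign⁻ j 1≤j j<n eq = ≮⇒≥ λ lt → <-asym (<ᵇ-true _ _ (trans (sym (sign-row j 1≤j j<n)) eq))
      (before-numbered y k (s≤s z≤n) (≤n⇒ j<n) 1≤j (≤n⇒ (<⇒≤ j<n)) (at<k (s≤s z≤n) j<n) (inj₁ lt))

  signCompatible⇒Compatible : AllPairs _≥_ s → signCompatible n s v ≡ true → Compatible y s
  signCompatible⇒Compatible dec eq = full⇒compatible y s (trans len-y (sym len-s)) (adjacent⇒full y s dec adj)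
    where
    adj : AdjacentCompatible y s
    adj (suc i) _ j< e = sign⁻ (suc i) (s≤s z≤n) (≤-trans j< (≤-reflexive len-s))
      (descFrom-applyUpTo⁻ (sig n v) (length s) 1 (λ i → at s (suc i))
          (trans (cong (descFrom (sig n v) 1) (sym (reverse-at s))) eq) i j< e)

  Compatible⇒signCompatible : Compatible y s → signCompatible n s v ≡ true
  Compatible⇒signCompatible cp = trans (cong (descFrom (sig n v) 1) (reverse-at s))
    (descFrom-applyUpTo⁺ (sig n v) (length s) 1 _ λ i lt e → sign⁺ (suc i) (s≤s z≤n)
        (≤-trans lt (≤-reflexive len-s))
      (compatible⇒full y s (trans len-y (sym len-s)) cp (suc i) (2 + i) (s≤s z≤n) (n≤1+n _) lt e))

-- There is a single weakly increasing word of content α, so the coefficient is 0 or 1.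
coeffF-signs : ∀ n σ α → sum α ≡ n → coeffF n σ α ≡ bit (descFrom σ 1 (reverse (sortedWord 1 α)))
coeffF-signs n σ α refl = trans (tally-single p (wordsOver-unique (sum α) (length α)) w∈ only) (cong bit p-w)
  where
  w : Word
  w = reverse (sortedWord 1 α)
  p : Word → Bool
  p s = wincr s ∧ descOK σ s ∧ hasContent α s
  len-w : length w ≡ sum α
  len-w = trans (length-reverse (sortedWord 1 α)) (length-sortedWord 1 α)
  count-w : ∀ x → countV x w ≡ countV x (sortedWord 1 α)
  count-w x = countV-↭ x (↭-reverse (sortedWord 1 α))
  weak-w : Weak w
  weak-w = Weak-at _ (sortedWord-antitone 1 α)
  w∈ : w ∈ wordsOver (sum α) (length α)
  w∈ = subst (λ m → w ∈ wordsOver m (length α)) len-w (∈-wordsOver⁺ w (All.tabulate λ m →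
    proj₁ (sortedWord-letters 1 α (∈-resp-↭ (↭-reverse _) m)) , s≤s⁻¹
        (proj₂ (sortedWord-letters 1 α (∈-resp-↭ (↭-reverse (sortedWord 1 α)) m)))))
  only : ∀ x → x ∈ wordsOver (sum α) (length α) → p x ≡ true → x ≡ w
  only x x∈ px = Weak-ext x w (wincr⇒Weak x (proj₁ (∧-true px))) weak-w λ c →
    trans (hasContent⇒count α x (proj₂ (∈-wordsOver⁻ (sum α) x∈))
        (proj₂ (∧-true {descOK σ x} (proj₂ (∧-true {wincr x} px)))) c) (sym (count-w c))
  p-w : p w ≡ descFrom σ 1 w
  p-w rewrite Weak⇒wincr weak-w | count⇒hasContent α w len-w count-w = trans (∧-identityʳ _) (descOK≡ σ w)

coeffF-degree : ∀ n σ α → sum α ≢ n → coeffF n σ α ≡ 0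
coeffF-degree n σ α ≢n = tally-zero p (wordsOver n (length α)) none
  where
  p : Word → Bool
  p s = wincr s ∧ descOK σ s ∧ hasContent α s
  none : ∀ x → x ∈ wordsOver n (length α) → p x ≡ false
  none x x∈ with p x in px
  ... | false = refl
  ... | true = ⊥-elim (≢n (trans (sym (hasContent⇒length α x
      (proj₂ (∧-true {descOK σ x} (proj₂ (∧-true {wincr x} px)))))) (proj₁ (∈-wordsOver⁻ n x∈))))

down-↭ : ∀ n → down n ↭ range1 n
down-↭ zero = ↭-refl
down-↭ (suc n) = ↭-trans (prep (suc n) (down-↭ n))
  (↭-trans (++-comm (suc n ∷ []) (range1 n)) (↭-reflexive (sym (range1-∷ʳ n))))

-- The quasisymmetric expansion

==T⁺ : ∀ {S T} → S ≡ T → (S ==T T) ≡ true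
==T⁺ {S} {T} eq = dec-true (≡-dec (≡-dec _≟_) S T) eq

==T⁻ : ∀ {S T} → (S ==T T) ≡ true → S ≡ T
==T⁻ {S} {T} eq with ≡-dec (≡-dec _≟_) S T
... | yes S≡T = S≡T

rowAt-All : ∀ {Q : List ℕ → Set} T → Q [] → All Q T → ∀ r → Q (rowAt T r)
rowAt-All [] q _ r = q
rowAt-All (x ∷ T) q (p ∷ ps) zero = p
rowAt-All (x ∷ T) q (p ∷ ps) (suc r) = rowAt-All T q ps r

rowAt-Col : ∀ T → Linked Col T → ∀ r → Col (rowAt T r) (rowAt T (suc r))
rowAt-Col [] _ r = []
rowAt-Col (x ∷ []) _ zero = []
rowAt-Col (x ∷ []) _ (suc r) = []
rowAt-Col (x ∷ y ∷ T) (c ∷ _) zero = c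
rowAt-Col (x ∷ y ∷ T) (_ ∷ cs) (suc r) = rowAt-Col (y ∷ T) cs r

Cols-rowAt : ∀ T → (∀ r → Col (rowAt T r) (rowAt T (suc r))) → Linked Col T
Cols-rowAt [] _ = []
Cols-rowAt (x ∷ []) _ = [-]
Cols-rowAt (x ∷ y ∷ T) c = c 0 ∷ Cols-rowAt (y ∷ T) (c ∘ suc)

rowAt-≥ : ∀ T r → length T ≤ r → rowAt T r ≡ []
rowAt-≥ [] r _ = refl
rowAt-≥ (x ∷ T) (suc r) (s≤s le) = rowAt-≥ T r le

rowAt-map : ∀ (f : List ℕ → List ℕ) → f [] ≡ [] → ∀ T r → rowAt (map f T) r ≡ f (rowAt T r)
rowAt-map f f[] [] r = sym f[]
rowAt-map f f[] (x ∷ T) zero = refl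
rowAt-map f f[] (x ∷ T) (suc r) = rowAt-map f f[] T r

part-shape : ∀ T r → part (map length T) r ≡ length (rowAt T r)
part-shape [] r = refl
part-shape (x ∷ T) zero = refl
part-shape (x ∷ T) (suc r) = part-shape T r

readRows-rowAt : ∀ T → readRows (length T) (rowAt T) ≡ reading T
readRows-rowAt T = trans (sym (reading-tableau (length T) (rowAt T))) (cong reading (tableau-rowAt T))

fromTableau : ∀ {s} T → All Weak T → Linked Col T → AllPairs _≥_ s → (∀ c → countV c (concat T) ≡ countV c s) →
  Filling (length T) s (rowAt T)
fromTableau {s} T weak cs dec content = filling (length T) s (rowAt T) dec
  (record { weak = rowAt-All T [] weak ; col = rowAt-Col T cs ; empty = rowAt-≥ T })
  λ c → trans (cong (countV c) (readRows-rowAt T)) (trans (sym (countV-↭ c (concat-↭-reading T))) (content c))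

down-antitone : ∀ n → AllPairs _≥_ (down n)
down-antitone zero = []
down-antitone (suc n) = All.tabulate (λ m → ≤-trans (proj₂ (down-≤ n m)) (n≤1+n n)) ∷ down-antitone n

length-concat : ∀ (T : Tableau) → length (concat T) ≡ sum (map length T)
length-concat [] = refl
length-concat (r ∷ T) = trans (length-++ r) (cong (length r +_) (length-concat T))

Cols⇒shape-antitone : ∀ T → Linked Col T → AllPairs _≥_ (map length T)
Cols⇒shape-antitone [] _ = []
Cols⇒shape-antitone (r ∷ []) _ = [] ∷ []
Cols⇒shape-antitone (r ∷ s ∷ T) (c ∷ cs) with Cols⇒shape-antitone (s ∷ T) cs
... | ps ∷ pss = (Col-length c ∷ All.map (λ le → ≤-trans le (Col-length c)) ps) ∷ (ps ∷ pss)

parts≤sum : ∀ la → All (_≤ sum la) la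
parts≤sum [] = []
parts≤sum (l ∷ la) = m≤m+n l (sum la) ∷ All.map (λ le → ≤-trans le (m≤n+m (sum la) l)) (parts≤sum la)

Col-map : ∀ (f : ℕ → ℕ) {r s} → (∀ x y → x ∈ r → y ∈ s → x < y → f x < f y) → Col r s → Col (map f r) (map f s)
Col-map f mono [] = []
Col-map f mono (lt ∷ c) = mono _ _ (here refl) (here refl) lt ∷ Col-map f
    (λ x y x∈ y∈ → mono x y (there x∈) (there y∈)) c

Weak-map : ∀ (f : ℕ → ℕ) {r} → (∀ x y → x ∈ r → y ∈ r → x < y → f x ≤ f y) → Increasing r → Weak (map f r)
Weak-map f mono [] = []
Weak-map f mono (ps ∷ pss) = Allₚ.map⁺ (All.tabulate λ m → mono _ _ (here refl) (there m) (All.lookup ps m)) ∷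
  Weak-map f (λ x y x∈ y∈ → mono x y (there x∈) (there y∈)) pss

ssyt : List ℕ → List ℕ → List Tableau
ssyt la α = filterᵇ (λ T → isSSYT T ∧ hasContent α (concat T)) (fillings la (length α))

ssyt-unique : ∀ la α → Unique (ssyt la α)
ssyt-unique la α = Uniqueₚ.filter⁺ _ (fillings-unique la (length α))

module _ la α {S} (S∈ : S ∈ ssyt la α) where
  private
    S∈' : S ∈ fillings la (length α) × (isSSYT S ∧ hasContent α (concat S)) ≡ true
    S∈' = ∈-filterᵇ⁻ (λ T → isSSYT T ∧ hasContent α (concat T)) (fillings la (length α)) S∈
    has : hasContent α (concat S) ≡ true
    has = proj₂ (∧-true {isSSYT S} (proj₂ S∈'))
    isS : isSSYT S ≡ true
    isS = proj₁ (∧-true (proj₂ S∈'))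

  ssyt-shape : map length S ≡ la
  ssyt-shape = proj₁ (∈-fillings⁻ la (proj₁ S∈'))

  ssyt-degree : sum la ≡ sum α
  ssyt-degree = trans (cong sum (sym ssyt-shape))
      (trans (sym (length-concat S)) (hasContent⇒length α (concat S) has))

  ssyt-filling : Filling (length S) (sortedWord 1 α) (rowAt S)
  ssyt-filling = fromTableau S (All.map (wincr⇒Weak _) (allB⁻ S (proj₁ (∧-true isS))))
      (colsStrict⇒Cols S (proj₂ (∧-true {allB wincr S} isS)))
    (sortedWord-antitone 1 α) (hasContent⇒count α (concat S)
        (Allₚ.concat⁺ (proj₂ (∈-fillings⁻ la (proj₁ S∈')))) has)

-- Fibres of P and the comparison of coefficients

module Main (n : ℕ) (G : SCGraph n) (ax : Axiom1 G)
  (perm : ∀ v → v ∈ V G → IsPerm n v)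
  (σ≡ : ∀ v → v ∈ V G → σ G v ≡ sig n v)
  (knuth : ∀ i v w → 1 < i → i < n → v ∈ V G → Admits G i v → E G i v w → KnuthEq w (dW i v)) where

  open Morphism n G ax perm σ≡ knuth public

  fibre : Tableau → ℕ
  fibre T = tally (λ v → P v ==T T) (V G)

  -- E_i maps the fibre over T injectively into the fibre over d_i T.
  fibre-exchange : ∀ k p {a b c z} → (b ≤ c × c < a) ⊎ (a ≤ c × c < b) → All (_< k) (p ++ a ∷ b ∷ c ∷ z) →
    length (p ++ a ∷ b ∷ c ∷ z) ≡ n →
    fibre (tableau k (numbered (p ++ a ∷ b ∷ c ∷ z))) ≤ fibre (tableau k (numbered (p ++ b ∷ a ∷ c ∷ z)))
  fibre-exchange k p {a} {b} {c} {z} mid y<k len = pigeonhole {R = E G (suc m)} injective _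
      (Uniqueₚ.filter⁺ _ (V-unique G)) neighbour
    where
    m : ℕ
    m = suc (length z)
    T T' : Tableau
    T = tableau k (numbered (p ++ a ∷ b ∷ c ∷ z))
    T' = tableau k (numbered (p ++ b ∷ a ∷ c ∷ z))
    m<n : suc m < n
    m<n = ≤-trans (m≤n+m (2 + m) (length p)) (≤-reflexive (trans (sym (length-++ p)) len))
    injective : ∀ {x x' y} → E G (suc m) x y → E G (suc m) x' y → x ≡ x'
    injective e e' = Axiom1.unique ax (suc m) (s≤s (s≤s z≤n)) m<n _ _ _ (E-sym G _ _ _ e) (E-sym G _ _ _ e')
    neighbour : ∀ v → v ∈ filterᵇ (λ v → P v ==T T) (V G) → ∃ λ w → w ∈ filterᵇ (λ v → P v ==T T') (V G) × E G
        (suc m) v w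
    neighbour v v∈F with ∈-filterᵇ⁻ (λ v → P v ==T T) (V G) v∈F
    ... | v∈ , PvT = w , ∈-filterᵇ⁺ (λ v → P v ==T T') (proj₂ (E-inV G _ _ _ e)) (==T⁺ Pw≡) , e
      where
      Pv≡ : P v ≡ T
      Pv≡ = ==T⁻ PvT
      sign : ∀ j → 1 ≤ j → j < n → sgnAt (σ G v) j ≡ isBefore j (suc j) (reading T)
      sign j 1≤j j<n = trans (cong (λ t → sgnAt t j) (σ≡ v v∈)) (trans (sgnAt-sig n v j 1≤j j<n)
        (trans (P-isBefore v (uniq v∈) j) (cong (λ t → isBefore j (suc j) (reading t)) Pv≡)))
      -- With i - 1 between i and i + 1 the two signs at i differ, so Axiom 1 supplies the edge.
      admits : Admits G (suc m) v
      admits eq = Exchange.signs-differ k p a b c z mid y<k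
        (trans (sym (sign m (s≤s z≤n) (<-trans (n<1+n m) m<n))) (trans eq (sign (suc m) (s≤s z≤n) m<n)))
      w = proj₁ (Axiom1.cover ax (suc m) (s≤s (s≤s z≤n)) m<n v v∈ admits)
      e = proj₂ (Axiom1.cover ax (suc m) (s≤s (s≤s z≤n)) m<n v v∈ admits)
      Pw≡ : P w ≡ T'
      Pw≡ = trans (edge-dT (s≤s z≤n) m<n e) (trans (cong (dT (suc m)) Pv≡)
          (Exchange.dT-exchange k p a b c z mid y<k))

  -- The prefix p collects the letters passed under `add`, so that an exchange deep in the word is
  -- seen with all larger cells in front of it. Swapping the roles of a and b gives the reverse
  -- inequality.
  fibre-∼ : ∀ k p {y z} → y ∼ z → All (_< k) (p ++ y) → length (p ++ y) ≡ n →
    fibre (tableau k (numbered (p ++ y))) ≡ fibre (tableau k (numbered (p ++ z)))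
    × All (_< k) (p ++ z) × length (p ++ z) ≡ n
  fibre-∼ k p stay y<k len = refl , y<k , len
  fibre-∼ k p (q then r) y<k len with fibre-∼ k p q y<k len
  ... | eq , z<k , len' with fibre-∼ k p r z<k len'
  ...   | eq' , rest = trans eq eq' , rest
  fibre-∼ k p (add a {y} {z} q) y<k len with fibre-∼ k (p ∷ʳ a) q
      (subst (All (_< k)) (sym (++-assoc p (a ∷ []) y)) y<k) (trans (cong length (++-assoc p (a ∷ []) y)) len)
  ... | eq , z<k , len' = trans (cong (λ t → fibre (tableau k (numbered t))) (sym (++-assoc p (a ∷ []) y)))
      (trans eq (cong (λ t → fibre (tableau k (numbered t))) (++-assoc p (a ∷ []) z))) ,
    subst (All (_< k)) (++-assoc p (a ∷ []) z) z<k , trans (cong length (sym (++-assoc p (a ∷ []) z))) len'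
  fibre-∼ k p (exchange {a} {b} {c} {z} mid) y<k len = ≤-antisym (fibre-exchange k p mid y<k len)
      (fibre-exchange k p (Sum.swap mid) z<k len') , z<k , len'
    where
    z<k : All (_< k) (p ++ b ∷ a ∷ c ∷ z)
    z<k with Allₚ.++⁻ p y<k
    ... | ps , pa ∷ pb ∷ rest = Allₚ.++⁺ ps (pb ∷ pa ∷ rest)
    len' : length (p ++ b ∷ a ∷ c ∷ z) ≡ n
    len' = trans (length-++ p) (trans (sym (length-++ p)) len)

  module Coefficients (α : List ℕ) (deg : sum α ≡ n) where

    s : List ℕ
    s = sortedWord 1 α

    s-antitone : AllPairs _≥_ s
    s-antitone = sortedWord-antitone 1 α

    len-s : length s ≡ n
    len-s = trans (length-sortedWord 1 α) deg

    relabel : Tableau → Tableau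
    relabel = map (map (at s))

    compatible? : Word → Bool
    compatible? v = signCompatible n s v

    -- R v S: the standardisation of S is P v.
    R : Word → Tableau → Bool
    R v S = compatible? v ∧ (relabel (P v) ==T S)

    module Vertex {v : Word} (v∈ : v ∈ V G) where
      st : Standard (P v)
      st = P-standard v (uniq v∈)

      concat↭ : concat (P v) ↭ range1 n
      concat↭ = ↭-trans (concat-↭-reading (P v)) (↭-trans (↭-sym (P-↭ v (uniq v∈))) (perm v v∈))

      fil : Filling (length (P v)) (down n) (rowAt (P v))
      fil = fromTableau (P v) (All.map (AllPairs.map <⇒≤) (rows st)) (cols st) (down-antitone n)
        λ c → trans (countV-↭ c concat↭) (sym (countV-↭ c (down-↭ n)))

      open Filling fil public

      len-y : length y ≡ n
      len-y = trans length-y (length-down n)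

      numbered≡ : ∀ r → numbered y r ≡ rowAt (P v) r
      numbered≡ r = trans (cong (λ m → rowS r y (down m)) len-y) (rows≡ r)

      P≡ : P v ≡ tableau (length (P v)) (numbered y)
      P≡ = sym (trans (tableau-cong (length (P v)) numbered≡) (tableau-rowAt (P v)))

      relabelled-row : ∀ r → rowAt (relabel (P v)) r ≡ rowS r y s
      relabelled-row r = trans (rowAt-map (map (at s)) refl (P v) r)
          (trans (cong (map (at s)) (sym (numbered≡ r)))
        (map-at-numbered r y s (trans len-y (sym len-s))))

    -- The vertices paired with S form the fibre over the standardisation of S, which has shape la
    -- and is therefore connected to U_la. The count depends on S only through its shape.
    fibre-ssyt : ∀ la {S} → S ∈ ssyt la α → tally (λ v → R v S) (V G) ≡ countSYam (V G) la
    fibre-ssyt la {S} S∈ = trans (tally-cong (V G) λ v v∈ → bool-ext (R⇒P v∈) (P⇒R v∈))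
        (trans (proj₁ (fibre-∼ k [] (∼-superstandard k yS latS above) yS<k len-yS))
        (cong fibre (trans (cong (λ t → tableau k (numbered t))
            (superstandard-cong k λ r _ → trans (countsS r)
            (trans (sym (part-shape S r)) (cong (λ t → part t r) (ssyt-shape la α S∈)))))
          (trans (cong (λ m → tableau m (numbered (superstandard (part la) m))) k≡) (U-superstandard la)))))
      where
      k : ℕ
      k = length S
      k≡ : k ≡ length la
      k≡ = trans (sym (length-map length S)) (cong length (ssyt-shape la α S∈))
      open Filling (ssyt-filling la α S∈) renaming
          (y to yS; y<k to yS<k; lattice to latS; compatible to compatS; rows≡ to rowsS; counts to countsS;
          length-y to length-yS)
      len-yS : length yS ≡ n
      len-yS = trans length-yS len-s
      above : ∀ r → k ≤ r → countV r yS ≡ 0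
      above r k≤r = trans (countsS r) (cong length (rowAt-≥ S r k≤r))
      R⇒P : ∀ {v} → v ∈ V G → R v S ≡ true → (P v ==T tableau k (numbered yS)) ≡ true
      R⇒P {v} v∈ Rv = ==T⁺ (trans P≡ (cong₂ (λ m t → tableau m (numbered t)) k≡' y≡))
        where
        open Vertex v∈
        relabel≡ : relabel (P v) ≡ S
        relabel≡ = ==T⁻ (proj₂ (∧-true {compatible? v} Rv))
        k≡' : length (P v) ≡ k
        k≡' = trans (sym (length-map (map (at s)) (P v))) (cong length relabel≡)
        y≡ : y ≡ yS
        -- The words of P v and of S both yield the rows of S when filled with s, and both are
        -- compatible with s.
        y≡ = rowS-injective y yS s (trans len-y (sym len-s)) length-yS
          (signCompatible⇒Compatible (uniq v∈) P≡ y<k len-y len-s s-antitone (proj₁ (∧-true Rv))) compatS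
          λ r → trans (sym (relabelled-row r)) (trans (cong (λ t → rowAt t r) relabel≡) (sym (rowsS r)))
      P⇒R : ∀ {v} → v ∈ V G → (P v ==T tableau k (numbered yS)) ≡ true → R v S ≡ true
      P⇒R {v} v∈ Pv = true-∧ (Compatible⇒signCompatible (uniq v∈) Pv≡ yS<k len-yS len-s compatS) (==T⁺ (begin
          relabel (P v)                                       ≡⟨ cong relabel Pv≡ ⟩
          relabel (tableau k (numbered yS))                   ≡⟨ map-∘ (upTo k) ⟨
          tableau k (λ r → map (at s) (numbered yS r))
              ≡⟨ tableau-cong k (λ r → trans (map-at-numbered r yS s length-yS) (rowsS r)) ⟩
          tableau k (rowAt S)                                 ≡⟨ tableau-rowAt S ⟩
          S                                                   ∎))
        where
        open ≡-Reasoning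
        Pv≡ : P v ≡ tableau k (numbered yS)
        Pv≡ = ==T⁻ Pv

    relabel-ssyt : ∀ {v} → v ∈ V G → compatible? v ≡ true →
      relabel (P v) ∈ ssyt (map length (P v)) α × map length (P v) ∈ partitions n
    relabel-ssyt {v} v∈ cv = ∈-filterᵇ⁺ (λ T → isSSYT T ∧ hasContent α (concat T)) in-fillings
        (true-∧ (true-∧ (allB⁺ (Allₚ.map⁺ (All.tabulate λ m → Weak⇒wincr (weak-row m))))
            (Cols⇒colsStrict (Cols-rowAt (relabel (P v)) col-rows))) content) ,
        ∈-partsB n n n (map length (P v)) ≤-refl size (Allₚ.map⁺ (nonEmpty st))
            (All.map (λ le → ≤-trans le (≤-reflexive size)) (parts≤sum _)) (Cols⇒shape-antitone (P v) (cols st))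
      where
      open Vertex v∈
      cp : FullyCompatible y s
      cp = compatible⇒full y s (trans len-y (sym len-s))
          (signCompatible⇒Compatible (uniq v∈) P≡ y<k len-y len-s s-antitone cv)
      size : sum (map length (P v)) ≡ n
      size = trans (sym (length-concat (P v))) (trans (↭-length concat↭) (length-range1 n))
      letter : ∀ {x r} → x ∈ r → r ∈ P v → 1 ≤ x × x ≤ n
      letter x∈ r∈ = ∈-range1⁻ (∈-resp-↭ concat↭ (∈-concat⁺′ x∈ r∈))
      ≤s : ∀ {x} → x ≤ n → x ≤ length s
      ≤s x≤ = ≤-trans x≤ (≤-reflexive (sym len-s))
      shape : map length (relabel (P v)) ≡ map length (P v)
      shape = trans (sym (map-∘ (P v))) (map-cong (length-map (at s)) (P v))
      in-fillings : relabel (P v) ∈ fillings (map length (P v)) (length α)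
      in-fillings = subst (λ t → relabel (P v) ∈ fillings t (length α)) shape (∈-fillings⁺ (relabel (P v))
        (Allₚ.map⁺ (All.tabulate λ r∈ → Allₚ.map⁺ (All.tabulate λ x∈ → at-letter (letter x∈ r∈)))))
        where
        at-letter : ∀ {x} → 1 ≤ x × x ≤ n → Letter (length α) (at s x)
        at-letter (1≤x , x≤) with sortedWord-letters 1 α (at-∈ s 1≤x (≤s x≤))
        ... | 1≤ , <ℓ = 1≤ , s≤s⁻¹ <ℓ
      weak-row : ∀ {r} → r ∈ P v → Weak (map (at s) r)
      weak-row r∈ = Weak-map (at s) (λ x y x∈ y∈ x<y → at-mono s s-antitone (proj₁ (letter x∈ r∈)) (<⇒≤ x<y)
          (≤s (proj₂ (letter y∈ r∈)))) (All.lookup (rows st) r∈)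
      col-rows : ∀ r → Col (rowAt (relabel (P v)) r) (rowAt (relabel (P v)) (suc r))
      col-rows r = subst₂ Col (sym (rowAt-map (map (at s)) refl (P v) r))
          (sym (rowAt-map (map (at s)) refl (P v) (suc r)))
        (Col-map (at s) strict (rowAt-Col (P v) (cols st) r))
        where
        cell : ∀ {x} r → x ∈ rowAt (P v) r → 1 ≤ x × x ≤ length y × at y x ≡ r
        cell r x∈ = numbered-∈⁻ y r (subst (_ ∈_) (sym (numbered≡ r)) x∈)
        -- Were the two letters equal, compatibility would put j weakly below i, whereas j lies one
        -- row above.
        strict : ∀ i j → i ∈ rowAt (P v) r → j ∈ rowAt (P v) (suc r) → i < j → at s i < at s j
        strict i j i∈ j∈ i<j with cell r i∈ | cell (suc r) j∈
        ... | 1≤i , _ , i-row | _ , j≤ , j-row = ≤∧≢⇒< (at-mono s s-antitone 1≤i (<⇒≤ i<j) j≤s)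
            λ eq → n≮n r (subst₂ _≤_ j-row i-row (cp i j 1≤i (<⇒≤ i<j) j≤s eq))
          where
          j≤s : j ≤ length s
          j≤s = ≤-trans j≤ (≤-reflexive (trans len-y (sym len-s)))
      content : hasContent α (concat (relabel (P v))) ≡ true
      content = count⇒hasContent α _ (trans (length-concat (relabel (P v)))
          (trans (cong sum shape) (trans size (sym deg)))) λ x →
        trans (cong (countV x) (concat-map (P v))) (trans (countV-↭ x (PermP.map⁺ (at s) concat↭))
        (trans (cong (λ m → countV x (map (at s) (range1 m))) (sym len-s))
            (trans (cong (countV x) (map-at-range1 s)) (countV-↭ x (↭-reverse s)))))

    -- The only tableau that can be paired with v is the relabelled P v, and it is semistandard of
    -- content α when the signature is compatible. The double sum is thus the same 0 or 1 as the
    -- coefficient, contributed by the shape of P v.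
    vertex-coefficient : ∀ v → v ∈ V G → coeffF n (σ G v) α ≡ sum
        (map (λ la → tally (R v) (ssyt la α)) (partitions n))
    vertex-coefficient v v∈ = trans (cong (λ t → coeffF n t α) (σ≡ v v∈))
        (trans (coeffF-signs n (sig n v) α deg) (go (compatible? v) refl))
      where
      go : ∀ b → compatible? v ≡ b → bit (compatible? v) ≡ sum
          (map (λ la → tally (R v) (ssyt la α)) (partitions n))
      go false eq = trans (cong bit eq) (sym (sum-zero (partitions n) λ la _ → tally-zero (R v) (ssyt la α)
          λ S _ → cong (_∧ (relabel (P v) ==T S)) eq))
      go true eq with relabel-ssyt v∈ eq
      ... | S∈ , la∈ = trans (cong bit eq) (sym
          (trans (sum-single (λ la → tally (R v) (ssyt la α)) (partsB-unique n n n) la∈ others)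
          (trans (tally-single (R v) (ssyt-unique (map length (P v)) α) S∈ λ S _ RS → sym
              (==T⁻ (proj₂ (∧-true {compatible? v} RS))))
          (cong bit (true-∧ eq (==T⁺ {relabel (P v)} refl))))))
        where
        others : ∀ la → la ∈ partitions n → la ≢ map length (P v) → tally (R v) (ssyt la α) ≡ 0
        others la _ la≢ = tally-zero (R v) (ssyt la α) none
          where
          none : ∀ S → S ∈ ssyt la α → R v S ≡ false
          none S S∈' with R v S in RS
          ... | false = refl
          ... | true = ⊥-elim (la≢ (trans (sym (ssyt-shape la α S∈'))
              (trans (cong (map length) (sym (==T⁻ (proj₂ (∧-true {compatible? v} RS)))))
              (trans (sym (map-∘ (P v))) (map-cong (length-map (at s)) (P v))))))

    expansion : sum (map (λ v → coeffF n (σ G v) α) (V G)) ≡ sum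
        (map (λ la → countSYam (V G) la * coeffS la α) (partitions n))
    expansion = begin
      sum (map (λ v → coeffF n (σ G v) α) (V G))
        ≡⟨ sum-cong (V G) vertex-coefficient ⟩
      sum (map (λ v → sum (map (λ la → tally (R v) (ssyt la α)) (partitions n))) (V G))
        ≡⟨ sum-swap (λ v la → tally (R v) (ssyt la α)) (V G) (partitions n) ⟩
      sum (map (λ la → sum (map (λ v → tally (R v) (ssyt la α)) (V G))) (partitions n))
        ≡⟨ sum-cong (partitions n) (λ la _ → sym (tally-swap R (V G) (ssyt la α))) ⟩
      sum (map (λ la → sum (map (λ S → tally (λ v → R v S) (V G)) (ssyt la α))) (partitions n))
        ≡⟨ sum-cong (partitions n) (λ la _ → trans (sum-cong (ssyt la α) (λ S S∈ → fibre-ssyt la S∈))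
            (sum-const (countSYam (V G) la) (ssyt la α))) ⟩
      sum (map (λ la → countSYam (V G) la * coeffS la α) (partitions n)) ∎
      where open ≡-Reasoning

  -- Both sides are homogeneous of degree n.
  degree-mismatch : ∀ α → sum α ≢ n →
    sum (map (λ v → coeffF n (σ G v) α) (V G)) ≡ sum
        (map (λ la → countSYam (V G) la * coeffS la α) (partitions n))
  degree-mismatch α ≢n = trans (sum-zero (V G) λ v _ → coeffF-degree n (σ G v) α ≢n)
    (sym (sum-zero (partitions n) λ la la∈ → trans (cong (countSYam (V G) la *_) (no-ssyt la la∈))
        (*-zeroʳ (countSYam (V G) la))))
    where
    no-ssyt : ∀ la → la ∈ partitions n → coeffS la α ≡ 0
    no-ssyt la la∈ with ssyt la α in eq
    ... | [] = refl
    ... | S ∷ _ = ⊥-elim (≢n (trans (sym (ssyt-degree la α (subst (S ∈_) (sym eq) (here refl))))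
        (partsB-sum n n n la∈)))

theorem3p13 : (n : ℕ) (G : SCGraph n) →
    Axiom1 G →
    (∀ v → v ∈ V G → IsPerm n v) →
    (∀ v → v ∈ V G → σ G v ≡ sig n v) →
    (∀ i v w → 1 < i → i < n → v ∈ V G → Admits G i v → E G i v w → KnuthEq w (dW i v)) →
    IsPMorphism G
    × (∀ (α : List ℕ) →
    sum (map (λ v → coeffF n (σ G v) α) (V G))
    ≡ sum (map (λ la → countSYam (V G) la * coeffS la α) (partitions n)))
theorem3p13 n G ax perm σ≡ knuth = P-morphism , coefficient
  where
  open Main n G ax perm σ≡ knuth
  coefficient : ∀ α → sum (map (λ v → coeffF n (σ G v) α) (V G)) ≡ sum
      (map (λ la → countSYam (V G) la * coeffS la α) (partitions n))
  coefficient α with sum α ≟ n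
  ... | yes deg = Coefficients.expansion α deg
  ... | no ≢n = degree-mismatch α ≢n
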